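{- Let $q$ be a prime power, $n\ge1$, and $L(x)=\sum_{i=0}^{n-1}a_ix^{q^{2i}}$ with $a_i\in\mathbb F_{q^{2n}}$. For $c\in\mathbb F_{q^2}$ let $N_c$ be the number of $x\in\mathbb F_{q^{2n}}$ with $\mathrm{Tr}(xL(x^q))+c=0$. Then \[N_0=q^{2(n-1)}+(q-1)q^{2(n-1)}\sum_{\upsilon\in U}(-q)^{ -R(\upsilon)}\] and, for $c\in\mathbb F_{q^2}^*$, \[N_c=q^{2(n-1)}+q^{2n-1}(-q)^{ -R(-c^{1-q})}-q^{2(n-1)}\sum_{\upsilon\in U}(-q)^{ -R(\upsilon)}.\]
   Context: $\mathrm{Tr}$ is the trace map of $\mathbb F_{q^{2n}}/\mathbb F_{q^2}$. $L^*(x)=\sum_{i=0}^{n-1}(a_i^qx)^{q^{2(n-i-1)}}$. $U$ is the subgroup of order $q+1$ of $\mathbb F_{q^2}^*$, and for $\upsilon\in U$, $R(\upsilon)=n-\dim\ker(\upsilon L^*+L)$, where $\ker$ denotes the zero set in $\mathbb F_{q^{2n}}$ viewed as an $\mathbb F_{q^2}$-subspace and $\dim$ is over $\mathbb F_{q^2}$. -}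

module Defs where

open import Level using (Level)
open import Data.Nat as ℕ using (ℕ; zero; suc; _∸_; NonZero)
open import Data.Nat.Properties using (m^n≢0)
open import Data.Fin using (Fin; toℕ)
import Data.Fin as Fin
open import Data.List using (List; length; filter; foldr; map)
open import Data.List.Relation.Unary.Any using (Any)
open import Data.List.Relation.Unary.AllPairs using (AllPairs)
open import Data.Product using (Σ; _×_; ∃)
open import Relation.Nullary using (¬_; Dec)
open import Relation.Binary.PropositionalEquality using (_≡_)
open import Algebra.Bundles using (CommutativeRing)
open import Data.Integer as ℤ using (ℤ; +_)
open import Data.Rational as ℚ using (ℚ; _/_)

ℕ→ℚ : ℕ → ℚ
ℕ→ℚ m = (+ m) / 1

-- (-q)^(-r) = (-1)^r / q^r   (junk value 0 for q = 0, never used since q is a prime power)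
negQPow : ℕ → ℕ → ℚ
negQPow zero    r = ℚ.0ℚ
negQPow (suc m) r = ((ℤ.- ℤ.1ℤ) ℤ.^ r) / (suc m ℕ.^ r)
  where instance _ = m^n≢0 (suc m) r

sumℚ : List ℚ → ℚ
sumℚ = foldr ℚ._+_ ℚ.0ℚ

module _ {c ℓ : Level} (R : CommutativeRing c ℓ) where
  open CommutativeRing R

  pow : Carrier → ℕ → Carrier
  pow x zero    = 1#
  pow x (suc m) = x * pow x m

  ∑ : (k : ℕ) → (Fin k → Carrier) → Carrier
  ∑ zero    f = 0#
  ∑ (suc k) f = f Fin.zero + ∑ k (λ i → f (Fin.suc i))

  record IsFiniteFieldOfSize (m : ℕ) : Set (c Level.⊔ ℓ) where
    field
      _≟_      : (x y : Carrier) → Dec (x ≈ y)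
      nontriv  : ¬ (1# ≈ 0#)
      inverse  : (x : Carrier) → ¬ (x ≈ 0#) → ∃ λ y → x * y ≈ 1#
      elems    : List Carrier
      complete : (x : Carrier) → Any (x ≈_) elems
      distinct : AllPairs (λ a b → ¬ (a ≈ b)) elems
      size     : length elems ≡ m

  module Setup (q n : ℕ) (a : Fin n → Carrier) where

    InFq2 : Carrier → Set ℓ
    InFq2 x = pow x (q ℕ.^ 2) ≈ x

    -- membership in U, the subgroup of order q+1 of F_{q^2}^*
    InU : Carrier → Set ℓ
    InU v = pow v (q ℕ.+ 1) ≈ 1#

    L : Carrier → Carrier
    L x = ∑ n (λ i → a i * pow x (q ℕ.^ (2 ℕ.* toℕ i)))

    L* : Carrier → Carrier
    L* x = ∑ n (λ i → pow (pow (a i) q * x) (q ℕ.^ (2 ℕ.* (n ∸ toℕ i ∸ 1))))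

    Tr : Carrier → Carrier
    Tr y = ∑ n (λ j → pow y (q ℕ.^ (2 ℕ.* toℕ j)))

    InKer : Carrier → Carrier → Set ℓ
    InKer υ x = υ * L* x + L x ≈ 0#

    HasDimension : (Carrier → Set ℓ) → ℕ → Set (c Level.⊔ ℓ)
    HasDimension P d = Σ (Fin d → Carrier) λ b →
        ((i : Fin d) → P (b i))
      × ((coef : Fin d → Carrier) → ((i : Fin d) → InFq2 (coef i)) →
           ∑ d (λ i → coef i * b i) ≈ 0# → (i : Fin d) → coef i ≈ 0#)
      × ((x : Carrier) → P x →
           Σ (Fin d → Carrier) λ coef → ((i : Fin d) → InFq2 (coef i))
             × (x ≈ ∑ d (λ i → coef i * b i)))

    module Count {m : ℕ} (FF : IsFiniteFieldOfSize m) where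
      open IsFiniteFieldOfSize FF

      N : Carrier → ℕ
      N c = length (filter (λ x → (Tr (x * L (pow x q)) + c) ≟ 0#) elems)

      Ulist : List Carrier
      Ulist = filter (λ v → (pow v (q ℕ.+ 1)) ≟ 1#) elems

      SumU : (Carrier → ℕ) → ℚ
      SumU dim = sumℚ (map (λ υ → negQPow q (n ∸ dim υ)) Ulist)

{-# OPTIONS --safe #-}

-- Character sums are replaced by counting. For υ ∈ U put M(z) = υ L*(z^q) + L(z^q) and
-- h(y, z) = Tr(y M(z)). Then υ h(y, z)^q = h(z, y), the radical of h has as many elements as
-- ker(υ L* + L), and g(x) = h(x, x) = f(x) + υ f(x)^q with f(x) = Tr(x L(x^q)) takes values in the
-- F_q-line W = {s : υ s^q = s}. Scaling x by F* shows that all nonzero values in W are attained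
-- equally often, say M₀ times; let Z be the number of zeros of g. Counting the pairs with
-- g(x) = g(y) gives (Z - M₀)² = q^(2n) |ker|, a square, and the free action of U on the nonzero x
-- gives Z - M₀ ≡ 1 modulo q + 1, which fixes the sign: Z - M₀ = q^(2n) (-q)^(-R(υ)).
-- Finally, with z = f(x) + c, a nonzero z satisfies z + υ z^q = 0 for exactly one υ ∈ U and z = 0
-- for all q + 1 of them, so summing the counts of these x over U gives q N_c + q^(2n).
module Submission where

open import Defs
open import Level using (Level; _⊔_; 0ℓ)
open import Algebra.Bundles using (AbelianGroup; CommutativeMonoid; CommutativeRing)
open import Data.Empty using (⊥; ⊥-elim)
open import Data.Fin using (Fin; toℕ)
import Data.Fin as Fin
import Data.Fin.Properties as Fin
open import Data.Integer as ℤ using (ℤ; +_)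
import Data.Integer.Divisibility.Signed as ℤ
import Data.Integer.Properties as ℤ
open import Data.Integer.Tactic.RingSolver using () renaming (solve-∀ to solve-ℤ)
open import Data.List using (List; []; _∷_; concat; filter; foldr; length; map)
import Data.List.Properties as List
open import Data.List.Relation.Unary.All as All using (All; []; _∷_)
import Data.List.Relation.Unary.All.Properties as All
open import Data.List.Relation.Unary.AllPairs as AllPairs using (AllPairs; []; _∷_)
import Data.List.Relation.Unary.AllPairs.Properties as AllPairs
open import Data.List.Relation.Unary.Any as Any using (Any; here; there)
import Data.List.Relation.Unary.Any.Properties as Any
open import Data.Nat as ℕ using (ℕ; zero; suc; z≤n; s≤s; _≤_; _<_; NonZero)
open import Data.Nat.Base using (_!)
open import Data.Nat.Combinatorics using (_C_; nCn≡1; nCk≡n!/k![n-k]!; k![n∸k]!∣n!)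
open import Data.Nat.Divisibility as ℕ using (_∣_; divides; _∣0; ∣m∣n⇒∣m+n; >⇒∤)
open import Data.Nat.DivMod using (m/n*n≡m)
open import Data.Nat.Primality using (Prime; euclidsLemma; prime⇒nonZero; prime⇒nonTrivial)
import Data.Nat.Properties as ℕ
open import Data.Nat.Tactic.RingSolver using (solve-∀)
open import Data.Product using (Σ; ∃; _×_; _,_; proj₁; proj₂)
open import Data.Rational as ℚ using (ℚ; _/_; toℚᵘ)
import Data.Rational.Properties as ℚ
open import Data.Rational.Unnormalised as ℚᵘ using (mkℚᵘ)
import Data.Rational.Unnormalised.Properties as ℚᵘ
open import Data.Sum using (_⊎_; inj₁; inj₂)
open import Function using (_∘_)
open import Relation.Binary.PropositionalEquality as ≡ using (_≡_)
open import Relation.Nullary using (¬_; Dec; yes; no; ¬?)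
open import Relation.Nullary.Decidable using (_×-dec_; dec⇒maybe)
open import Tactic.RingSolver using () renaming (solve-∀ to solve-ring)
open import Tactic.RingSolver.Core.AlmostCommutativeRing using (AlmostCommutativeRing; fromCommutativeRing)

-- One squeeze carries the structural facts. If ab elements are mapped into a set of at most b
-- elements and no fibre exceeds a, then every fibre has exactly a elements, and for a > 0 the set
-- has exactly b. Both upper bounds are degree bounds for polynomials. Used with power maps, this
-- gives the order of U, the size of F_{q^2} and the surjectivity of the norm onto F_q^*, without a
-- generator of the multiplicative group. Used with y ↦ Tr(yμ) + υ Tr(yμ)^q, it gives |W| = q and
-- the equidistribution of these maps on W, which replaces the nondegeneracy of the trace and the
-- orthogonality of characters. The factor υ ∈ U is what makes a Hermitian form available: f itself
-- is the diagonal of a form without symmetry, and each υ yields one way to symmetrise it. The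
-- constant c enters only through c + υ c^q. This vanishes for every υ when c = 0 and for exactly
-- one υ when c ≠ 0, which is why the two formulas differ in shape and why R is singled out at
-- -c^(1-q).

module ListSum {c ℓ : Level} (M : CommutativeMonoid c ℓ) where
  open CommutativeMonoid M
  open import Algebra.Properties.CommutativeSemigroup commutativeSemigroup using (interchange)
  open import Relation.Binary.Reasoning.Setoid setoid

  private variable
    a b p r : Level
    A : Set a
    B : Set b
    P : Set p
    P′ : Set r

  ∑ₗ : List A → (A → Carrier) → Carrier
  ∑ₗ xs w = foldr (λ x s → w x ∙ s) ε xs

  when : Dec P → Carrier → Carrier
  when (yes _) m = m
  when (no _)  m = ε

  when-cong : (d : Dec P) {m m′ : Carrier} → (P → m ≈ m′) → when d m ≈ when d m′
  when-cong (yes p) e = e p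
  when-cong (no _)  _ = refl

  when-⇔ : (d : Dec P) (d′ : Dec P′) → (P → P′) → (P′ → P) →
           (m : Carrier) → when d m ≈ when d′ m
  when-⇔ (yes _) (yes _) _ _ _ = refl
  when-⇔ (yes p) (no ¬p) f _ _ = ⊥-elim (¬p (f p))
  when-⇔ (no ¬p) (yes p) _ g _ = ⊥-elim (¬p (g p))
  when-⇔ (no _)  (no _)  _ _ _ = refl

  when-yes : (d : Dec P) → P → (m : Carrier) → when d m ≈ m
  when-yes (yes _) _ _ = refl
  when-yes (no ¬p) p _ = ⊥-elim (¬p p)

  when-no : (d : Dec P) → ¬ P → (m : Carrier) → when d m ≈ ε
  when-no (yes p) ¬p _ = ⊥-elim (¬p p)
  when-no (no _)  _  _ = refl

  ∑ₗ-cong : (xs : List A) {w v : A → Carrier} → (∀ x → w x ≈ v x) → ∑ₗ xs w ≈ ∑ₗ xs v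
  ∑ₗ-cong []       _ = refl
  ∑ₗ-cong (x ∷ xs) e = ∙-cong (e x) (∑ₗ-cong xs e)

  ∑ₗ-ε : (xs : List A) → ∑ₗ xs (λ _ → ε) ≈ ε
  ∑ₗ-ε []       = refl
  ∑ₗ-ε (_ ∷ xs) = trans (identityˡ _) (∑ₗ-ε xs)

  ∑ₗ-∙ : (xs : List A) (w v : A → Carrier) →
         ∑ₗ xs (λ x → w x ∙ v x) ≈ ∑ₗ xs w ∙ ∑ₗ xs v
  ∑ₗ-∙ []       w v = sym (identityˡ ε)
  ∑ₗ-∙ (x ∷ xs) w v = trans (∙-congˡ (∑ₗ-∙ xs w v)) (interchange _ _ _ _)

  ∑ₗ-swap : (xs : List A) (ys : List B) (w : A → B → Carrier) →
            ∑ₗ xs (λ x → ∑ₗ ys (w x)) ≈ ∑ₗ ys (λ y → ∑ₗ xs (λ x → w x y))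
  ∑ₗ-swap []       ys w = sym (∑ₗ-ε ys)
  ∑ₗ-swap (x ∷ xs) ys w = trans (∙-congˡ (∑ₗ-swap xs ys w)) (sym (∑ₗ-∙ ys _ _))

  ∑ₗ-filter : {P : A → Set p} (P? : ∀ x → Dec (P x)) (xs : List A) (w : A → Carrier) →
              ∑ₗ (filter P? xs) w ≈ ∑ₗ xs (λ x → when (P? x) (w x))
  ∑ₗ-filter P? []       w = refl
  ∑ₗ-filter P? (x ∷ xs) w with P? x
  ... | yes _ = ∙-congˡ (∑ₗ-filter P? xs w)
  ... | no _  = trans (∑ₗ-filter P? xs w) (sym (identityˡ _))

-- Sums over all elements of a finite field.

module FieldSum {c ℓ : Level} (R : CommutativeRing c ℓ) {m : ℕ} (FF : IsFiniteFieldOfSize R m)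
                {c′ ℓ′ : Level} (M : CommutativeMonoid c′ ℓ′) where
  open IsFiniteFieldOfSize FF
  private
    module K = CommutativeRing R
    module M = CommutativeMonoid M
  open ListSum M public
  open import Relation.Binary.Reasoning.Setoid M.setoid

  ∑ᴷ : (K.Carrier → M.Carrier) → M.Carrier
  ∑ᴷ = ∑ₗ elems

  delta-∉ : (xs : List K.Carrier) (a : K.Carrier) (w : M.Carrier) →
            All (λ x → ¬ (a K.≈ x)) xs → ∑ₗ xs (λ x → when (x ≟ a) w) M.≈ M.ε
  delta-∉ []       a w []         = M.refl
  delta-∉ (x ∷ xs) a w (a≉x ∷ ns) = begin
    when (x ≟ a) w M.∙ ∑ₗ xs (λ x → when (x ≟ a) w)
      ≈⟨ M.∙-cong (when-no (x ≟ a) (λ e → a≉x (K.sym e)) w) (delta-∉ xs a w ns) ⟩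
    M.ε M.∙ M.ε ≈⟨ M.identityˡ _ ⟩
    M.ε         ∎

  private
    absent : {x a : K.Carrier} (xs : List K.Carrier) → a K.≈ x →
             All (λ y → ¬ (x K.≈ y)) xs → All (λ y → ¬ (a K.≈ y)) xs
    absent []       e []       = []
    absent (_ ∷ xs) e (n ∷ ns) = (λ a≈y → n (K.trans (K.sym e) a≈y)) ∷ absent xs e ns

  delta-∈ : (xs : List K.Carrier) → AllPairs (λ a b → ¬ (a K.≈ b)) xs →
            (a : K.Carrier) (w : M.Carrier) → Any (a K.≈_) xs →
            ∑ₗ xs (λ x → when (x ≟ a) w) M.≈ w
  delta-∈ (x ∷ xs) (d ∷ ds) a w (here a≈x) = begin
    when (x ≟ a) w M.∙ ∑ₗ xs (λ x → when (x ≟ a) w)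
      ≈⟨ M.∙-cong (when-yes (x ≟ a) (K.sym a≈x) w) (delta-∉ xs a w (absent xs a≈x d)) ⟩
    w M.∙ M.ε ≈⟨ M.identityʳ _ ⟩
    w         ∎
  delta-∈ (x ∷ xs) (d ∷ ds) a w (there a∈xs) = begin
    when (x ≟ a) w M.∙ ∑ₗ xs (λ x → when (x ≟ a) w)
      ≈⟨ M.∙-cong (when-no (x ≟ a) (λ x≈a → differ d a∈xs x≈a) w) (delta-∈ xs ds a w a∈xs) ⟩
    M.ε M.∙ w ≈⟨ M.identityˡ _ ⟩
    w         ∎
    where
    differ : {ys : List K.Carrier} → All (λ y → ¬ (x K.≈ y)) ys → Any (a K.≈_) ys → ¬ (x K.≈ a)
    differ (n ∷ _)  (here a≈y)  x≈a = n (K.trans x≈a a≈y)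
    differ (_ ∷ ns) (there a∈) x≈a = differ ns a∈ x≈a

  delta : (a : K.Carrier) (w : M.Carrier) → ∑ᴷ (λ x → when (x ≟ a) w) M.≈ w
  delta a w = delta-∈ elems distinct a w (complete a)

  ∑-fibres : (φ : K.Carrier → K.Carrier) (w : K.Carrier → M.Carrier) →
             ∑ᴷ w M.≈ ∑ᴷ (λ s → ∑ᴷ (λ x → when (s ≟ φ x) (w x)))
  ∑-fibres φ w = begin
    ∑ᴷ w                                        ≈⟨ ∑ₗ-cong elems (λ x → delta (φ x) (w x)) ⟨
    ∑ᴷ (λ x → ∑ᴷ (λ s → when (s ≟ φ x) (w x)))   ≈⟨ ∑ₗ-swap elems elems _ ⟩
    ∑ᴷ (λ s → ∑ᴷ (λ x → when (s ≟ φ x) (w x)))   ∎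

  -- The two implications make σ and τ mutually inverse up to ≈, and congruence of both maps follows
  -- from them. Each s therefore receives exactly one summand, from the entry of `elems` that
  -- represents τ s.
  ∑-reindex : (σ τ : K.Carrier → K.Carrier) →
              (∀ {x y} → σ x K.≈ y → x K.≈ τ y) → (∀ {x y} → x K.≈ τ y → σ x K.≈ y) →
              (w : K.Carrier → M.Carrier) → (∀ {x y} → x K.≈ y → w x M.≈ w y) →
              ∑ᴷ (λ x → w (σ x)) M.≈ ∑ᴷ w
  ∑-reindex σ τ to from w w-cong = begin
    ∑ᴷ (λ x → w (σ x))                               ≈⟨ ∑-fibres σ (λ x → w (σ x)) ⟩
    ∑ᴷ (λ s → ∑ᴷ (λ x → when (s ≟ σ x) (w (σ x))))    ≈⟨ ∑ₗ-cong elems inner ⟩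
    ∑ᴷ w                                             ∎
    where
    inner : ∀ s → ∑ᴷ (λ x → when (s ≟ σ x) (w (σ x))) M.≈ w s
    inner s = begin
      ∑ᴷ (λ x → when (s ≟ σ x) (w (σ x)))
        ≈⟨ ∑ₗ-cong elems (λ x → when-cong (s ≟ σ x) (λ e → w-cong (K.sym e))) ⟩
      ∑ᴷ (λ x → when (s ≟ σ x) (w s))
        ≈⟨ ∑ₗ-cong elems (λ x → when-⇔ (s ≟ σ x) (x ≟ τ s) (λ e → to (K.sym e)) (λ e → K.sym (from e)) (w s)) ⟩
      ∑ᴷ (λ x → when (x ≟ τ s) (w s))
        ≈⟨ delta (τ s) (w s) ⟩
      w s ∎

-- Powers and finite sums in a commutative ring.

module Powers {c ℓ : Level} (R : CommutativeRing c ℓ) where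
  open CommutativeRing R
  open import Algebra.Properties.Semiring.Exp semiring
  import Algebra.Properties.CommutativeSemiring.Exp commutativeSemiring as Exp

  pow≡^ : ∀ x e → pow R x e ≡ x ^ e
  pow≡^ x zero    = ≡.refl
  pow≡^ x (suc e) = ≡.cong (x *_) (pow≡^ x e)

  pow-cong : ∀ e {x y} → x ≈ y → pow R x e ≈ pow R y e
  pow-cong zero    _ = refl
  pow-cong (suc e) h = *-cong h (pow-cong e h)

  pow-≡ : ∀ x {d e} → d ≡ e → pow R x d ≈ pow R x e
  pow-≡ x ≡.refl = refl

  pow-* : ∀ x d e → pow R x (d ℕ.* e) ≈ pow R (pow R x d) e
  pow-* x d e rewrite pow≡^ (pow R x d) e | pow≡^ x d | pow≡^ x (d ℕ.* e) = sym (^-assocʳ x d e)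

  pow-distrib : ∀ e x y → pow R (x * y) e ≈ pow R x e * pow R y e
  pow-distrib e x y rewrite pow≡^ (x * y) e | pow≡^ x e | pow≡^ y e = Exp.^-distrib-* x y e

  pow-1# : ∀ e → pow R 1# e ≈ 1#
  pow-1# zero    = refl
  pow-1# (suc e) = trans (*-identityˡ _) (pow-1# e)

  pow-0# : ∀ e → 0 < e → pow R 0# e ≈ 0#
  pow-0# (suc e) _ = zeroˡ _

  pow-1 : ∀ x → pow R x 1 ≈ x
  pow-1 x = *-identityʳ x

module FinSum {c ℓ : Level} (R : CommutativeRing c ℓ) where
  open CommutativeRing R
  open import Algebra.Properties.CommutativeSemigroup +-commutativeSemigroup using (interchange)

  ∑-cong : ∀ k {f g : Fin k → Carrier} → (∀ i → f i ≈ g i) → ∑ R k f ≈ ∑ R k g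
  ∑-cong zero    _ = refl
  ∑-cong (suc k) e = +-cong (e Fin.zero) (∑-cong k (λ i → e (Fin.suc i)))

  ∑-0 : ∀ k → ∑ R k (λ _ → 0#) ≈ 0#
  ∑-0 zero    = refl
  ∑-0 (suc k) = trans (+-identityˡ _) (∑-0 k)

  ∑-+ : ∀ k (f g : Fin k → Carrier) → ∑ R k (λ i → f i + g i) ≈ ∑ R k f + ∑ R k g
  ∑-+ zero    f g = sym (+-identityˡ 0#)
  ∑-+ (suc k) f g = trans (+-congˡ (∑-+ k _ _)) (interchange _ _ _ _)

  ∑-*ˡ : ∀ k (a : Carrier) (f : Fin k → Carrier) → a * ∑ R k f ≈ ∑ R k (λ i → a * f i)
  ∑-*ˡ zero    a f = zeroʳ a
  ∑-*ˡ (suc k) a f = trans (distribˡ _ _ _) (+-congˡ (∑-*ˡ k a _))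

  ∑-last : ∀ k (f : ℕ → Carrier) →
           ∑ R (suc k) (λ i → f (toℕ i)) ≈ ∑ R k (λ i → f (toℕ i)) + f k
  ∑-last zero    f = trans (+-identityʳ _) (sym (+-identityˡ _))
  ∑-last (suc k) f = trans (+-congˡ (∑-last k (λ i → f (suc i)))) (sym (+-assoc _ _ _))

-- Field arithmetic, root bounds for polynomial functions, and counting.

module Field {c ℓ : Level} (R : CommutativeRing c ℓ) {m : ℕ} (FF : IsFiniteFieldOfSize R m) where
  open CommutativeRing R hiding (zero)
  open IsFiniteFieldOfSize FF public
  open Powers R public
  open import Algebra.Properties.Ring ring public
    using (-‿involutive; -0#≈0#; x+x≈x⇒x≈0; -‿distribˡ-*; -‿distribʳ-*; +-cancelˡ; +-cancelʳ)
  open import Algebra.Properties.Group +-group public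
    using (x∙y⁻¹≈ε⇒x≈y; inverseʳ-unique; inverseˡ-unique; //-rightDividesˡ; //-rightDividesʳ)
  open import Relation.Binary.Reasoning.Setoid setoid

  *≈0 : ∀ x y → x * y ≈ 0# → ¬ (x ≈ 0#) → y ≈ 0#
  *≈0 x y xy≈0 x≉0 with inverse x x≉0
  ... | x⁻¹ , xx⁻¹≈1 = begin
    y              ≈⟨ *-identityˡ y ⟨
    1# * y         ≈⟨ *-congʳ (trans (*-comm x⁻¹ x) xx⁻¹≈1) ⟨
    x⁻¹ * x * y    ≈⟨ *-assoc _ _ _ ⟩
    x⁻¹ * (x * y)  ≈⟨ *-congˡ xy≈0 ⟩
    x⁻¹ * 0#       ≈⟨ zeroʳ _ ⟩
    0#             ∎

  *≉0 : ∀ {x y} → ¬ (x ≈ 0#) → ¬ (y ≈ 0#) → ¬ (x * y ≈ 0#)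
  *≉0 x≉0 y≉0 xy≈0 = y≉0 (*≈0 _ _ xy≈0 x≉0)

  *-cancelˡ : ∀ {x} → ¬ (x ≈ 0#) → ∀ {y z} → x * y ≈ x * z → y ≈ z
  *-cancelˡ {x} x≉0 {y} {z} e = x∙y⁻¹≈ε⇒x≈y y z (*≈0 x (y - z) (begin
    x * (y - z)       ≈⟨ distribˡ x y (- z) ⟩
    x * y + x * - z   ≈⟨ +-cong e (sym (-‿distribʳ-* x z)) ⟩
    x * z - x * z     ≈⟨ -‿inverseʳ _ ⟩
    0#                ∎) x≉0)

  pow≉0 : ∀ {x} e → ¬ (x ≈ 0#) → ¬ (pow R x e ≈ 0#)
  pow≉0 zero    _   = nontriv
  pow≉0 (suc e) x≉0 = *≉0 x≉0 (pow≉0 e x≉0)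

  -- Deg< d: polynomial functions of degree less than d. Lead a d: polynomial functions a x^d + (lower order terms).
  data Deg< : ℕ → (Carrier → Carrier) → Set (c ⊔ ℓ) where
    null   : ∀ {f} → (∀ x → f x ≈ 0#) → Deg< 0 f
    horner : ∀ {d f} (b : Carrier) {g : Carrier → Carrier} → Deg< d g →
             (∀ x → f x ≈ b + x * g x) → Deg< (suc d) f

  data Lead (a : Carrier) : ℕ → (Carrier → Carrier) → Set (c ⊔ ℓ) where
    const  : ∀ {f} → (∀ x → f x ≈ a) → Lead a 0 f
    horner : ∀ {d f} (b : Carrier) {g : Carrier → Carrier} → Lead a d g →
             (∀ x → f x ≈ b + x * g x) → Lead a (suc d) f

  private
    +-horner : ∀ x b b′ y y′ → (b + x * y) + (b′ + x * y′) ≈ (b + b′) + x * (y + y′)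
    +-horner x b b′ y y′ = trans (interchange b (x * y) b′ (x * y′)) (+-congˡ (sym (distribˡ x y y′)))
      where open import Algebra.Properties.CommutativeSemigroup +-commutativeSemigroup using (interchange)

  Deg<-+ : ∀ {d f g} → Deg< d f → Deg< d g → Deg< d (λ x → f x + g x)
  Deg<-+ (null e) (null e′) = null (λ x → trans (+-cong (e x) (e′ x)) (+-identityʳ 0#))
  Deg<-+ (horner b D e) (horner b′ D′ e′) =
    horner (b + b′) (Deg<-+ D D′) (λ x → trans (+-cong (e x) (e′ x)) (+-horner x _ _ _ _))

  Deg<-null : ∀ d {f} → (∀ x → f x ≈ 0#) → Deg< d f
  Deg<-null zero    e = null e
  Deg<-null (suc d) e = horner 0# (Deg<-null d {λ _ → 0#} (λ _ → refl))
    (λ x → trans (e x) (sym (trans (+-identityˡ _) (zeroʳ x))))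

  Deg<-monomial : ∀ {d} e (a : Carrier) → e < d → Deg< d (λ x → a * pow R x e)
  Deg<-monomial {suc d} zero    a _         = horner a (Deg<-null d {λ _ → 0#} (λ _ → refl))
    (λ x → trans (*-identityʳ a) (sym (trans (+-congˡ (zeroʳ x)) (+-identityʳ a))))
  Deg<-monomial {suc d} (suc e) a (s≤s e<d) = horner 0# (Deg<-monomial e a e<d)
    (λ x → trans (x∙yz≈y∙xz a x (pow R x e)) (sym (+-identityˡ _)))
    where open import Algebra.Properties.CommutativeSemigroup *-commutativeSemigroup using (x∙yz≈y∙xz)

  Deg<-∑ : ∀ {d} k (f : Fin k → Carrier → Carrier) → (∀ i → Deg< d (f i)) →
           Deg< d (λ x → ∑ R k (λ i → f i x))
  Deg<-∑ {d} zero f D = Deg<-null d (λ _ → refl)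
  Deg<-∑ (suc k) f D = Deg<-+ (D Fin.zero) (Deg<-∑ k (λ i → f (Fin.suc i)) (λ i → D (Fin.suc i)))

  Lead-+ : ∀ {a d f g h} → Lead a d g → Deg< d h → (∀ x → f x ≈ g x + h x) → Lead a d f
  Lead-+ (const e) (null e′) h = const (λ x → trans (h x) (trans (+-cong (e x) (e′ x)) (+-identityʳ _)))
  Lead-+ (horner b L e) (horner b′ D e′) h = horner (b + b′) (Lead-+ L D (λ _ → refl))
    (λ x → trans (h x) (trans (+-cong (e x) (e′ x)) (+-horner x _ _ _ _)))

  Lead-monomial : ∀ d (a : Carrier) → Lead a d (λ x → a * pow R x d)
  Lead-monomial zero    a = const (λ _ → *-identityʳ a)
  Lead-monomial (suc d) a = horner 0# (Lead-monomial d a)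
    (λ x → trans (x∙yz≈y∙xz a x (pow R x d)) (sym (+-identityˡ _)))
    where open import Algebra.Properties.CommutativeSemigroup *-commutativeSemigroup using (x∙yz≈y∙xz)

  -- Synthetic division along the Horner recursion: if g = g(r) + (x - r) h, then b + x g has the
  -- quotient g(r) + x h. The leading coefficient is inherited unchanged, so its being nonzero
  -- survives the removal of any number of roots.
  Lead-divide : ∀ {a d f} → Lead a (suc d) f → ∀ r → Σ (Carrier → Carrier) λ g →
                Lead a d g × (∀ x → f x ≈ f r + (x - r) * g x)
  Lead-divide {a} {zero} {f} (horner b {g} (const g≈a) e) r = (λ _ → a) , const (λ _ → refl) , λ x → begin
    f x                       ≈⟨ trans (e x) (+-congˡ (*-congˡ (g≈a x))) ⟩
    b + x * a                 ≈⟨ shift b x r a ⟩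
    (b + r * a) + (x - r) * a ≈⟨ +-congʳ (trans (e r) (+-congˡ (*-congˡ (g≈a r)))) ⟨
    f r + (x - r) * a         ∎
    where
    shift : ∀ b x r a → b + x * a ≈ (b + r * a) + (x - r) * a
    shift b x r a = begin
      b + x * a                     ≈⟨ +-congˡ (*-congʳ (trans (+-congˡ (-‿inverseʳ r)) (+-identityʳ x))) ⟨
      b + (x + (r - r)) * a         ≈⟨ +-congˡ (*-congʳ (x∙yz≈y∙xz x r (- r))) ⟩
      b + (r + (x - r)) * a         ≈⟨ +-congˡ (distribʳ a r (x - r)) ⟩
      b + (r * a + (x - r) * a)     ≈⟨ +-assoc _ _ _ ⟨
      (b + r * a) + (x - r) * a     ∎
      where open import Algebra.Properties.CommutativeSemigroup +-commutativeSemigroup using (x∙yz≈y∙xz)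
  Lead-divide {a} {suc d} {f} (horner b {g} L e) r with Lead-divide L r
  ... | h , Lh , eh = (λ x → g r + x * h x) , horner (g r) Lh (λ _ → refl) , λ x → begin
    f x                                           ≈⟨ trans (e x) (+-congˡ (*-congˡ (eh x))) ⟩
    b + x * (g r + (x - r) * h x)                 ≈⟨ +-congˡ (distribˡ x (g r) _) ⟩
    b + (x * g r + x * ((x - r) * h x))           ≈⟨ +-congˡ (+-cong (*-congʳ (split x)) (x∙yz≈y∙xz x (x - r) (h x))) ⟩
    b + ((r + (x - r)) * g r + (x - r) * (x * h x))
      ≈⟨ +-congˡ (trans (+-congʳ (distribʳ (g r) r (x - r))) (+-assoc _ _ _)) ⟩
    b + (r * g r + ((x - r) * g r + (x - r) * (x * h x)))
      ≈⟨ trans (sym (+-assoc _ _ _)) (+-cong (sym (e r)) (sym (distribˡ (x - r) (g r) _))) ⟩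
    f r + (x - r) * (g r + x * h x) ∎
    where
    open import Algebra.Properties.CommutativeSemigroup *-commutativeSemigroup using (x∙yz≈y∙xz)
    open import Algebra.Properties.CommutativeSemigroup +-commutativeSemigroup using ()
      renaming (x∙yz≈y∙xz to x+yz≈y+xz)
    split : ∀ x → x ≈ r + (x - r)
    split x = trans (sym (trans (+-congˡ (-‿inverseʳ r)) (+-identityʳ x))) (x+yz≈y+xz x r (- r))

  roots-≤ : ∀ {a} d {f} → Lead a d f → ¬ (a ≈ 0#) → (xs : List Carrier) →
            AllPairs (λ x y → ¬ (x ≈ y)) xs → All (λ x → f x ≈ 0#) xs → length xs ≤ d
  roots-≤ d       _         a≉0 []       _        _        = z≤n
  roots-≤ zero    (const e) a≉0 (r ∷ xs) _        (0r ∷ _) = ⊥-elim (a≉0 (trans (sym (e r)) 0r))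
  roots-≤ (suc d) {f} L     a≉0 (r ∷ xs) (r∉ ∷ ds) (0r ∷ 0s) with Lead-divide L r
  ... | g , Lg , e = s≤s (roots-≤ d Lg a≉0 xs ds (All.zipWith root (r∉ , 0s)))
    where
    root : ∀ {x} → (¬ (r ≈ x)) × (f x ≈ 0#) → g x ≈ 0#
    root {x} (r≉x , 0x) = *≈0 (x - r) (g x)
      (trans (sym (trans (e x) (trans (+-congʳ 0r) (+-identityˡ _)))) 0x)
      (λ x-r≈0 → r≉x (sym (x∙y⁻¹≈ε⇒x≈y x r x-r≈0)))

  module ∑ℕ = FieldSum R FF ℕ.+-0-commutativeMonoid
  open ∑ℕ public using (when) renaming (∑ᴷ to Σℕ)

  -- Opaque, so that predicates can be inferred from counts.
  opaque
    # : {p : Level} {P : Carrier → Set p} → (∀ x → Dec (P x)) → ℕ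
    # P? = Σℕ (λ x → when (P? x) 1)

    #-def : {p : Level} {P : Carrier → Set p} (P? : ∀ x → Dec (P x)) → # P? ≡ Σℕ (λ x → when (P? x) 1)
    #-def P? = ≡.refl

  private variable
    p r : Level
    P : Carrier → Set p
    S : Carrier → Set r

  length-∑ₗ : (xs : List Carrier) → length xs ≡ ∑ℕ.∑ₗ xs (λ _ → 1)
  length-∑ₗ []       = ≡.refl
  length-∑ₗ (_ ∷ xs) = ≡.cong suc (length-∑ₗ xs)

  opaque
    unfolding #

    length-filter : (P? : ∀ x → Dec (P x)) → length (filter P? elems) ≡ # P?
    length-filter P? = ≡.trans (length-∑ₗ (filter P? elems)) (∑ℕ.∑ₗ-filter P? elems (λ _ → 1))

    #-⇔ : (P? : ∀ x → Dec (P x)) (S? : ∀ x → Dec (S x)) →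
          (∀ x → P x → S x) → (∀ x → S x → P x) → # P? ≡ # S?
    #-⇔ P? S? to from = ∑ℕ.∑ₗ-cong elems (λ x → ∑ℕ.when-⇔ (P? x) (S? x) (to x) (from x) 1)

    #-roots : ∀ {a d f} → Lead a d f → ¬ (a ≈ 0#) → (P? : ∀ x → Dec (P x)) →
              (∀ x → P x → f x ≈ 0#) → # P? ≤ d
    #-roots {d = d} Lf a≉0 P? root = ≡.subst (_≤ d) (length-filter P?)
      (roots-≤ d Lf a≉0 (filter P? elems) (AllPairs.filter⁺ P? distinct)
        (All.map (root _) (All.all-filter P? elems)))

    #-all : (P? : ∀ x → Dec (P x)) → (∀ x → P x) → # P? ≡ m
    #-all P? all = ≡.trans (∑ℕ.∑ₗ-cong elems (λ x → ∑ℕ.when-yes (P? x) (all x) 1))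
      (≡.trans (≡.sym (length-∑ₗ elems)) size)

    #-none : (P? : ∀ x → Dec (P x)) → (∀ x → ¬ P x) → # P? ≡ 0
    #-none P? none = ≡.trans (∑ℕ.∑ₗ-cong elems (λ x → ∑ℕ.when-no (P? x) (none x) 1)) (∑ℕ.∑ₗ-ε elems)

    #-one : (P? : ∀ x → Dec (P x)) (a : Carrier) → (∀ x → P x → x ≈ a) → (∀ x → x ≈ a → P x) → # P? ≡ 1
    #-one P? a to from = ≡.trans (#-⇔ P? (_≟ a) to from) (∑ℕ.delta a 1)

    #-∃ : (P? : ∀ x → Dec (P x)) → 0 < # P? → ∃ P
    #-∃ {P = P} P? = go elems
      where
      go : (xs : List Carrier) → 0 < ∑ℕ.∑ₗ xs (λ x → when (P? x) 1) → ∃ P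
      go (x ∷ xs) h with P? x
      ... | yes Px = x , Px
      ... | no _   = go xs h

    #-⊎ : {u v : Level} {U : Carrier → Set u} {V : Carrier → Set v} (P? : ∀ x → Dec (P x))
          (U? : ∀ x → Dec (U x)) (V? : ∀ x → Dec (V x)) →
          (∀ x → P x → U x ⊎ V x) → (∀ x → U x → P x) → (∀ x → V x → P x) → (∀ x → U x → V x → ⊥) →
          # P? ≡ # U? ℕ.+ # V?
    #-⊎ P? U? V? split U⇒P V⇒P dis = ≡.trans (∑ℕ.∑ₗ-cong elems pointwise) (∑ℕ.∑ₗ-∙ elems _ _)
      where
      pointwise : ∀ x → when (P? x) 1 ≡ when (U? x) 1 ℕ.+ when (V? x) 1
      pointwise x with P? x | U? x | V? x
      ... | yes _ | yes _ | no _ = ≡.refl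
      ... | yes _ | no _ | yes _ = ≡.refl
      ... | no _  | no _ | no _  = ≡.refl
      ... | _     | yes u | yes v = ⊥-elim (dis x u v)
      ... | yes p | no ¬u | no ¬v with split x p
      ...   | inj₁ u = ⊥-elim (¬u u)
      ...   | inj₂ v = ⊥-elim (¬v v)
      pointwise x | no ¬p | yes u | no _ = ⊥-elim (¬p (U⇒P x u))
      pointwise x | no ¬p | no _ | yes v = ⊥-elim (¬p (V⇒P x v))

-- Divisibility of binomial coefficients by a prime.

p∤k! : ∀ {p} → Prime p → ∀ k → k < p → ¬ (p ∣ k !)
p∤k! pp zero    _   p∣1 = >⇒∤ (ℕ.nonTrivial⇒n>1 _ {{prime⇒nonTrivial pp}}) p∣1
p∤k! pp (suc k) k<p p∣k! with euclidsLemma (suc k) (k !) pp p∣k!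
... | inj₁ p∣1+k = >⇒∤ k<p p∣1+k
... | inj₂ p∣k!′ = p∤k! pp k (ℕ.<-trans (ℕ.n<1+n k) k<p) p∣k!′

p∣pCk : ∀ {p} → Prime p → ∀ k → 0 < k → k < p → p ∣ p C k
p∣pCk {p@(suc p-1)} pp k@(suc k-1) 0<k k<p
  with euclidsLemma (p C k) (k ! ℕ.* (p ℕ.∸ k) !) pp
         (≡.subst (p ∣_) (≡.sym C*k!≡p!) (divides (p-1 !) (ℕ.*-comm p (p-1 !))))
  where
  instance _ = k ℕ.!* (p ℕ.∸ k) !≢0
  C*k!≡p! : (p C k) ℕ.* (k ! ℕ.* (p ℕ.∸ k) !) ≡ p !
  C*k!≡p! = ≡.trans (≡.cong (ℕ._* (k ! ℕ.* (p ℕ.∸ k) !)) (nCk≡n!/k![n-k]! (ℕ.<⇒≤ k<p)))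
                    (m/n*n≡m (k![n∸k]!∣n! (ℕ.<⇒≤ k<p)))
... | inj₁ p∣C = p∣C
... | inj₂ p∣kk with euclidsLemma (k !) ((p ℕ.∸ k) !) pp p∣kk
...   | inj₁ p∣k!   = ⊥-elim (p∤k! pp k k<p p∣k!)
...   | inj₂ p∣p-k! = ⊥-elim (p∤k! pp (p ℕ.∸ k) (s≤s (ℕ.m∸n≤m p-1 k-1)) p∣p-k!)

-- Fibre counts, and the squeeze that makes them equal.

module Fibres {c ℓ : Level} (R : CommutativeRing c ℓ) {m : ℕ} (FF : IsFiniteFieldOfSize R m) where
  open CommutativeRing R
  open Field R FF

  private variable
    p r : Level
    P : Carrier → Set p
    W : Carrier → Set r

  Σℕ-*ʳ : ∀ (xs : List Carrier) (w : Carrier → ℕ) a → ∑ℕ.∑ₗ xs (λ x → w x ℕ.* a) ≡ ∑ℕ.∑ₗ xs w ℕ.* a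
  Σℕ-*ʳ []       w a = ≡.refl
  Σℕ-*ʳ (x ∷ xs) w a = ≡.trans (≡.cong (w x ℕ.* a ℕ.+_) (Σℕ-*ʳ xs w a)) (≡.sym (ℕ.*-distribʳ-+ a (w x) _))

  when-1-* : {P : Set p} (P? : Dec P) (a : ℕ) → when P? 1 ℕ.* a ≡ when P? a
  when-1-* (yes _) a = ℕ.*-identityˡ a
  when-1-* (no _)  a = ≡.refl

  Σℕ-when : (P? : ∀ x → Dec (P x)) (a : ℕ) → Σℕ (λ x → when (P? x) a) ≡ # P? ℕ.* a
  Σℕ-when P? a rewrite #-def P? = ≡.trans (∑ℕ.∑ₗ-cong elems (λ x → ≡.sym (when-1-* (P? x) a)))
                         (Σℕ-*ʳ elems (λ x → when (P? x) 1) a)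

  Σℕ-mono : (xs : List Carrier) (F G : Carrier → ℕ) → (∀ x → F x ≤ G x) → ∑ℕ.∑ₗ xs F ≤ ∑ℕ.∑ₗ xs G
  Σℕ-mono []       F G _   = z≤n
  Σℕ-mono (x ∷ xs) F G F≤G = ℕ.+-mono-≤ (F≤G x) (Σℕ-mono xs F G F≤G)

  Σℕ-squeeze : (xs : List Carrier) (F G : Carrier → ℕ) → (∀ x → F x ≤ G x) →
               ∑ℕ.∑ₗ xs G ≤ ∑ℕ.∑ₗ xs F → All (λ x → F x ≡ G x) xs
  Σℕ-squeeze []       F G _   _ = []
  Σℕ-squeeze (x ∷ xs) F G F≤G h = ℕ.≤-antisym (F≤G x) G≤F ∷ Σℕ-squeeze xs F G F≤G ΣG≤ΣF
    where
    G≤F : G x ≤ F x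
    G≤F = ℕ.+-cancelʳ-≤ (∑ℕ.∑ₗ xs F) (G x) (F x) (ℕ.≤-trans (ℕ.+-monoʳ-≤ (G x) (Σℕ-mono xs F G F≤G)) h)
    ΣG≤ΣF : ∑ℕ.∑ₗ xs G ≤ ∑ℕ.∑ₗ xs F
    ΣG≤ΣF = ℕ.+-cancelˡ-≤ (F x) _ _ (ℕ.≤-trans (ℕ.+-monoˡ-≤ (∑ℕ.∑ₗ xs G) (F≤G x)) h)

  fibre : (P? : ∀ x → Dec (P x)) (φ : Carrier → Carrier) (s : Carrier) → ℕ
  fibre P? φ s = # (λ x → P? x ×-dec (φ x ≟ s))

  fibre-cong : (P? : ∀ x → Dec (P x)) (φ : Carrier → Carrier) {s t : Carrier} →
               s ≈ t → fibre P? φ s ≡ fibre P? φ t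
  fibre-cong P? φ s≈t = #-⇔ _ _ (λ _ (Px , e) → Px , trans e s≈t) (λ _ (Px , e) → Px , trans e (sym s≈t))

  Σ-fibre : (P? : ∀ x → Dec (P x)) (φ : Carrier → Carrier) → # P? ≡ Σℕ (fibre P? φ)
  Σ-fibre P? φ = ≡.trans (≡.trans (#-def P?) (∑ℕ.∑-fibres φ (λ x → when (P? x) 1)))
    (∑ℕ.∑ₗ-cong elems (λ s → ≡.trans (∑ℕ.∑ₗ-cong elems (λ x → join s x))
      (≡.sym (#-def (λ x → P? x ×-dec (φ x ≟ s))))))
    where
    join : ∀ s x → when (s ≟ φ x) (when (P? x) 1) ≡ when (P? x ×-dec (φ x ≟ s)) 1
    join s x with s ≟ φ x | P? x | φ x ≟ s
    ... | yes _ | yes _ | yes _ = ≡.refl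
    ... | yes e | _     | no ¬e = ⊥-elim (¬e (sym e))
    ... | no ¬e | _     | yes e = ⊥-elim (¬e (sym e))
    ... | yes _ | no _  | yes _ = ≡.refl
    ... | no _  | yes _ | no _  = ≡.refl
    ... | no _  | no _  | no _  = ≡.refl

  module _ (P? : ∀ x → Dec (P x)) (W? : ∀ x → Dec (W x)) (W-resp : ∀ {x y} → x ≈ y → W x → W y)
           (φ : Carrier → Carrier) (φ∈W : ∀ x → P x → W (φ x))
           (a b : ℕ) (#P : # P? ≡ a ℕ.* b) (#W≤b : # W? ≤ b)
           (fibre-≤ : ∀ s → W s → fibre P? φ s ≤ a) where
    private
      bound : ∀ s → fibre P? φ s ≤ when (W? s) a
      bound s with W? s
      ... | yes Ws = fibre-≤ s Ws
      ... | no ¬Ws = ℕ.≤-reflexive (#-none _ (λ x (Px , φx≈s) → ¬Ws (W-resp φx≈s (φ∈W x Px))))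

      total-≤ : Σℕ (λ s → when (W? s) a) ≤ Σℕ (fibre P? φ)
      total-≤ = begin
        Σℕ (λ s → when (W? s) a) ≡⟨ Σℕ-when W? a ⟩
        # W? ℕ.* a               ≤⟨ ℕ.*-monoˡ-≤ a #W≤b ⟩
        b ℕ.* a                  ≡⟨ ℕ.*-comm b a ⟩
        a ℕ.* b                  ≡⟨ #P ⟨
        # P?                     ≡⟨ Σ-fibre P? φ ⟩
        Σℕ (fibre P? φ)          ∎
        where open ℕ.≤-Reasoning

    -- The fibre counts add up to ab, yet they are at most a on W, zero off W, and W has at most b
    -- elements. No slack is left, so each bound on W is attained.
    fibre-≡ : ∀ s → W s → fibre P? φ s ≡ a
    fibre-≡ s Ws with All.lookupAny (Σℕ-squeeze elems _ _ bound total-≤) (complete s)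
    ... | e , s≈t = ≡.trans (fibre-cong P? φ s≈t)
      (≡.trans e (∑ℕ.when-yes (W? _) (W-resp s≈t Ws) a))

    target-≡ : 0 < a → # W? ≡ b
    target-≡ 0<a = ℕ.*-cancelʳ-≡ (# W?) b a {{ℕ.>-nonZero 0<a}} (ℕ.≤-antisym (ℕ.*-monoˡ-≤ a #W≤b)
      (begin
        b ℕ.* a ≡⟨ ℕ.*-comm b a ⟩
        a ℕ.* b ≡⟨ #P ⟨
        # P? ≡⟨ Σ-fibre P? φ ⟩
        Σℕ (fibre P? φ) ≤⟨ Σℕ-mono elems _ _ bound ⟩
        Σℕ (λ s → when (W? s) a) ≡⟨ Σℕ-when W? a ⟩
        # W? ℕ.* a ∎))
      where open ℕ.≤-Reasoning

-- The identities m · 1 = 0 and a^m = a in a field of m elements.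

module Fermat {c ℓ : Level} (R : CommutativeRing c ℓ) {m : ℕ} (FF : IsFiniteFieldOfSize R m) where
  open CommutativeRing R
  open Field R FF
  open import Algebra.Properties.Semiring.Mult semiring using (×-congˡ) renaming (_×_ to _×ₙ_)
  open import Algebra.Properties.CommutativeSemigroup *-commutativeSemigroup using (x∙yz≈y∙xz)
  open import Relation.Binary.Reasoning.Setoid setoid
  private
    module Π = FieldSum R FF *-commutativeMonoid
    module Σ⁺ = FieldSum R FF +-commutativeMonoid

  -- Translating the sum of all elements by 1 adds m × 1#.
  m×1≈0 : m ×ₙ 1# ≈ 0#
  m×1≈0 = +-cancelˡ total (m ×ₙ 1#) 0# (begin
    total + m ×ₙ 1#                  ≈⟨ +-congˡ (trans (×-congˡ (≡.sym size)) (ones elems)) ⟩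
    total + Σ⁺.∑ᴷ (λ _ → 1#)          ≈⟨ Σ⁺.∑ₗ-∙ elems _ _ ⟨
    Σ⁺.∑ᴷ (λ x → x + 1#)
      ≈⟨ Σ⁺.∑-reindex (_+ 1#) (_- 1#)
           (λ e → trans (sym (//-rightDividesʳ 1# _)) (+-congʳ e))
           (λ e → trans (+-congʳ e) (//-rightDividesˡ 1# _)) (λ x → x) (λ e → e) ⟩
    total                            ≈⟨ +-identityʳ total ⟨
    total + 0#                       ∎)
    where
    total = Σ⁺.∑ᴷ (λ x → x)
    ones : ∀ xs → length xs ×ₙ 1# ≈ Σ⁺.∑ₗ xs (λ _ → 1#)
    ones []       = refl
    ones (_ ∷ xs) = +-congˡ (ones xs)

  private
    unit : Carrier → Carrier
    unit x = Π.when (¬? (x ≟ 0#)) x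

    unit-cong : ∀ {x y} → x ≈ y → unit x ≈ unit y
    unit-cong {x} {y} x≈y = trans (Π.when-cong (¬? (x ≟ 0#)) (λ _ → x≈y))
      (Π.when-⇔ (¬? (x ≟ 0#)) (¬? (y ≟ 0#)) (λ x≉0 y≈0 → x≉0 (trans x≈y y≈0))
                                  (λ y≉0 x≈0 → y≉0 (trans (sym x≈y) x≈0)) y)

    -- `unit` replaces 0 by 1, so multiplication by a fails to produce a factor a at x = 0. The
    -- second factor on the left supplies it. The product over all x then contains a exactly m times
    -- and gives a^m = a directly, with no exponent m - 1.
    unit-* : ∀ a → ¬ (a ≈ 0#) → ∀ x → unit (a * x) * Π.when (x ≟ 0#) a ≈ a * unit x
    unit-* a a≉0 x with x ≟ 0# | (a * x) ≟ 0#
    ... | yes _   | yes _   = trans (*-identityˡ a) (sym (*-identityʳ a))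
    ... | yes x≈0 | no ax≉0 = ⊥-elim (ax≉0 (trans (*-congˡ x≈0) (zeroʳ a)))
    ... | no x≉0  | yes ax≈0 = ⊥-elim (*≉0 a≉0 x≉0 ax≈0)
    ... | no _    | no _    = *-identityʳ (a * x)

    Π-const : ∀ a (xs : List Carrier) → Π.∑ₗ xs (λ _ → a) ≈ pow R a (length xs)
    Π-const a []       = refl
    Π-const a (_ ∷ xs) = *-congˡ (Π-const a xs)

    Π-unit≉0 : ∀ xs → ¬ (Π.∑ₗ xs unit ≈ 0#)
    Π-unit≉0 [] = nontriv
    Π-unit≉0 (x ∷ xs) with x ≟ 0#
    ... | yes _   = λ e → Π-unit≉0 xs (trans (sym (*-identityˡ _)) e)
    ... | no x≉0  = *≉0 x≉0 (Π-unit≉0 xs)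

  -- For a ≠ 0, multiplication by a permutes the product of the nonzero elements.
  fermat : ∀ a → pow R a m ≈ a
  fermat a with a ≟ 0#
  ... | yes a≈0 = trans (pow-cong m a≈0) (trans (pow-0# m 0<m) (sym a≈0))
    where
    0<m : 0 < m
    0<m = ≡.subst (0 <_) size (nonempty (complete 0#))
      where
      nonempty : ∀ {xs} → Any (0# ≈_) xs → 0 < length xs
      nonempty {_ ∷ _} _ = s≤s z≤n
  ... | no a≉0 with inverse a a≉0
  ...   | a⁻¹ , aa⁻¹≈1 = *-cancelˡ (Π-unit≉0 elems) (begin
    Π.∑ᴷ unit * pow R a m
      ≈⟨ *-congˡ (trans (Π-const a elems) (pow-≡ a size)) ⟨
    Π.∑ᴷ unit * Π.∑ᴷ (λ _ → a)
      ≈⟨ trans (*-comm _ _) (sym (Π.∑ₗ-∙ elems _ _)) ⟩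
    Π.∑ᴷ (λ x → a * unit x)
      ≈⟨ Π.∑ₗ-cong elems (unit-* a a≉0) ⟨
    Π.∑ᴷ (λ x → unit (a * x) * Π.when (x ≟ 0#) a)
      ≈⟨ Π.∑ₗ-∙ elems _ _ ⟩
    Π.∑ᴷ (λ x → unit (a * x)) * Π.∑ᴷ (λ x → Π.when (x ≟ 0#) a)
      ≈⟨ *-cong (Π.∑-reindex (a *_) (a⁻¹ *_) to from unit unit-cong) (Π.delta 0# a) ⟩
    Π.∑ᴷ unit * a ∎)
    where
    a⁻¹a : ∀ x → a⁻¹ * (a * x) ≈ x
    a⁻¹a x = trans (sym (*-assoc _ _ _)) (trans (*-congʳ (trans (*-comm a⁻¹ a) aa⁻¹≈1)) (*-identityˡ x))
    to : ∀ {x y} → a * x ≈ y → x ≈ a⁻¹ * y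
    to {x} e = trans (sym (a⁻¹a x)) (*-congˡ e)
    from : ∀ {x y} → x ≈ a⁻¹ * y → a * x ≈ y
    from {x} {y} e = trans (*-congˡ e) (trans (x∙yz≈y∙xz a a⁻¹ y) (a⁻¹a y))

-- Characteristic p and additivity of the Frobenius maps.

module Frobenius {c ℓ : Level} (R : CommutativeRing c ℓ) {m : ℕ} (FF : IsFiniteFieldOfSize R m)
                 {p : ℕ} (pp : Prime p) (e : ℕ) (m≡p^e : m ≡ p ℕ.^ e) where
  open CommutativeRing R
  open Field R FF
  open Fermat R FF
  open import Algebra.Properties.Semiring.Mult semiring using (×1-homo-*; ×-congʳ; ×-assoc-*; ×-homo-1)
    renaming (_×_ to _×ₙ_)
  open import Algebra.Properties.Semiring.Sum semiring using (sum; sum-init-last; sum-cong-≋; sum-replicate-zero)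
  open import Algebra.Properties.CommutativeSemiring.Binomial commutativeSemiring using (theorem; binomialTerm)
  open import Relation.Binary.Reasoning.Setoid setoid

  -- p^e · 1 vanishes and is the e-fold product of p · 1; a field has no zero divisors.
  p×1≈0 : p ×ₙ 1# ≈ 0#
  p×1≈0 = go e (≡.subst (λ k → k ×ₙ 1# ≈ 0#) m≡p^e m×1≈0)
    where
    go : ∀ e → (p ℕ.^ e) ×ₙ 1# ≈ 0# → p ×ₙ 1# ≈ 0#
    go zero    1×1≈0 = ⊥-elim (nontriv (trans (sym (×-homo-1 1#)) 1×1≈0))
    go (suc e) h with (p ×ₙ 1#) ≟ 0#
    ... | yes p×1≈0 = p×1≈0
    ... | no  p×1≉0 = go e (*≈0 _ _ (trans (sym (×1-homo-* p (p ℕ.^ e))) h) p×1≉0)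

  p∣⇒×≈0 : ∀ {k} → p ∣ k → ∀ x → k ×ₙ x ≈ 0#
  p∣⇒×≈0 (divides j ≡.refl) x = begin
    (j ℕ.* p) ×ₙ x             ≈⟨ ×-congʳ (j ℕ.* p) (*-identityˡ x) ⟨
    (j ℕ.* p) ×ₙ (1# * x)      ≈⟨ ×-assoc-* (j ℕ.* p) 1# x ⟨
    ((j ℕ.* p) ×ₙ 1#) * x      ≈⟨ *-congʳ (×1-homo-* j p) ⟩
    ((j ×ₙ 1#) * (p ×ₙ 1#)) * x ≈⟨ *-congʳ (trans (*-congˡ p×1≈0) (zeroʳ _)) ⟩
    0# * x                     ≈⟨ zeroˡ x ⟩
    0#                         ∎

  frobenius-p : ∀ x y → pow R (x + y) p ≈ pow R x p + pow R y p
  frobenius-p x y = go p ≡.refl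
    where
    go : ∀ p′ → p′ ≡ p → pow R (x + y) p′ ≈ pow R x p′ + pow R y p′
    go zero ≡.refl = ⊥-elim (ℕ.<-irrefl ≡.refl (ℕ.>-nonZero⁻¹ 0 {{prime⇒nonZero pp}}))
    go p′@(suc p-1) ≡.refl rewrite pow≡^ (x + y) p′ | pow≡^ x p′ | pow≡^ y p′ = begin
      _ ≈⟨ theorem p′ x y ⟩
      term Fin.zero + sum (λ i → term (Fin.suc i))
        ≈⟨ +-cong (trans (×-homo-1 _) (*-identityˡ _)) (sum-init-last {p-1} (λ i → term (Fin.suc i))) ⟩
      _ + (sum (λ i → term (Fin.suc (Fin.inject₁ i))) + term (Fin.suc (Fin.fromℕ p-1)))
        ≈⟨ +-congˡ (+-cong (trans (sum-cong-≋ middle) (sum-replicate-zero p-1)) top) ⟩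
      _ + (0# + _) ≈⟨ trans (+-congˡ (+-identityˡ _)) (+-comm _ _) ⟩
      _ ∎
      where
      open import Algebra.Properties.Semiring.Exp semiring using (_^_)
      term : Fin (suc p′) → Carrier
      term = binomialTerm x y p′
      middle : ∀ i → term (Fin.suc (Fin.inject₁ i)) ≈ 0#
      middle i = p∣⇒×≈0 (p∣pCk pp _ (s≤s z≤n) (s≤s (≡.subst (_< p-1) (≡.sym (Fin.toℕ-inject₁ i)) (Fin.toℕ<n i)))) _
      top : term (Fin.suc (Fin.fromℕ p-1)) ≈ x ^ p′
      top rewrite Fin.toℕ-fromℕ p-1 | nCn≡1 p′ | ℕ.n∸n≡0 p-1 = trans (×-homo-1 _) (*-identityʳ _)

  frobenius : ∀ k x y → pow R (x + y) (p ℕ.^ k) ≈ pow R x (p ℕ.^ k) + pow R y (p ℕ.^ k)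
  frobenius zero    x y = trans (pow-1 _) (sym (+-cong (pow-1 x) (pow-1 y)))
  frobenius (suc k) x y = begin
    pow R (x + y) (p ℕ.* p ℕ.^ k)                  ≈⟨ pow-* (x + y) p (p ℕ.^ k) ⟩
    pow R (pow R (x + y) p) (p ℕ.^ k)              ≈⟨ pow-cong (p ℕ.^ k) (frobenius-p x y) ⟩
    pow R (pow R x p + pow R y p) (p ℕ.^ k)        ≈⟨ frobenius k _ _ ⟩
    pow R (pow R x p) (p ℕ.^ k) + pow R (pow R y p) (p ℕ.^ k)
      ≈⟨ +-cong (pow-* x p (p ℕ.^ k)) (pow-* y p (p ℕ.^ k)) ⟨
    pow R x (p ℕ.* p ℕ.^ k) + pow R y (p ℕ.* p ℕ.^ k) ∎

-- G is the geometric sum 1 + (a + 1) + ... + (a + 1)^(n-1). With a = q^2 - 1 it becomes the index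
-- of F_{q^2}^* in the multiplicative group of the large field.
geometric : ∀ a n → 0 < n → ∃ λ G → 0 < G × suc (a ℕ.* G) ≡ suc a ℕ.^ n
geometric a 1             _ = 1 , s≤s z≤n , ≡.cong suc (≡.trans (ℕ.*-identityʳ a) (≡.sym (ℕ.*-identityʳ a)))
geometric a (suc (suc n)) _ with geometric a (suc n) (s≤s z≤n)
... | G , _ , e = suc (G ℕ.+ a ℕ.* G) , s≤s z≤n , ≡.trans (step a G) (≡.cong (suc a ℕ.*_) e)
  where
  step : ∀ a G → suc (a ℕ.* suc (G ℕ.+ a ℕ.* G)) ≡ suc a ℕ.* suc (a ℕ.* G)
  step = solve-∀

-- Roots of unity, counted without a generator.

module RootsOfUnity {c ℓ : Level} (R : CommutativeRing c ℓ) {m : ℕ} (FF : IsFiniteFieldOfSize R m) where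
  open CommutativeRing R
  open Field R FF
  open Fibres R FF
  open Fermat R FF
  open import Relation.Binary.Reasoning.Setoid setoid

  Lead-x^d-a : ∀ d a → 0 < d → Lead 1# d (λ x → pow R x d - a)
  Lead-x^d-a d a 0<d = Lead-+ (Lead-monomial d 1#) (Deg<-monomial 0 (- a) 0<d)
    (λ x → sym (+-cong (*-identityˡ _) (*-identityʳ _)))

  x-y≈0 : ∀ {x y} → x ≈ y → x - y ≈ 0#
  x-y≈0 {x} {y} e = trans (+-congʳ e) (-‿inverseʳ y)

  #-x^d≈a : ∀ d a → 0 < d → (P? : ∀ x → Dec (pow R x d ≈ a)) → # P? ≤ d
  #-x^d≈a d a 0<d P? = #-roots (Lead-x^d-a d a 0<d) nontriv P? (λ _ → x-y≈0)

  #≉0 : suc (# (λ x → ¬? (x ≟ 0#))) ≡ m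
  #≉0 = ≡.trans (≡.cong (ℕ._+ # (λ x → ¬? (x ≟ 0#))) (≡.sym (#-one (_≟ 0#) 0# (λ _ e → e) (λ _ e → e))))
    (≡.trans (≡.sym (#-⊎ (λ x → x ≟ x) (_≟ 0#) (λ x → ¬? (x ≟ 0#)) split (λ _ _ → refl) (λ _ _ → refl)
      (λ _ u v → v u))) (#-all (λ x → x ≟ x) (λ _ → refl)))
    where
    split : ∀ x → x ≈ x → (x ≈ 0#) ⊎ (¬ (x ≈ 0#))
    split x _ with x ≟ 0#
    ... | yes p = inj₁ p
    ... | no ¬p = inj₂ ¬p

  fermat-unit : ∀ {e} → suc e ≡ m → ∀ {x} → ¬ (x ≈ 0#) → pow R x e ≈ 1#
  fermat-unit {e} ≡.refl {x} x≉0 = *-cancelˡ x≉0 (trans (fermat x) (sym (*-identityʳ x)))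

  root≉0 : ∀ {d x} → 0 < d → pow R x d ≈ 1# → ¬ (x ≈ 0#)
  root≉0 {d} 0<d h x≈0 = nontriv (trans (sym h) (trans (pow-cong d x≈0) (pow-0# d 0<d)))

  module _ (d e : ℕ) (0<d : 0 < d) (0<e : 0 < e) (m≡ : suc (d ℕ.* e) ≡ m) where
    private
      W? : ∀ s → Dec (pow R s d ≈ 1#)
      W? s = pow R s d ≟ 1#
      P? : ∀ x → Dec (¬ (x ≈ 0#))
      P? x = ¬? (x ≟ 0#)
      resp : ∀ {x y} → x ≈ y → pow R x d ≈ 1# → pow R y d ≈ 1#
      resp e h = trans (pow-cong d (sym e)) h
      into : ∀ x → ¬ (x ≈ 0#) → pow R (pow R x e) d ≈ 1#
      into x x≉0 = trans (sym (pow-* x e d)) (fermat-unit (≡.trans (≡.cong suc (ℕ.*-comm e d)) m≡) x≉0)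
      #P : # P? ≡ e ℕ.* d
      #P = ≡.trans (ℕ.suc-injective (≡.trans #≉0 (≡.sym m≡))) (ℕ.*-comm d e)
      fibre-≤ : ∀ s → pow R s d ≈ 1# → fibre P? (λ x → pow R x e) s ≤ e
      fibre-≤ s _ = #-roots (Lead-x^d-a e s 0<e) nontriv _ (λ x (_ , h) → x-y≈0 h)

    -- The map x ↦ x^e sends the de nonzero elements into the d-th roots of unity. By degree there
    -- are at most d of these, each with at most e preimages, so both bounds are equalities. The
    -- same squeeze makes every d-th root of unity an e-th power.
    #roots-of-unity : # W? ≡ d
    #roots-of-unity = target-≡ P? W? resp (λ x → pow R x e) into e d #P (#-x^d≈a d 1# 0<d W?) fibre-≤ 0<e

    root-∃ : ∀ s → pow R s d ≈ 1# → ∃ λ x → ¬ (x ≈ 0#) × pow R x e ≈ s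
    root-∃ s h = #-∃ _ (≡.subst (0 <_) (≡.sym
      (fibre-≡ P? W? resp (λ x → pow R x e) into e d #P (#-x^d≈a d 1# 0<d W?) fibre-≤ s h)) 0<e)

-- The fields with q, q^2 and q^(2n) elements.

module Tower {c ℓ : Level} (R : CommutativeRing c ℓ) {p : ℕ} (pp : Prime p) (k q n : ℕ)
             (1≤k : 1 ≤ k) (q≡p^k : q ≡ p ℕ.^ k) (1≤n : 1 ≤ n)
             (FF : IsFiniteFieldOfSize R (q ℕ.^ (2 ℕ.* n))) where
  open CommutativeRing R
  open Field R FF public
  open Fibres R FF public
  open Fermat R FF public
  open RootsOfUnity R FF public
  open FinSum R public
  open import Relation.Binary.Reasoning.Setoid setoid

  Q q₁ : ℕ
  Q = q ℕ.^ (2 ℕ.* n)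
  q₁ = q ℕ.∸ 1

  private
    p^*≡q^ : ∀ j → q ℕ.^ j ≡ p ℕ.^ (k ℕ.* j)
    p^*≡q^ j = ≡.trans (≡.cong (ℕ._^ j) q≡p^k) (ℕ.^-*-assoc p k j)

  open Frobenius R FF pp (k ℕ.* (2 ℕ.* n)) (p^*≡q^ (2 ℕ.* n)) public using (frobenius)

  2≤q : 2 ≤ q
  2≤q = ≡.subst (2 ≤_) (≡.sym q≡p^k) (ℕ.≤-trans 2≤p (≡.subst (_≤ p ℕ.^ k) (ℕ.*-identityʳ p)
    (ℕ.^-monoʳ-≤ p {{ℕ.>-nonZero (ℕ.<-trans (s≤s z≤n) 2≤p)}} 1≤k)))
    where
    2≤p : 2 ≤ p
    2≤p = ℕ.nonTrivial⇒n>1 p {{prime⇒nonTrivial pp}}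

  0<q : 0 < q
  0<q = ℕ.<-trans (s≤s z≤n) 2≤q

  instance
    q-nonZero : NonZero q
    q-nonZero = ℕ.>-nonZero 0<q

  suc-q₁ : suc q₁ ≡ q
  suc-q₁ = ℕ.m+[n∸m]≡n 0<q

  0<q₁ : 0 < q₁
  0<q₁ = ℕ.m<n⇒0<n∸m 2≤q

  q²≡ : suc (q₁ ℕ.* (q ℕ.+ 1)) ≡ q ℕ.^ 2
  q²≡ = ≡.subst (λ r → suc (q₁ ℕ.* (r ℕ.+ 1)) ≡ r ℕ.^ 2) suc-q₁ (square q₁)
    where
    square : ∀ r → suc (r ℕ.* (suc r ℕ.+ 1)) ≡ suc r ℕ.* (suc r ℕ.* 1)
    square = solve-∀

  private
    geom = geometric (q₁ ℕ.* (q ℕ.+ 1)) n 1≤n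
    G = proj₁ geom
    0<G : 0 < G
    0<G = proj₁ (proj₂ geom)
    Q≡ : suc (q₁ ℕ.* (q ℕ.+ 1) ℕ.* G) ≡ Q
    Q≡ = ≡.trans (proj₂ (proj₂ geom)) (≡.trans (≡.cong (ℕ._^ n) q²≡) (ℕ.^-*-assoc q 2 n))
    0<q+1 : 0 < q ℕ.+ 1
    0<q+1 = ℕ.≤-trans 0<q (ℕ.m≤m+n q 1)
    infixr 6 _⊛_
    _⊛_ : ∀ {a b} → 0 < a → 0 < b → 0 < a ℕ.* b
    _⊛_ {suc a} {suc b} _ _ = s≤s z≤n

  #U : # (λ v → pow R v (q ℕ.+ 1) ≟ 1#) ≡ q ℕ.+ 1
  #U = #roots-of-unity (q ℕ.+ 1) (q₁ ℕ.* G) 0<q+1 (0<q₁ ⊛ 0<G)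
    (≡.trans (≡.cong suc (≡.trans (≡.sym (ℕ.*-assoc (q ℕ.+ 1) q₁ G)) (≡.cong (ℕ._* G) (ℕ.*-comm (q ℕ.+ 1) q₁)))) Q≡)

  F? : ∀ x → Dec (pow R x (q ℕ.^ 2) ≈ x)
  F? x = pow R x (q ℕ.^ 2) ≟ x

  pow-q² : ∀ x → pow R x (q ℕ.^ 2) ≈ x * pow R x (q₁ ℕ.* (q ℕ.+ 1))
  pow-q² x = pow-≡ x (≡.sym q²≡)

  #F : # F? ≡ q ℕ.^ 2
  #F = ≡.trans (#-⊎ F? (_≟ 0#) (λ x → pow R x (q₁ ℕ.* (q ℕ.+ 1)) ≟ 1#) split
        (λ x x≈0 → trans (pow-q² x) (trans (*-congʳ x≈0) (trans (zeroˡ _) (sym x≈0))))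
        (λ x h → trans (pow-q² x) (trans (*-congˡ h) (*-identityʳ x)))
        (λ x x≈0 h → root≉0 (0<q₁ ⊛ 0<q+1) h x≈0))
      (≡.trans (≡.cong₂ ℕ._+_ (#-one (_≟ 0#) 0# (λ _ e → e) (λ _ e → e))
        (#roots-of-unity (q₁ ℕ.* (q ℕ.+ 1)) G (0<q₁ ⊛ 0<q+1) 0<G Q≡)) q²≡)
    where
    split : ∀ x → pow R x (q ℕ.^ 2) ≈ x → (x ≈ 0#) ⊎ (pow R x (q₁ ℕ.* (q ℕ.+ 1)) ≈ 1#)
    split x h with x ≟ 0#
    ... | yes x≈0 = inj₁ x≈0
    ... | no x≉0  = inj₂ (*-cancelˡ x≉0 (trans (sym (pow-q² x)) (trans h (sym (*-identityʳ x)))))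

  -- The condition says s ∈ F_q^*. As (q - 1) · (q + 1)G = q^(2n) - 1, s is some u^((q+1)G). Then t
  -- = u^G has norm s, and it lies in F_{q^2} because u^(G(q^2-1)) = 1.
  norm-onto : ∀ s → pow R s q₁ ≈ 1# →
              ∃ λ t → ¬ (t ≈ 0#) × pow R t (q ℕ.^ 2) ≈ t × pow R t (q ℕ.+ 1) ≈ s
  norm-onto s h with root-∃ q₁ ((q ℕ.+ 1) ℕ.* G) 0<q₁ (0<q+1 ⊛ 0<G)
                       (≡.trans (≡.cong suc (≡.sym (ℕ.*-assoc q₁ (q ℕ.+ 1) G))) Q≡) s h
  ... | u , u≉0 , hu = pow R u G , pow≉0 G u≉0 , t∈F ,
    trans (sym (pow-* u G (q ℕ.+ 1))) (trans (pow-≡ u (ℕ.*-comm G (q ℕ.+ 1))) hu)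
    where
    t∈F : pow R (pow R u G) (q ℕ.^ 2) ≈ pow R u G
    t∈F = begin
      pow R (pow R u G) (q ℕ.^ 2)                             ≈⟨ pow-q² (pow R u G) ⟩
      pow R u G * pow R (pow R u G) (q₁ ℕ.* (q ℕ.+ 1))        ≈⟨ *-congˡ (pow-* u G (q₁ ℕ.* (q ℕ.+ 1))) ⟨
      pow R u G * pow R u (G ℕ.* (q₁ ℕ.* (q ℕ.+ 1)))
        ≈⟨ *-congˡ (fermat-unit (≡.trans (≡.cong suc (ℕ.*-comm G (q₁ ℕ.* (q ℕ.+ 1)))) Q≡) u≉0) ⟩
      pow R u G * 1#                                          ≈⟨ *-identityʳ _ ⟩
      pow R u G                                               ∎

  -- `InFq2 x` is by definition `σ 2 x ≈ x`, and conjugation over F_q on F_{q^2} is `σ 1`. The plain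
  -- q-th power of the statement agrees with `σ 1` only up to q · 1 = q, whence `pow-q`.
  σ : ℕ → Carrier → Carrier
  σ j x = pow R x (q ℕ.^ j)

  σ-cong : ∀ j {x y} → x ≈ y → σ j x ≈ σ j y
  σ-cong j = pow-cong (q ℕ.^ j)

  σ-≡ : ∀ {i j} → i ≡ j → ∀ x → σ i x ≈ σ j x
  σ-≡ ≡.refl x = refl

  σ-* : ∀ j x y → σ j (x * y) ≈ σ j x * σ j y
  σ-* j = pow-distrib (q ℕ.^ j)

  σ-+ : ∀ j x y → σ j (x + y) ≈ σ j x + σ j y
  σ-+ j x y rewrite p^*≡q^ j = frobenius (k ℕ.* j) x y

  σ-∘ : ∀ i j x → σ i (σ j x) ≈ σ (i ℕ.+ j) x
  σ-∘ i j x = trans (sym (pow-* x (q ℕ.^ j) (q ℕ.^ i)))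
    (pow-≡ x (≡.trans (≡.sym (ℕ.^-distribˡ-+-* q j i)) (≡.cong (q ℕ.^_) (ℕ.+-comm j i))))

  σ-0# : ∀ j → σ j 0# ≈ 0#
  σ-0# j = x+x≈x⇒x≈0 _ (trans (sym (σ-+ j 0# 0#)) (σ-cong j (+-identityʳ 0#)))

  σ-neg : ∀ j x → σ j (- x) ≈ - σ j x
  σ-neg j x = inverseˡ-unique (σ j (- x)) (σ j x)
    (trans (sym (σ-+ j (- x) x)) (trans (σ-cong j (-‿inverseˡ x)) (σ-0# j)))

  σ-∑ : ∀ j d (f : Fin d → Carrier) → σ j (∑ R d f) ≈ ∑ R d (λ i → σ j (f i))
  σ-∑ j zero    f = σ-0# j
  σ-∑ j (suc d) f = trans (σ-+ j _ _) (+-congˡ (σ-∑ j d _))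

  σ-2n : ∀ x → σ (2 ℕ.* n) x ≈ x
  σ-2n = fermat

  pow-q : ∀ x → pow R x q ≈ σ 1 x
  pow-q x = pow-≡ x (≡.sym (ℕ.*-identityʳ q))

  σ≉0 : ∀ j {x} → ¬ (x ≈ 0#) → ¬ (σ j x ≈ 0#)
  σ≉0 j = pow≉0 (q ℕ.^ j)

  σ-F : ∀ {t} → σ 2 t ≈ t → ∀ i → σ (2 ℕ.* i) t ≈ t
  σ-F {t} h zero    = pow-1 t
  σ-F {t} h (suc i) = begin
    σ (2 ℕ.* suc i) t      ≈⟨ σ-≡ (≡.trans (ℕ.*-suc 2 i) (ℕ.+-comm 2 (2 ℕ.* i))) t ⟩
    σ (2 ℕ.* i ℕ.+ 2) t    ≈⟨ σ-∘ (2 ℕ.* i) 2 t ⟨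
    σ (2 ℕ.* i) (σ 2 t)    ≈⟨ σ-cong (2 ℕ.* i) h ⟩
    σ (2 ℕ.* i) t          ≈⟨ σ-F h i ⟩
    t                      ∎

-- The trace, the adjoint of L, and the Hermitian forms attached to υ.

module Forms {c ℓ : Level} (R : CommutativeRing c ℓ) {p : ℕ} (pp : Prime p) (k q n : ℕ)
             (1≤k : 1 ≤ k) (q≡p^k : q ≡ p ℕ.^ k) (1≤n : 1 ≤ n)
             (FF : IsFiniteFieldOfSize R (q ℕ.^ (2 ℕ.* n)))
             (a : Fin n → CommutativeRing.Carrier R) where
  open CommutativeRing R
  open Tower R pp k q n 1≤k q≡p^k 1≤n FF public
  open Setup R q n a public
  open import Algebra.Properties.CommutativeSemigroup *-commutativeSemigroup using (x∙yz≈y∙xz)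
    renaming (interchange to *-interchange)
  open import Algebra.Properties.CommutativeSemigroup +-commutativeSemigroup using (interchange)
  open import Relation.Binary.Reasoning.Setoid setoid

  F : Carrier → Set ℓ
  F = InFq2

  F-σ : ∀ {t} → F t → F (σ 1 t)
  F-σ {t} t∈F = trans (σ-∘ 2 1 t) (trans (sym (σ-∘ 1 2 t)) (σ-cong 1 t∈F))

  Tr-cong : ∀ {x y} → x ≈ y → Tr x ≈ Tr y
  Tr-cong e = ∑-cong n (λ j → σ-cong (2 ℕ.* toℕ j) e)

  Tr-+ : ∀ x y → Tr (x + y) ≈ Tr x + Tr y
  Tr-+ x y = trans (∑-cong n (λ j → σ-+ (2 ℕ.* toℕ j) x y)) (∑-+ n _ _)

  Tr-0# : Tr 0# ≈ 0#
  Tr-0# = trans (∑-cong n (λ j → σ-0# (2 ℕ.* toℕ j))) (∑-0 n)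

  Tr-∑ : ∀ d (f : Fin d → Carrier) → Tr (∑ R d f) ≈ ∑ R d (λ i → Tr (f i))
  Tr-∑ zero    f = Tr-0#
  Tr-∑ (suc d) f = trans (Tr-+ _ _) (+-congˡ (Tr-∑ d _))

  Tr-*ˡ : ∀ {t} → F t → ∀ x → Tr (t * x) ≈ t * Tr x
  Tr-*ˡ {t} t∈F x = trans
    (∑-cong n (λ j → trans (σ-* (2 ℕ.* toℕ j) t x) (*-congʳ (σ-F t∈F (toℕ j)))))
    (sym (∑-*ˡ n t _))

  σ-Tr : ∀ i x → σ i (Tr x) ≈ Tr (σ i x)
  σ-Tr i x = trans (σ-∑ i n _) (∑-cong n (λ j → trans (σ-∘ i (2 ℕ.* toℕ j) x)
    (trans (σ-≡ (ℕ.+-comm i (2 ℕ.* toℕ j)) x) (sym (σ-∘ (2 ℕ.* toℕ j) i x)))))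

  -- `σ 2` permutes the conjugates cyclically. Adding `σ 0 x` on the left gives a sum of n + 1
  -- conjugates, and the last of these, `σ (2n) x`, is x again.
  Tr-σ2 : ∀ x → Tr (σ 2 x) ≈ Tr x
  Tr-σ2 x = +-cancelˡ (σ 0 x) _ _ (begin
    σ 0 x + Tr (σ 2 x)
      ≈⟨ +-congˡ (∑-cong n (λ j → trans (σ-∘ (2 ℕ.* toℕ j) 2 x) (σ-≡ (shift (toℕ j)) x))) ⟩
    ∑ R (suc n) (λ j → σ (2 ℕ.* toℕ j) x)   ≈⟨ ∑-last n (λ j → σ (2 ℕ.* j) x) ⟩
    Tr x + σ (2 ℕ.* n) x                    ≈⟨ +-congˡ (trans (σ-2n x) (sym (pow-1 x))) ⟩
    Tr x + σ 0 x                            ≈⟨ +-comm _ _ ⟩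
    σ 0 x + Tr x                            ∎)
    where
    shift : ∀ j → 2 ℕ.* j ℕ.+ 2 ≡ 2 ℕ.* suc j
    shift = solve-∀

  Tr-σ : ∀ i x → Tr (σ (2 ℕ.* i) x) ≈ Tr x
  Tr-σ zero    x = Tr-cong (pow-1 x)
  Tr-σ (suc i) x = begin
    Tr (σ (2 ℕ.* suc i) x)   ≈⟨ Tr-cong (σ-≡ (ℕ.*-suc 2 i) x) ⟩
    Tr (σ (2 ℕ.+ 2 ℕ.* i) x) ≈⟨ Tr-cong (σ-∘ 2 (2 ℕ.* i) x) ⟨
    Tr (σ 2 (σ (2 ℕ.* i) x)) ≈⟨ Tr-σ2 _ ⟩
    Tr (σ (2 ℕ.* i) x)       ≈⟨ Tr-σ i x ⟩
    Tr x                     ∎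

  Tr∈F : ∀ x → F (Tr x)
  Tr∈F x = trans (σ-Tr 2 x) (Tr-σ2 x)

  L-cong : ∀ {x y} → x ≈ y → L x ≈ L y
  L-cong e = ∑-cong n (λ i → *-congˡ (σ-cong (2 ℕ.* toℕ i) e))

  L-+ : ∀ x y → L (x + y) ≈ L x + L y
  L-+ x y = trans (∑-cong n (λ i → trans (*-congˡ (σ-+ (2 ℕ.* toℕ i) x y)) (distribˡ _ _ _))) (∑-+ n _ _)

  L-*ˡ : ∀ {t} → F t → ∀ x → L (t * x) ≈ t * L x
  L-*ˡ {t} t∈F x = trans
    (∑-cong n (λ i → trans (*-congˡ (trans (σ-* (2 ℕ.* toℕ i) t x) (*-congʳ (σ-F t∈F (toℕ i))))) (x∙yz≈y∙xz _ _ _)))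
    (sym (∑-*ˡ n t _))

  private
    e* : Fin n → ℕ
    e* i = n ℕ.∸ toℕ i ℕ.∸ 1

  L*-cong : ∀ {x y} → x ≈ y → L* x ≈ L* y
  L*-cong e = ∑-cong n (λ i → σ-cong (2 ℕ.* e* i) (*-congˡ e))

  L*-+ : ∀ x y → L* (x + y) ≈ L* x + L* y
  L*-+ x y = trans (∑-cong n (λ i → trans (σ-cong (2 ℕ.* e* i) (distribˡ _ _ _)) (σ-+ (2 ℕ.* e* i) _ _))) (∑-+ n _ _)

  L*-*ˡ : ∀ {t} → F t → ∀ x → L* (t * x) ≈ t * L* x
  L*-*ˡ {t} t∈F x = trans
    (∑-cong n (λ i → trans (σ-cong (2 ℕ.* e* i) (x∙yz≈y∙xz _ _ _))
      (trans (σ-* (2 ℕ.* e* i) t _) (*-congʳ (σ-F t∈F (e* i))))))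
    (sym (∑-*ˡ n t _))

  -- Linear in y and semilinear in z over F_{q^2}. Its diagonal is the function f, whose equation
  -- f(x) + c = 0 is counted by `N`.
  B : Carrier → Carrier → Carrier
  B y z = Tr (y * L (pow R z q))

  -- Raising the i-th summand of σ 1 (z L(y^q)) to the power q^(2(n-i-1)) turns y into y^(q^(2n)) = y.
  adjoint : ∀ y z → σ 1 (B z y) ≈ Tr (y * L* (pow R z q))
  adjoint y z = begin
    σ 1 (Tr (z * L y^q))                      ≈⟨ σ-Tr 1 _ ⟩
    Tr (σ 1 (z * L y^q))                      ≈⟨ Tr-cong (trans (σ-* 1 z _) (*-congˡ (σ-∑ 1 n _))) ⟩
    Tr (σ 1 z * ∑ R n (λ i → σ 1 (a i * σ (2 ℕ.* toℕ i) y^q)))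
      ≈⟨ trans (Tr-cong (∑-*ˡ n _ _)) (Tr-∑ n _) ⟩
    ∑ R n (λ i → Tr (σ 1 z * σ 1 (a i * σ (2 ℕ.* toℕ i) y^q)))
      ≈⟨ ∑-cong n summand ⟩
    ∑ R n (λ i → Tr (y * σ (2 ℕ.* e* i) (pow R (a i) q * pow R z q)))
      ≈⟨ trans (Tr-cong (∑-*ˡ n y _)) (Tr-∑ n _) ⟨
    Tr (y * L* (pow R z q)) ∎
    where
    y^q = pow R y q
    exponent : ∀ i → i < n → 2 ℕ.* (n ℕ.∸ i ℕ.∸ 1) ℕ.+ (1 ℕ.+ (2 ℕ.* i ℕ.+ 1)) ≡ 2 ℕ.* n
    exponent i i<n = ≡.trans (regroup (n ℕ.∸ i ℕ.∸ 1) i) (≡.cong (2 ℕ.*_)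
      (≡.trans (≡.cong (ℕ._+ suc i) (≡.trans (ℕ.∸-+-assoc n i 1) (≡.cong (n ℕ.∸_) (ℕ.+-comm i 1)))) (ℕ.m∸n+n≡m i<n)))
      where
      regroup : ∀ e i → 2 ℕ.* e ℕ.+ (1 ℕ.+ (2 ℕ.* i ℕ.+ 1)) ≡ 2 ℕ.* (e ℕ.+ suc i)
      regroup = solve-∀
    summand : ∀ i → Tr (σ 1 z * σ 1 (a i * σ (2 ℕ.* toℕ i) y^q)) ≈
                    Tr (y * σ (2 ℕ.* e* i) (pow R (a i) q * pow R z q))
    summand i = begin
      Tr (σ 1 z * σ 1 (a i * σ (2 ℕ.* toℕ i) y^q))
        ≈⟨ Tr-cong (*-congˡ (σ-* 1 _ _)) ⟩
      Tr (σ 1 z * (σ 1 (a i) * σ 1 (σ (2 ℕ.* toℕ i) y^q)))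
        ≈⟨ Tr-cong (xyz _ _ _) ⟩
      Tr ((σ 1 (a i) * σ 1 z) * σ 1 (σ (2 ℕ.* toℕ i) y^q))
        ≈⟨ Tr-σ (e* i) _ ⟨
      Tr (σ (2 ℕ.* e* i) ((σ 1 (a i) * σ 1 z) * σ 1 (σ (2 ℕ.* toℕ i) y^q)))
        ≈⟨ Tr-cong (trans (σ-* (2 ℕ.* e* i) _ _) (*-comm _ _)) ⟩
      Tr (σ (2 ℕ.* e* i) (σ 1 (σ (2 ℕ.* toℕ i) y^q)) * σ (2 ℕ.* e* i) (σ 1 (a i) * σ 1 z))
        ≈⟨ Tr-cong (*-cong y-power (σ-cong (2 ℕ.* e* i) (*-cong (sym (pow-q _)) (sym (pow-q _))))) ⟩
      Tr (y * σ (2 ℕ.* e* i) (pow R (a i) q * pow R z q)) ∎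
      where
      xyz : ∀ x y z → x * (y * z) ≈ (y * x) * z
      xyz x y z = trans (x∙yz≈y∙xz x y z) (sym (*-assoc y x z))
      y-power : σ (2 ℕ.* e* i) (σ 1 (σ (2 ℕ.* toℕ i) y^q)) ≈ y
      y-power = begin
        σ (2 ℕ.* e* i) (σ 1 (σ (2 ℕ.* toℕ i) y^q))
          ≈⟨ σ-cong (2 ℕ.* e* i) (σ-cong 1 (trans (σ-cong (2 ℕ.* toℕ i) (pow-q y)) (σ-∘ (2 ℕ.* toℕ i) 1 y))) ⟩
        σ (2 ℕ.* e* i) (σ 1 (σ (2 ℕ.* toℕ i ℕ.+ 1) y))
          ≈⟨ trans (σ-cong (2 ℕ.* e* i) (σ-∘ 1 (2 ℕ.* toℕ i ℕ.+ 1) y)) (σ-∘ (2 ℕ.* e* i) (1 ℕ.+ (2 ℕ.* toℕ i ℕ.+ 1)) y) ⟩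
        σ (2 ℕ.* e* i ℕ.+ (1 ℕ.+ (2 ℕ.* toℕ i ℕ.+ 1))) y
          ≈⟨ σ-≡ (exponent (toℕ i) (Fin.toℕ<n i)) y ⟩
        σ (2 ℕ.* n) y ≈⟨ σ-2n y ⟩
        y ∎

  module Hermitian (υ : Carrier) (υ∈U : InU υ) where

    υσυ : υ * σ 1 υ ≈ 1#
    υσυ = trans (*-congˡ (sym (pow-q υ))) (trans (pow-≡ υ (ℕ.+-comm 1 q)) υ∈U)

    υ≉0 : ¬ (υ ≈ 0#)
    υ≉0 υ≈0 = nontriv (trans (sym υσυ) (trans (*-congʳ υ≈0) (zeroˡ _)))

    -- Apply `σ 1` to υ υ^q = 1: both υ and `σ 2 υ` are inverse to `σ 1 υ`.
    υ∈F : F υ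
    υ∈F = sym (*-cancelˡ (σ≉0 1 υ≉0) (begin
      σ 1 υ * υ               ≈⟨ trans (*-comm _ _) υσυ ⟩
      1#                      ≈⟨ pow-1# (q ℕ.^ 1) ⟨
      σ 1 1#                  ≈⟨ σ-cong 1 υσυ ⟨
      σ 1 (υ * σ 1 υ)         ≈⟨ σ-* 1 υ (σ 1 υ) ⟩
      σ 1 υ * σ 1 (σ 1 υ)     ≈⟨ *-congˡ (σ-∘ 1 1 υ) ⟩
      σ 1 υ * σ 2 υ           ∎))

    M : Carrier → Carrier
    M z = υ * L* (pow R z q) + L (pow R z q)

    M-cong : ∀ {x y} → x ≈ y → M x ≈ M y
    M-cong e = +-cong (*-congˡ (L*-cong (pow-cong q e))) (L-cong (pow-cong q e))

    M-+ : ∀ x y → M (x + y) ≈ M x + M y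
    M-+ x y = begin
      M (x + y)
        ≈⟨ +-cong (*-congˡ (trans (L*-cong power) (L*-+ _ _))) (trans (L-cong power) (L-+ _ _)) ⟩
      υ * (L* (pow R x q) + L* (pow R y q)) + (L (pow R x q) + L (pow R y q))
        ≈⟨ +-congʳ (distribˡ _ _ _) ⟩
      (υ * L* (pow R x q) + υ * L* (pow R y q)) + (L (pow R x q) + L (pow R y q))
        ≈⟨ interchange _ _ _ _ ⟩
      M x + M y ∎
      where
      power : pow R (x + y) q ≈ pow R x q + pow R y q
      power = trans (pow-q _) (trans (σ-+ 1 x y) (sym (+-cong (pow-q x) (pow-q y))))

    M-*ˡ : ∀ {t} → F t → ∀ x → M (t * x) ≈ σ 1 t * M x
    M-*ˡ {t} t∈F x = begin
      M (t * x)
        ≈⟨ +-cong (*-congˡ (trans (L*-cong power) (L*-*ˡ (F-σ t∈F) _))) (trans (L-cong power) (L-*ˡ (F-σ t∈F) _)) ⟩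
      υ * (σ 1 t * L* (pow R x q)) + σ 1 t * L (pow R x q)
        ≈⟨ +-congʳ (x∙yz≈y∙xz _ _ _) ⟩
      σ 1 t * (υ * L* (pow R x q)) + σ 1 t * L (pow R x q)
        ≈⟨ distribˡ _ _ _ ⟨
      σ 1 t * M x ∎
      where
      power : pow R (t * x) q ≈ σ 1 t * pow R x q
      power = trans (pow-distrib q t x) (*-congʳ (pow-q t))

    h : Carrier → Carrier → Carrier
    h y z = Tr (y * M z)

    h-cong : ∀ {x x′ y y′} → x ≈ x′ → y ≈ y′ → h x y ≈ h x′ y′
    h-cong e e′ = Tr-cong (*-cong e (M-cong e′))

    h-+ˡ : ∀ x y z → h (x + y) z ≈ h x z + h y z
    h-+ˡ x y z = trans (Tr-cong (distribʳ _ _ _)) (Tr-+ _ _)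

    h-+ʳ : ∀ x y z → h x (y + z) ≈ h x y + h x z
    h-+ʳ x y z = trans (Tr-cong (trans (*-congˡ (M-+ y z)) (distribˡ _ _ _))) (Tr-+ _ _)

    -- `adjoint` rewrites the L* half of M as υ times the q-th power of B with its arguments
    -- exchanged. So h is B symmetrised by the twisted conjugation s ↦ υ s^q, and its Hermitian
    -- symmetry becomes visible.
    h≈B : ∀ y z → h y z ≈ υ * σ 1 (B z y) + B y z
    h≈B y z = begin
      Tr (y * M z)                                        ≈⟨ Tr-cong (trans (distribˡ _ _ _) (+-congʳ (x∙yz≈y∙xz _ _ _))) ⟩
      Tr (υ * (y * L* (pow R z q)) + y * L (pow R z q))   ≈⟨ Tr-+ _ _ ⟩
      Tr (υ * (y * L* (pow R z q))) + B y z               ≈⟨ +-congʳ (Tr-*ˡ υ∈F _) ⟩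
      υ * Tr (y * L* (pow R z q)) + B y z                 ≈⟨ +-congʳ (*-congˡ (adjoint y z)) ⟨
      υ * σ 1 (B z y) + B y z                             ∎

    -- Conjugation twisted by υ. On F_{q^2} it is an involution, since υ υ^q = 1, and `W` below is
    -- the set of its fixed points.
    υσ : Carrier → Carrier
    υσ s = υ * σ 1 s

    υσ-cong : ∀ {x y} → x ≈ y → υσ x ≈ υσ y
    υσ-cong e = *-congˡ (σ-cong 1 e)

    υσ-+ : ∀ x y → υσ (x + y) ≈ υσ x + υσ y
    υσ-+ x y = trans (*-congˡ (σ-+ 1 x y)) (distribˡ _ _ _)

    υσ-υσ : ∀ {x} → F x → υσ (υσ x) ≈ x
    υσ-υσ {x} x∈F = begin
      υ * σ 1 (υ * σ 1 x)        ≈⟨ *-congˡ (σ-* 1 υ _) ⟩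
      υ * (σ 1 υ * σ 1 (σ 1 x))  ≈⟨ *-assoc _ _ _ ⟨
      (υ * σ 1 υ) * σ 1 (σ 1 x)  ≈⟨ *-cong υσυ (trans (σ-∘ 1 1 x) x∈F) ⟩
      1# * x                     ≈⟨ *-identityˡ x ⟩
      x                          ∎

    h-hermitian : ∀ y z → υσ (h y z) ≈ h z y
    h-hermitian y z = begin
      υσ (h y z)                            ≈⟨ trans (υσ-cong (h≈B y z)) (υσ-+ _ _) ⟩
      υσ (υσ (B z y)) + υσ (B y z)          ≈⟨ +-congʳ (υσ-υσ (Tr∈F _)) ⟩
      B z y + υσ (B y z)                    ≈⟨ +-comm _ _ ⟩
      υσ (B y z) + B z y                    ≈⟨ h≈B z y ⟨
      h z y                                 ∎

    g : Carrier → Carrier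
    g x = h x x

    g-cong : ∀ {x y} → x ≈ y → g x ≈ g y
    g-cong e = h-cong e e

    g-*ˡ : ∀ {t} → F t → ∀ x → g (t * x) ≈ pow R t (q ℕ.+ 1) * g x
    g-*ˡ {t} t∈F x = begin
      Tr ((t * x) * M (t * x))        ≈⟨ Tr-cong (trans (*-congˡ (M-*ˡ t∈F x)) (*-interchange _ _ _ _)) ⟩
      Tr ((t * σ 1 t) * (x * M x))    ≈⟨ Tr-cong (*-assoc _ _ _) ⟩
      Tr (t * (σ 1 t * (x * M x)))    ≈⟨ trans (Tr-*ˡ t∈F _) (*-congˡ (Tr-*ˡ (F-σ t∈F) _)) ⟩
      t * (σ 1 t * g x)               ≈⟨ *-assoc _ _ _ ⟨
      t * σ 1 t * g x                 ≈⟨ *-congʳ (trans (*-congˡ (sym (pow-q t))) (pow-≡ t (ℕ.+-comm 1 q))) ⟩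
      pow R t (q ℕ.+ 1) * g x         ∎

    W : Carrier → Set ℓ
    W s = υσ s ≈ s

    W? : ∀ s → Dec (W s)
    W? s = υσ s ≟ s

    W-resp : ∀ {x y} → x ≈ y → W x → W y
    W-resp e w = trans (υσ-cong (sym e)) (trans w e)

    g∈W : ∀ x → W (g x)
    g∈W x = h-hermitian x x

    0∈W : W 0#
    0∈W = trans (*-congˡ (σ-0# 1)) (zeroʳ υ)

    W-neg : ∀ {x} → W x → W (- x)
    W-neg {x} w = trans (*-congˡ (σ-neg 1 x)) (trans (sym (-‿distribʳ-* _ _)) (-‿cong w))

    τ∈W : ∀ {θ} → F θ → W (θ + υσ θ)
    τ∈W θ∈F = trans (υσ-+ _ _) (trans (+-congˡ (υσ-υσ θ∈F)) (+-comm _ _))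

    #W≤q : # W? ≤ q
    #W≤q = #-roots (Lead-+ (Lead-monomial q υ) (Deg<-monomial 1 (- 1#) 2≤q) (λ _ → refl)) υ≉0 W?
      (λ s w → begin
        υ * pow R s q + - 1# * pow R s 1
          ≈⟨ +-cong (*-congˡ (pow-q s)) (trans (sym (-‿distribˡ-* _ _)) (-‿cong (trans (*-identityˡ _) (pow-1 s)))) ⟩
        υσ s - s ≈⟨ x-y≈0 w ⟩
        0# ∎)

    n₁ : ℕ
    n₁ = n ℕ.∸ 1

    suc-n₁ : suc n₁ ≡ n
    suc-n₁ = ℕ.m+[n∸m]≡n 1≤n

    -- A polynomial in y of degree q^(2n-1) with values in W, where |W| ≤ q: all its fibres over W must be full.
    T : Carrier → Carrier → Carrier
    T μ y = Tr (y * μ) + υσ (Tr (y * μ))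

    private
      -- The j-th conjugate in the trace has exponent q^(2j) in y, its image under `υσ` has exponent
      -- q^(2j+1). Paired in this way the exponents increase with j, so the last pair carries the
      -- leading term; its coefficient, υ times the q^(2n-1)-th power of μ, is nonzero for nonzero
      -- μ.
      term : Carrier → ℕ → Carrier → Carrier
      term μ j y = υ * σ (2 ℕ.* j ℕ.+ 1) μ * σ (2 ℕ.* j ℕ.+ 1) y + σ (2 ℕ.* j) μ * σ (2 ℕ.* j) y

      term-Deg< : ∀ μ j {d} → q ℕ.^ (2 ℕ.* j ℕ.+ 1) < d → Deg< d (term μ j)
      term-Deg< μ j lt = Deg<-+ (Deg<-monomial (q ℕ.^ (2 ℕ.* j ℕ.+ 1)) _ lt)
        (Deg<-monomial (q ℕ.^ (2 ℕ.* j)) _ (ℕ.≤-<-trans (ℕ.^-monoʳ-≤ q (ℕ.m≤m+n (2 ℕ.* j) 1)) lt))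

      ∑-term-Lead : ∀ μ d s → Lead (υ * σ (2 ℕ.* d ℕ.+ 1) μ) (q ℕ.^ (2 ℕ.* d ℕ.+ 1))
                    (λ y → ∑ R (suc d) (λ j → term μ (toℕ j) y) - s)
      ∑-term-Lead μ d s = Lead-+ {g = λ y → υ * σ (2 ℕ.* d ℕ.+ 1) μ * σ (2 ℕ.* d ℕ.+ 1) y}
        (Lead-monomial (q ℕ.^ (2 ℕ.* d ℕ.+ 1)) _)
        (Deg<-+ (Deg<-+ (Deg<-monomial (q ℕ.^ (2 ℕ.* d)) (σ (2 ℕ.* d) μ) lt)
                        (Deg<-∑ d (λ j → term μ (toℕ j)) (λ j → term-Deg< μ (toℕ j) (lt′ (Fin.toℕ<n j)))))
                (Deg<-monomial 0 (- s) (ℕ.^-monoʳ-≤ q {0} {2 ℕ.* d ℕ.+ 1} z≤n)))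
        (λ y → begin
          ∑ R (suc d) (λ j → term μ (toℕ j) y) - s
            ≈⟨ +-cong (trans (∑-last d (λ j → term μ j y)) (+-comm _ _)) (sym (*-identityʳ _)) ⟩
          _ ≈⟨ trans (+-congʳ (+-assoc _ _ _)) (+-assoc _ _ _) ⟩
          _ ∎)
        where
        lt : q ℕ.^ (2 ℕ.* d) < q ℕ.^ (2 ℕ.* d ℕ.+ 1)
        lt = ℕ.^-monoʳ-< q 2≤q (ℕ.m<m+n (2 ℕ.* d) (s≤s z≤n))
        lt′ : ∀ {j} → j < d → q ℕ.^ (2 ℕ.* j ℕ.+ 1) < q ℕ.^ (2 ℕ.* d ℕ.+ 1)
        lt′ j<d = ℕ.^-monoʳ-< q 2≤q (ℕ.+-monoˡ-< 1 (ℕ.*-monoʳ-< 2 j<d))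

      T≈∑term : ∀ μ y → T μ y ≈ ∑ R n (λ j → term μ (toℕ j) y)
      T≈∑term μ y = begin
        Tr (y * μ) + υσ (Tr (y * μ))
          ≈⟨ +-comm _ _ ⟩
        υσ (Tr (y * μ)) + Tr (y * μ)
          ≈⟨ +-congʳ (trans (*-congˡ (σ-∑ 1 n _)) (∑-*ˡ n υ _)) ⟩
        ∑ R n (λ j → υ * σ 1 (σ (2 ℕ.* toℕ j) (y * μ))) + Tr (y * μ)
          ≈⟨ ∑-+ n _ _ ⟨
        ∑ R n (λ j → υ * σ 1 (σ (2 ℕ.* toℕ j) (y * μ)) + σ (2 ℕ.* toℕ j) (y * μ))
          ≈⟨ ∑-cong n (λ j → +-cong
               (trans (*-congˡ (trans (σ-∘ 1 (2 ℕ.* toℕ j) _) (trans (σ-≡ (ℕ.+-comm 1 (2 ℕ.* toℕ j)) _)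
                 (trans (σ-* (2 ℕ.* toℕ j ℕ.+ 1) y μ) (*-comm _ _))))) (sym (*-assoc _ _ _)))
               (trans (σ-* (2 ℕ.* toℕ j) y μ) (*-comm _ _))) ⟩
        ∑ R n (λ j → term μ (toℕ j) y) ∎

      2n₁+1 : 2 ℕ.* n₁ ℕ.+ 1 ≡ 2 ℕ.* n ℕ.∸ 1
      2n₁+1 = ≡.trans (double n₁) (≡.cong (λ j → 2 ℕ.* j ℕ.∸ 1) suc-n₁)
        where
        double : ∀ j → 2 ℕ.* j ℕ.+ 1 ≡ 2 ℕ.* suc j ℕ.∸ 1
        double j = ≡.trans (ℕ.+-comm (2 ℕ.* j) 1) (≡.sym (ℕ.+-suc j (j ℕ.+ 0)))

    e : ℕ
    e = q ℕ.^ (2 ℕ.* n ℕ.∸ 1)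

    0<e : 0 < e
    0<e = ℕ.^-monoʳ-≤ q {0} {2 ℕ.* n ℕ.∸ 1} z≤n

    Q≡eq : Q ≡ e ℕ.* q
    Q≡eq = ≡.trans (≡.cong (q ℕ.^_) (≡.sym (ℕ.m∸n+n≡m {2 ℕ.* n} {1} (ℕ.≤-trans 1≤n (ℕ.m≤m+n n (n ℕ.+ 0))))))
      (≡.trans (ℕ.^-distribˡ-+-* q (2 ℕ.* n ℕ.∸ 1) 1) (≡.cong (e ℕ.*_) (ℕ.*-identityʳ q)))

    private
      ⊤? : ∀ x → Dec (x ≈ x)
      ⊤? x = x ≟ x

      T-fibre-≤ : ∀ {μ} → ¬ (μ ≈ 0#) → ∀ s → fibre ⊤? (T μ) s ≤ e
      T-fibre-≤ {μ} μ≉0 s = ≡.subst (λ d → fibre ⊤? (T μ) s ≤ q ℕ.^ d) 2n₁+1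
        (#-roots (∑-term-Lead μ n₁ s) (*≉0 υ≉0 (σ≉0 (2 ℕ.* n₁ ℕ.+ 1) μ≉0)) _ root)
        where
        root : ∀ y → y ≈ y × T μ y ≈ s → ∑ R (suc n₁) (λ j → term μ (toℕ j) y) - s ≈ 0#
        root y (_ , Ty≈s) = x-y≈0 (trans
          (≡.subst (λ d → ∑ R d (λ j → term μ (toℕ j) y) ≈ T μ y) (≡.sym suc-n₁) (sym (T≈∑term μ y))) Ty≈s)

    -- The lower bound needs no explicit solution of υ s^(q-1) = 1: `T 1` maps q · e elements into W
    -- with at most e over each value. The same bounds with any nonzero μ then show that `T μ` takes
    -- each value in W exactly e times.
    #W≡q : # W? ≡ q
    #W≡q = target-≡ ⊤? W? W-resp (T 1#) (λ y _ → τ∈W (Tr∈F _)) e q (≡.trans (#-all ⊤? (λ _ → refl)) Q≡eq) #W≤q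
      (λ s _ → T-fibre-≤ nontriv s) 0<e

    #T≡ : ∀ {μ} → ¬ (μ ≈ 0#) → ∀ {s} → W s → # (λ y → T μ y ≟ s) ≡ e
    #T≡ {μ} μ≉0 {s} s∈W = ≡.trans
      (#-⇔ (λ y → T μ y ≟ s) (λ y → ⊤? y ×-dec (T μ y ≟ s)) (λ _ h → refl , h) (λ _ → proj₂))
      (fibre-≡ ⊤? W? W-resp (T μ) (λ y _ → τ∈W (Tr∈F _)) e q
        (≡.trans (#-all ⊤? (λ _ → refl)) Q≡eq) #W≤q (λ s _ → T-fibre-≤ μ≉0 s) s s∈W)

-- Integer arithmetic: the square of Z - M and the choice of its root.

module SecondMoment where
  open import Data.Integer using (_+_; _*_; _-_; -_; _^_)
  open import Algebra.Properties.Group (AbelianGroup.group ℤ.+-0-abelianGroup) using () renaming (∙-cancelʳ to +-cancelʳ)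

  ^-neg-square : ∀ q N → ((- q) ^ N) * ((- q) ^ N) ≡ (q ^ N) * (q ^ N)
  ^-neg-square q zero    = ≡.refl
  ^-neg-square q (suc N) = ≡.trans (regroup q ((- q) ^ N)) (≡.trans
    (≡.cong ((q * q) *_) (^-neg-square q N)) (≡.sym (regroup′ q (q ^ N))))
    where
    regroup : ∀ q x → (- q * x) * (- q * x) ≡ (q * q) * (x * x)
    regroup = solve-ℤ
    regroup′ : ∀ q x → (q * x) * (q * x) ≡ (q * q) * (x * x)
    regroup′ = solve-ℤ

  ^-neg≡1 : ∀ q N → ∃ λ C → (- q) ^ N ≡ + 1 + (q + + 1) * C
  ^-neg≡1 q zero    = + 0 , ≡.sym (≡.cong (λ t → + 1 + t) (ℤ.*-zeroʳ (q + + 1)))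
  ^-neg≡1 q (suc N) with ^-neg≡1 q N
  ... | C , e = - + 1 - q * C , ≡.trans (≡.cong (λ t → - q * t) e) (step q C)
    where
    step : ∀ q C → - q * (+ 1 + (q + + 1) * C) ≡ + 1 + (q + + 1) * (- + 1 - q * C)
    step = solve-ℤ

  pos-^ : ∀ a N → + (a ℕ.^ N) ≡ (+ a) ^ N
  pos-^ a zero    = ≡.refl
  pos-^ a (suc N) = ≡.trans (ℤ.pos-* a (a ℕ.^ N)) (≡.cong (λ t → + a * t) (pos-^ a N))

  module _ (q₁ : ℤ) (q₁≢0 : ¬ (q₁ ≡ + 0)) (Z M ρ e Q : ℤ) (Q≡eq : Q ≡ e * (+ 1 + q₁))
           (first : Q ≡ Z + q₁ * M)
           (second : (Z * Z + q₁ * (M * M)) + ρ * e ≡ ρ * Q + Q * e) where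
    private
      P = Z * Z + q₁ * (M * M)

      -- Lagrange's identity for the q numbers Z, M, ..., M: q times the sum of squares exceeds the
      -- square of the sum by the squared differences over pairs, and only the q₁ pairs of Z with an
      -- M contribute.
      completing : q₁ * ((Z - M) * (Z - M)) + Q * Q ≡ (+ 1 + q₁) * P
      completing = ≡.trans (≡.cong (λ Q → q₁ * ((Z - M) * (Z - M)) + Q * Q) first) (identity q₁ Z M)
        where
        identity : ∀ q₁ Z M → q₁ * ((Z - M) * (Z - M)) + (Z + q₁ * M) * (Z + q₁ * M)
                            ≡ (+ 1 + q₁) * (Z * Z + q₁ * (M * M))
        identity = solve-ℤ

      scaled : (+ 1 + q₁) * P ≡ q₁ * (ρ * Q) + Q * Q
      scaled = begin
        (+ 1 + q₁) * P                                       ≡⟨ i₁ (+ 1 + q₁) P ρ e ⟩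
        (+ 1 + q₁) * (P + ρ * e) - ρ * (e * (+ 1 + q₁))      ≡⟨ ≡.cong₂ (λ s t → (+ 1 + q₁) * s - ρ * t) second (≡.sym Q≡eq) ⟩
        (+ 1 + q₁) * (ρ * Q + Q * e) - ρ * Q                 ≡⟨ i₂ q₁ ρ Q e ⟩
        q₁ * (ρ * Q) + Q * (e * (+ 1 + q₁))                  ≡⟨ ≡.cong (λ t → q₁ * (ρ * Q) + Q * t) Q≡eq ⟨
        q₁ * (ρ * Q) + Q * Q                                 ∎
        where
        open ≡.≡-Reasoning
        i₁ : ∀ q P ρ e → q * P ≡ q * (P + ρ * e) - ρ * (e * q)
        i₁ = solve-ℤ
        i₂ : ∀ q₁ ρ Q e → (+ 1 + q₁) * (ρ * Q + Q * e) - ρ * Q ≡ q₁ * (ρ * Q) + Q * (e * (+ 1 + q₁))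
        i₂ = solve-ℤ

    -- `completing` and `scaled` evaluate the same multiple of P. Removing Q² from both and dividing
    -- by q₁ leaves the square.
    square : (Z - M) * (Z - M) ≡ ρ * Q
    square = ℤ.*-cancelˡ-≡ q₁ _ _ {{ℤ.≢-nonZero q₁≢0}}
      (+-cancelʳ (Q * Q) _ _ (≡.trans completing scaled))

  -- S = ± (-q)^N, and both S and (-q)^N are congruent to 1 modulo q + 1 ≥ 3.
  square-root : ∀ q → 2 ≤ q → ∀ N (S : ℤ) A → S ≡ + 1 + (+ q + + 1) * A →
                S * S ≡ ((+ q) ^ N) * ((+ q) ^ N) → S ≡ (- + q) ^ N
  square-root q 2≤q N S A S≡1 S²≡ = conclude (^-neg≡1 (+ q) N) (ℤ.i*j≡0⇒i≡0∨j≡0 (S - X) (≡.trans (difference S X)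
    (ℤ.i≡j⇒i-j≡0 (≡.trans S²≡ (≡.sym (^-neg-square (+ q) N))))))
    where
    X = (- + q) ^ N
    difference : ∀ S X → (S - X) * (S + X) ≡ S * S - X * X
    difference = solve-ℤ
    solve-for-2 : ∀ r A C → + 2 ≡ ((+ 1 + r * A) + (+ 1 + r * C)) + - (A + C) * r
    solve-for-2 = solve-ℤ
    conclude : (∃ λ C → X ≡ + 1 + (+ q + + 1) * C) → S - X ≡ + 0 ⊎ S + X ≡ + 0 → S ≡ X
    conclude _         (inj₁ S-X≡0) = ℤ.i-j≡0⇒i≡j S X S-X≡0
    conclude (C , X≡1) (inj₂ S+X≡0) = ⊥-elim (>⇒∤ (≡.subst (2 <_) (ℕ.+-comm 1 q) (s≤s 2≤q)) (ℤ.∣⇒∣ᵤ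
      (ℤ.divides {+ q + + 1} {+ 2} (- (A + C)) (≡.trans (solve-for-2 (+ q + + 1) A C) (≡.trans
        (≡.cong (λ t → t + - (A + C) * (+ q + + 1)) (≡.trans (≡.sym (≡.cong₂ _+_ S≡1 X≡1)) S+X≡0))
        (ℤ.+-identityˡ _))))))

-- Counting under bijections, exchange of counts, and free actions of roots of unity.

module Reindex {c ℓ : Level} (R : CommutativeRing c ℓ) {m : ℕ} (FF : IsFiniteFieldOfSize R m) where
  open CommutativeRing R
  open Field R FF
  open Fibres R FF

  private variable
    p : Level
    P : Carrier → Set p

  #-reindex : (P? : ∀ x → Dec (P x)) → (∀ {x y} → x ≈ y → P x → P y) → (α β : Carrier → Carrier) →
              (∀ {x y} → α x ≈ y → x ≈ β y) → (∀ {x y} → x ≈ β y → α x ≈ y) →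
              # (λ x → P? (α x)) ≡ # P?
  #-reindex P? resp α β to from = ≡.trans (#-def (λ x → P? (α x))) (≡.trans
    (∑ℕ.∑-reindex α β to from (λ x → when (P? x) 1)
      (λ {x} {y} e → ∑ℕ.when-⇔ (P? x) (P? y) (resp e) (resp (sym e)) 1))
    (≡.sym (#-def P?)))

  #-swap : {S : Carrier → Carrier → Set p} (S? : ∀ x y → Dec (S x y)) →
           Σℕ (λ x → # (S? x)) ≡ Σℕ (λ y → # (λ x → S? x y))
  #-swap S? = ≡.trans (∑ℕ.∑ₗ-cong elems (λ x → #-def (S? x))) (≡.trans
    (∑ℕ.∑ₗ-swap elems elems (λ x y → when (S? x y) 1))
    (≡.sym (∑ℕ.∑ₗ-cong elems (λ y → #-def (λ x → S? x y)))))

  ∣-Σℕ : ∀ d (xs : List Carrier) (w : Carrier → ℕ) → (∀ x → d ∣ w x) → d ∣ ∑ℕ.∑ₗ xs w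
  ∣-Σℕ d []       w _ = d ∣0
  ∣-Σℕ d (x ∷ xs) w h = ∣m∣n⇒∣m+n (h x) (∣-Σℕ d xs w h)

  -- The inverse of a, packaged as the pair of implications that reindexing along x ↦ a x asks for.
  *-move : ∀ {a} → ¬ (a ≈ 0#) → ∃ λ b → (∀ {x y} → a * x ≈ y → x ≈ b * y) × (∀ {x y} → x ≈ b * y → a * x ≈ y)
  *-move {a} a≉0 with inverse a a≉0
  ... | b , ab≈1 = b ,
    (λ {x} e → trans (sym (trans (sym (*-assoc b a x)) (trans (*-congʳ (trans (*-comm b a) ab≈1)) (*-identityˡ x)))) (*-congˡ e)) ,
    (λ {x} {y} e → trans (*-congˡ e) (trans (sym (*-assoc a b y)) (trans (*-congʳ ab≈1) (*-identityˡ y))))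

  -- The fibres of x ↦ x^d on A are empty or cosets of the d-th roots of unity.
  roots-of-unity-∣ : ∀ d (A? : ∀ x → Dec (P x)) → (∀ {x y} → x ≈ y → P x → P y) →
                     (∀ x → P x → ¬ (x ≈ 0#)) → (∀ u x → pow R u d ≈ 1# → P x → P (u * x)) →
                     # (λ u → pow R u d ≟ 1#) ∣ # A?
  roots-of-unity-∣ {P = A} d A? resp A≉0 stable =
    ≡.subst (_ ∣_) (≡.sym (Σ-fibre A? (λ x → pow R x d))) (∣-Σℕ _ elems _ each)
    where
    each : ∀ b → # (λ u → pow R u d ≟ 1#) ∣ fibre A? (λ x → pow R x d) b
    each b with fibre A? (λ x → pow R x d) b ℕ.≟ 0
    ... | yes ≡0 = ≡.subst (_ ∣_) (≡.sym ≡0) (_ ∣0)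
    ... | no  ≢0 with #-∃ _ (ℕ.n≢0⇒n>0 ≢0)
    ...   | x₀ , Ax₀ , x₀^d≈b with *-move (A≉0 x₀ Ax₀)
    ...     | y₀ , to , from = ℕ.∣-reflexive (≡.trans
      (#-⇔ _ (λ u → A? (x₀ * u) ×-dec (pow R (x₀ * u) d ≟ b))
        (λ u h → resp (*-comm u x₀) (stable u x₀ h Ax₀) ,
                 trans (pow-distrib d x₀ u) (trans (*-congˡ h) (trans (*-identityʳ _) x₀^d≈b)))
        (λ u (_ , h) → *-cancelˡ (pow≉0 d (A≉0 x₀ Ax₀))
          (trans (trans (sym (pow-distrib d x₀ u)) h) (trans (sym x₀^d≈b) (sym (*-identityʳ _))))))
      (#-reindex (λ x → A? x ×-dec (pow R x d ≟ b))
        (λ e (Ax , h) → resp e Ax , trans (pow-cong d (sym e)) h) (x₀ *_) (y₀ *_) to from))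

-- How often g takes each value in W.

module Values {c ℓ : Level} (R : CommutativeRing c ℓ) {p : ℕ} (pp : Prime p) (k q n : ℕ)
              (1≤k : 1 ≤ k) (q≡p^k : q ≡ p ℕ.^ k) (1≤n : 1 ≤ n)
              (FF : IsFiniteFieldOfSize R (q ℕ.^ (2 ℕ.* n)))
              (a : Fin n → CommutativeRing.Carrier R)
              (υ : CommutativeRing.Carrier R) (υ∈U : Setup.InU R q n a υ) where
  open CommutativeRing R
  open Forms R pp k q n 1≤k q≡p^k 1≤n FF a
  open Hermitian υ υ∈U
  open Reindex R FF
  open import Relation.Binary.Reasoning.Setoid setoid

  #g : Carrier → ℕ
  #g s = # (λ x → g x ≟ s)

  #g-cong : ∀ {s t} → s ≈ t → #g s ≡ #g t
  #g-cong e = #-⇔ _ _ (λ _ h → trans h e) (λ _ h → trans h (sym e))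

  W*? : ∀ s → Dec (W s × ¬ (s ≈ 0#))
  W*? s = W? s ×-dec ¬? (s ≟ 0#)

  #W*≡q₁ : # W*? ≡ q₁
  #W*≡q₁ = ℕ.suc-injective (≡.trans (≡.sym (≡.trans
    (#-⊎ W? (_≟ 0#) W*? split (λ _ e → W-resp (sym e) 0∈W) (λ _ → proj₁) (λ _ e w → proj₂ w e))
    (≡.cong (ℕ._+ # W*?) (#-one (_≟ 0#) 0# (λ _ e → e) (λ _ e → e))))) (≡.trans #W≡q (≡.sym suc-q₁)))
    where
    split : ∀ s → W s → s ≈ 0# ⊎ (W s × ¬ (s ≈ 0#))
    split s w with s ≟ 0#
    ... | yes e = inj₁ e
    ... | no ¬e = inj₂ (w , ¬e)

  -- A sample nonzero point of W, available because q - 1 > 0. By `#g-const` the choice does not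
  -- affect `M₀`.
  s₀ : Carrier
  s₀ = proj₁ (#-∃ W*? (≡.subst (0 <_) (≡.sym #W*≡q₁) 0<q₁))

  s₀∈W* : W s₀ × ¬ (s₀ ≈ 0#)
  s₀∈W* = proj₂ (#-∃ W*? (≡.subst (0 <_) (≡.sym #W*≡q₁) 0<q₁))

  -- Two nonzero values in W differ by a factor in F_q^*, which is a norm from F.
  #g-const : ∀ {s s′} → W s × ¬ (s ≈ 0#) → W s′ × ¬ (s′ ≈ 0#) → #g s ≡ #g s′
  #g-const {s} {s′} (s∈W , s≉0) (s′∈W , s′≉0) with *-move s≉0
  ... | s⁻¹ , _ , from = conclude (norm-onto r r^q₁≈1)
    where
    r = s⁻¹ * s′
    sr≈s′ : s * r ≈ s′
    sr≈s′ = from refl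
    r≉0 : ¬ (r ≈ 0#)
    r≉0 r≈0 = s′≉0 (trans (sym sr≈s′) (trans (*-congˡ r≈0) (zeroʳ s)))
    σr≈r : σ 1 r ≈ r
    σr≈r = *-cancelˡ s≉0 (begin
      s * σ 1 r              ≈⟨ *-congʳ s∈W ⟨
      (υ * σ 1 s) * σ 1 r    ≈⟨ *-assoc _ _ _ ⟩
      υ * (σ 1 s * σ 1 r)    ≈⟨ *-congˡ (trans (sym (σ-* 1 s r)) (σ-cong 1 sr≈s′)) ⟩
      υσ s′                  ≈⟨ trans s′∈W (sym sr≈s′) ⟩
      s * r                  ∎)
    r^q₁≈1 : pow R r q₁ ≈ 1#
    r^q₁≈1 = *-cancelˡ r≉0 (trans (pow-≡ r suc-q₁) (trans (pow-q r) (trans σr≈r (sym (*-identityʳ r)))))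
    conclude : (∃ λ t → ¬ (t ≈ 0#) × F t × pow R t (q ℕ.+ 1) ≈ r) → #g s ≡ #g s′
    conclude (t , t≉0 , t∈F , Nt≈r) with *-move t≉0
    ... | t⁻¹ , to′ , from′ = ≡.trans
      (#-⇔ (λ x → g x ≟ s) (λ x → g (t * x) ≟ s′)
        (λ x h → trans (scale x) (trans (*-congˡ h) (trans (*-comm r s) sr≈s′)))
        (λ x h → *-cancelˡ r≉0 (trans (sym (scale x)) (trans h (trans (sym sr≈s′) (*-comm s r))))))
      (#-reindex (λ x → g x ≟ s′) (λ e h → trans (g-cong (sym e)) h) (t *_) (t⁻¹ *_) to′ from′)
      where
      scale : ∀ x → g (t * x) ≈ r * g x
      scale x = trans (g-*ˡ t∈F x) (*-congʳ Nt≈r)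

  Z M₀ ρ : ℕ
  Z  = #g 0#
  M₀ = #g s₀
  ρ  = # (λ z → M z ≟ 0#)

  private
    -- Used with the identity for the first moment and with squaring for the second. The condition f
    -- 0 = 0 disposes of the s outside W, which g never attains.
    spread : (f : ℕ → ℕ) → f 0 ≡ 0 → ∀ s (s≟0 : Dec (s ≈ 0#)) (s∈W*? : Dec (W s × ¬ (s ≈ 0#))) →
             f (#g s) ≡ when s≟0 (f Z) ℕ.+ when s∈W*? (f M₀)
    spread f f0 s (yes e) (yes w) = ⊥-elim (proj₂ w e)
    spread f f0 s (yes e) (no _)  = ≡.trans (≡.cong f (#g-cong e)) (≡.sym (ℕ.+-identityʳ _))
    spread f f0 s (no ¬e) (yes w) = ≡.cong f (#g-const w s₀∈W*)
    spread f f0 s (no ¬e) (no ¬w) =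
      ≡.trans (≡.cong f (#-none _ (λ x gx≈s → ¬w (W-resp gx≈s (g∈W x) , λ e → ¬e e)))) f0

    Σ-spread : (f : ℕ → ℕ) → f 0 ≡ 0 → Σℕ (λ s → f (#g s)) ≡ f Z ℕ.+ q₁ ℕ.* f M₀
    Σ-spread f f0 = ≡.trans (∑ℕ.∑ₗ-cong elems (λ s → spread f f0 s (s ≟ 0#) (W*? s))) (≡.trans (∑ℕ.∑ₗ-∙ elems _ _)
      (≡.cong₂ ℕ._+_ (∑ℕ.delta 0# (f Z)) (≡.trans (Σℕ-when W*? (f M₀)) (≡.cong (ℕ._* f M₀) #W*≡q₁))))

  first-moment : Q ≡ Z ℕ.+ q₁ ℕ.* M₀
  first-moment = ≡.trans (≡.sym (#-all (λ x → x ≟ x) (λ _ → refl))) (≡.trans (Σ-fibre (λ x → x ≟ x) g)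
    (≡.trans (∑ℕ.∑ₗ-cong elems (λ s → #-⇔ _ (λ x → g x ≟ s) (λ _ → proj₂) (λ _ h → refl , h)))
      (Σ-spread (λ t → t) ≡.refl)))

  private
    -- The number of pairs (x, y) with g x = g y. It is evaluated twice: `pairs≡` sorts the pairs by
    -- their common value, `pairs-by-z` by the difference z = x - y.
    pairs : ℕ
    pairs = Σℕ (λ y → #g (g y))

    pairs≡ : pairs ≡ Z ℕ.* Z ℕ.+ q₁ ℕ.* (M₀ ℕ.* M₀)
    pairs≡ = ≡.trans (∑ℕ.∑-fibres g (λ y → #g (g y))) (≡.trans (∑ℕ.∑ₗ-cong elems inner) (Σ-spread (λ t → t ℕ.* t) ≡.refl))
      where
      inner : ∀ s → Σℕ (λ y → when (s ≟ g y) (#g (g y))) ≡ #g s ℕ.* #g s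
      inner s = ≡.trans (∑ℕ.∑ₗ-cong elems (λ y → ∑ℕ.when-cong (s ≟ g y) (λ e → #g-cong (sym e))))
        (≡.trans (Σℕ-when (λ y → s ≟ g y) (#g s)) (≡.cong (ℕ._* #g s) (#-⇔ _ _ (λ _ → sym) (λ _ → sym))))

    -- Polarisation. By Hermitian symmetry the cross terms h y z + h z y have the form θ + υ θ^q
    -- with θ = Tr(y M z), which is exactly `T (M z) y`. Hence g(z + y) = g(y) is an equation for
    -- `T`, whose fibres are known.
    g-+ : ∀ z y → g (z + y) ≈ g y + (T (M z) y + g z)
    g-+ z y = begin
      h (z + y) (z + y)                      ≈⟨ h-+ˡ z y (z + y) ⟩
      h z (z + y) + h y (z + y)              ≈⟨ +-cong (h-+ʳ z z y) (h-+ʳ y z y) ⟩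
      (g z + h z y) + (h y z + g y)          ≈⟨ +-comm _ _ ⟩
      (h y z + g y) + (g z + h z y)          ≈⟨ +-cong (+-comm _ _) (+-comm _ _) ⟩
      (g y + h y z) + (h z y + g z)          ≈⟨ trans (+-assoc _ _ _) (+-congˡ (sym (+-assoc _ _ _))) ⟩
      g y + ((h y z + h z y) + g z)          ≈⟨ +-congˡ (+-congʳ (+-congˡ (h-hermitian y z))) ⟨
      g y + (T (M z) y + g z)                ∎

    -- If M z ≉ 0, the value -g z lies in W and has e preimages under `T (M z)`. If M z ≈ 0, both
    -- sides of the equation vanish and all Q elements y qualify. Adding e in the second case lets
    -- the sum over z be written without truncated subtraction.
    #pairs-z : ∀ z → # (λ y → T (M z) y ≟ (- g z)) ℕ.+ when (M z ≟ 0#) e ≡ when (M z ≟ 0#) Q ℕ.+ e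
    #pairs-z z with M z ≟ 0#
    ... | no Mz≉0  = ≡.trans (ℕ.+-identityʳ _) (#T≡ Mz≉0 (W-neg (g∈W z)))
    ... | yes Mz≈0 = ≡.cong (ℕ._+ e) (#-all _ (λ y → begin
      T (M z) y   ≈⟨ +-cong (vanish y) (υσ-cong (vanish y)) ⟩
      0# + υσ 0#  ≈⟨ trans (+-identityˡ _) 0∈W ⟩
      0#          ≈⟨ -0#≈0# ⟨
      - 0#        ≈⟨ -‿cong (vanish z) ⟨
      - g z       ∎))
      where
      vanish : ∀ y → Tr (y * M z) ≈ 0#
      vanish y = trans (Tr-cong (trans (*-congˡ Mz≈0) (zeroʳ y))) Tr-0#

    pairs-by-z : pairs ≡ Σℕ (λ z → # (λ y → T (M z) y ≟ (- g z)))
    pairs-by-z = ≡.trans (∑ℕ.∑ₗ-cong elems translate) (#-swap (λ y z → T (M z) y ≟ (- g z)))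
      where
      translate : ∀ y → #g (g y) ≡ # (λ z → T (M z) y ≟ (- g z))
      translate y = ≡.trans (≡.sym (#-reindex (λ x → g x ≟ g y) (λ e h → trans (g-cong (sym e)) h) (_+ y) (_- y)
          (λ e → trans (sym (//-rightDividesʳ y _)) (+-congʳ e))
          (λ e → trans (+-congʳ e) (//-rightDividesˡ y _))))
        (#-⇔ (λ z → g (z + y) ≟ g y) (λ z → T (M z) y ≟ (- g z))
          (λ z eq → inverseˡ-unique _ _ (+-cancelˡ (g y) _ _ (trans (sym (g-+ z y)) (trans eq (sym (+-identityʳ _))))))
          (λ z eq → trans (g-+ z y) (trans (+-congˡ (trans (+-congʳ eq) (-‿inverseˡ _))) (+-identityʳ _))))

  second-moment : (Z ℕ.* Z ℕ.+ q₁ ℕ.* (M₀ ℕ.* M₀)) ℕ.+ ρ ℕ.* e ≡ ρ ℕ.* Q ℕ.+ Q ℕ.* e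
  second-moment = ≡.trans (≡.cong₂ ℕ._+_ (≡.trans (≡.sym pairs≡) pairs-by-z) (≡.sym (Σℕ-when (λ z → M z ≟ 0#) e)))
    (≡.trans (≡.sym (∑ℕ.∑ₗ-∙ elems _ _)) (≡.trans (∑ℕ.∑ₗ-cong elems #pairs-z) (≡.trans (∑ℕ.∑ₗ-∙ elems _ _)
      (≡.cong₂ ℕ._+_ (Σℕ-when (λ z → M z ≟ 0#) Q)
        (≡.trans (∑ℕ.∑ₗ-cong elems (λ z → ≡.sym (∑ℕ.when-yes (z ≟ z) refl e)))
          (≡.trans (Σℕ-when (λ z → z ≟ z) e) (≡.cong (ℕ._* e) (#-all (λ z → z ≟ z) (λ _ → refl)))))))))

  private
    g-0# : ∀ {x} → x ≈ 0# → g x ≈ 0#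
    g-0# x≈0 = trans (Tr-cong (trans (*-congʳ x≈0) (zeroˡ _))) Tr-0#

    U⊆F : ∀ {u} → pow R u (q ℕ.+ 1) ≈ 1# → F u
    U⊆F {u} u∈U = Forms.Hermitian.υ∈F R pp k q n 1≤k q≡p^k 1≤n FF a u u∈U

    level-∣ : ∀ s → (q ℕ.+ 1) ∣ # (λ x → (g x ≟ s) ×-dec ¬? (x ≟ 0#))
    level-∣ s = ≡.subst (λ d → d ∣ # (λ x → (g x ≟ s) ×-dec ¬? (x ≟ 0#))) #U (roots-of-unity-∣ (q ℕ.+ 1) _
      (λ e (gx≈s , x≉0) → trans (g-cong (sym e)) gx≈s , λ y≈0 → x≉0 (trans e y≈0)) (λ _ → proj₂)
      (λ u x u∈U (gx≈s , x≉0) → trans (g-*ˡ (U⊆F u∈U) x) (trans (*-congʳ u∈U) (trans (*-identityˡ _) gx≈s)) ,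
        *≉0 (root≉0 {q ℕ.+ 1} (ℕ.≤-trans 0<q (ℕ.m≤m+n q 1)) u∈U) x≉0))

  M₀-∣ : (q ℕ.+ 1) ∣ M₀
  M₀-∣ = ≡.subst ((q ℕ.+ 1) ∣_) (#-⇔ _ (λ x → g x ≟ s₀) (λ _ → proj₁)
    (λ x gx≈s₀ → gx≈s₀ , λ x≈0 → proj₂ s₀∈W* (trans (sym gx≈s₀) (g-0# x≈0)))) (level-∣ s₀)

  -- The element 0 is a zero of g that lies in no free orbit of U; it accounts for the 1. Nonzero
  -- levels do not contain it, so `M₀` has no such remainder.
  Z-∣ : ∃ λ A → Z ≡ 1 ℕ.+ A × (q ℕ.+ 1) ∣ A
  Z-∣ = _ , ≡.trans (#-⊎ (λ x → g x ≟ 0#) (_≟ 0#) (λ x → (g x ≟ 0#) ×-dec ¬? (x ≟ 0#)) split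
      (λ _ → g-0#) (λ _ → proj₁) (λ _ e h → proj₂ h e))
    (≡.cong (ℕ._+ # (λ x → (g x ≟ 0#) ×-dec ¬? (x ≟ 0#))) (#-one (_≟ 0#) 0# (λ _ e → e) (λ _ e → e))) , level-∣ 0#
    where
    split : ∀ x → g x ≈ 0# → x ≈ 0# ⊎ (g x ≈ 0# × ¬ (x ≈ 0#))
    split x h with x ≟ 0#
    ... | yes e = inj₁ e
    ... | no ¬e = inj₂ (h , ¬e)

  -- M is υ L* + L preceded by z ↦ z^q, which is a bijection with inverse `σ (2n - 1)`.
  ρ≡#ker : ρ ≡ # (λ x → (υ * L* x + L x) ≟ 0#)
  ρ≡#ker = #-reindex (λ x → (υ * L* x + L x) ≟ 0#)
    (λ e h → trans (+-cong (*-congˡ (L*-cong (sym e))) (L-cong (sym e))) h)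
    (λ z → pow R z q) (σ (2 ℕ.* n ℕ.∸ 1))
    (λ {x} e → trans (sym (inv x)) (trans (sym (σ-∘ (2 ℕ.* n ℕ.∸ 1) 1 x)) (σ-cong (2 ℕ.* n ℕ.∸ 1) (trans (sym (pow-q x)) e))))
    (λ {x} {y} e → trans (pow-q x) (trans (σ-cong 1 e) (trans (σ-∘ 1 (2 ℕ.* n ℕ.∸ 1) y)
      (trans (σ-≡ (ℕ.+-comm 1 (2 ℕ.* n ℕ.∸ 1)) y) (inv y)))))
    where
    inv : ∀ x → σ (2 ℕ.* n ℕ.∸ 1 ℕ.+ 1) x ≈ x
    inv x = trans (σ-≡ (ℕ.m∸n+n≡m {2 ℕ.* n} {1} (ℕ.≤-trans 1≤n (ℕ.m≤m+n n (n ℕ.+ 0)))) x) (σ-2n x)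

-- From dimension over F_{q^2} to number of elements.

module Dimension {c ℓ : Level} (R : CommutativeRing c ℓ) {p : ℕ} (pp : Prime p) (k q n : ℕ)
                 (1≤k : 1 ≤ k) (q≡p^k : q ≡ p ℕ.^ k) (1≤n : 1 ≤ n)
                 (FF : IsFiniteFieldOfSize R (q ℕ.^ (2 ℕ.* n)))
                 (a : Fin n → CommutativeRing.Carrier R) where
  open CommutativeRing R
  open Forms R pp k q n 1≤k q≡p^k 1≤n FF a
  open import Relation.Binary.Reasoning.Setoid setoid

  F-+ : ∀ {x y} → F x → F y → F (x + y)
  F-+ x∈F y∈F = trans (σ-+ 2 _ _) (+-cong x∈F y∈F)

  F-neg : ∀ {x} → F x → F (- x)
  F-neg x∈F = trans (σ-neg 2 _) (-‿cong x∈F)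

  #-list : {r : Level} {P : Carrier → Set r} (P? : ∀ x → Dec (P x)) (ys : List Carrier) →
           AllPairs (λ x y → ¬ (x ≈ y)) ys → (∀ x → P x → Any (x ≈_) ys) → (∀ x → Any (x ≈_) ys → P x) →
           length ys ≡ # P?
  #-list P? ys distinct-ys to from = ≡.trans (≡.trans (length-∑ₗ ys)
      (≡.trans (∑ℕ.∑ₗ-cong ys (λ y → ≡.sym (∑ℕ.delta y 1))) (∑ℕ.∑ₗ-swap ys elems _)))
    (≡.trans (∑ℕ.∑ₗ-cong elems (λ x → ≡.trans (∑ℕ.∑ₗ-cong ys (λ y → ∑ℕ.when-⇔ (x ≟ y) (y ≟ x) sym sym 1)) (inner x (P? x))))
      (≡.sym (#-def P?)))
    where
    -- `ys` and `elems` may contain different representatives of the same element, so the lists are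
    -- compared by counting pairs with y ≈ x: one such y if P x holds, none otherwise.
    inner : ∀ x (Px? : Dec _) → ∑ℕ.∑ₗ ys (λ y → when (y ≟ x) 1) ≡ when Px? 1
    inner x (yes Px) = ∑ℕ.delta-∈ ys distinct-ys x 1 (to x Px)
    inner x (no ¬Px) = ∑ℕ.delta-∉ ys x 1 (All.¬Any⇒All¬ ys (λ x∈ys → ¬Px (from x x∈ys)))

  Fs : List Carrier
  Fs = filter F? elems

  translates : Carrier → List Carrier → Carrier → List Carrier
  translates v ys e = map (λ y → e * v + y) ys

  span : ∀ d → (Fin d → Carrier) → List Carrier
  span zero    b = 0# ∷ []
  span (suc d) b = concat (map (translates (b Fin.zero) (span d (b ∘ Fin.suc))) Fs)

  length-span : ∀ d b → length (span d b) ≡ (q ℕ.^ 2) ℕ.^ d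
  length-span zero    b = ≡.refl
  length-span (suc d) b = ≡.trans (go Fs) (≡.cong₂ ℕ._*_ (≡.trans (length-filter F?) #F) (length-span d (b ∘ Fin.suc)))
    where
    ys = span d (b ∘ Fin.suc)
    go : ∀ es → length (concat (map (translates (b Fin.zero) ys) es)) ≡ length es ℕ.* length ys
    go []       = ≡.refl
    go (e ∷ es) = ≡.trans (List.length-++ (translates (b Fin.zero) ys e))
      (≡.cong₂ ℕ._+_ (List.length-map _ ys) (go es))

  Combination : ∀ d → (Fin d → Carrier) → Carrier → Set (c ⊔ ℓ)
  Combination d b x = Σ (Fin d → Carrier) λ coef → (∀ i → F (coef i)) × (x ≈ ∑ R d (λ i → coef i * b i))

  Independent : ∀ d → (Fin d → Carrier) → Set (c ⊔ ℓ)
  Independent d b = (coef : Fin d → Carrier) → (∀ i → F (coef i)) →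
                    ∑ R d (λ i → coef i * b i) ≈ 0# → ∀ i → coef i ≈ 0#

  infixr 5 _◂_
  _◂_ : ∀ {d} → Carrier → (Fin d → Carrier) → Fin (suc d) → Carrier
  (x ◂ f) Fin.zero    = x
  (x ◂ f) (Fin.suc i) = f i

  ◂-F : ∀ {d x} {f : Fin d → Carrier} → F x → (∀ i → F (f i)) → ∀ i → F ((x ◂ f) i)
  ◂-F x∈F f∈F Fin.zero    = x∈F
  ◂-F x∈F f∈F (Fin.suc i) = f∈F i

  span-sound : ∀ d b → All (Combination d b) (span d b)
  span-sound zero    b = ((λ ()) , (λ ()) , refl) ∷ []
  span-sound (suc d) b = All.concat⁺ (All.map⁺ (All.map
    (λ {e} e∈F → All.map⁺ (All.map
      (λ {y} (coef , coef∈F , y≈) → (e ◂ coef) , ◂-F e∈F coef∈F , +-congˡ y≈) (span-sound d (b ∘ Fin.suc))))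
    (All.all-filter F? elems)))

  span-complete : ∀ d b {x} → Combination d b x → Any (x ≈_) (span d b)
  span-complete zero    b (_ , _ , x≈0) = here x≈0
  span-complete (suc d) b {x} (coef , coef∈F , x≈) = Any.concat⁺ (Any.map⁺ (Any.map
    (λ {e} e≈ → Any.map⁺ (Any.map
      (λ y≈ → trans x≈ (+-cong (*-congʳ e≈) y≈))
      (span-complete d (b ∘ Fin.suc) (coef ∘ Fin.suc , coef∈F ∘ Fin.suc , refl))))
    Fs∋))
    where
    Fs∋ : Any (coef Fin.zero ≈_) Fs
    Fs∋ with Any.filter⁺ F? (complete (coef Fin.zero))
    ... | inj₁ ∈Fs = ∈Fs
    ... | inj₂ ¬F = ⊥-elim (¬F (trans (σ-cong 2 (sym c≈)) (trans (coef∈F Fin.zero) c≈)))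
      where
      c≈ = Any.lookup-result (complete (coef Fin.zero))

  AllPairs-with : {A : Set c} {P : A → Set ℓ} {S : A → A → Set ℓ} {xs : List A} →
                  All P xs → AllPairs S xs → AllPairs (λ x y → P x × P y × S x y) xs
  AllPairs-with []         []         = []
  AllPairs-with (Px ∷ Pxs) (Sx ∷ Sxs) = All.zipWith (λ (Py , Sxy) → Px , Py , Sxy) (Pxs , Sx) ∷ AllPairs-with Pxs Sxs

  difference : ∀ d (b f g : Fin d → Carrier) →
               ∑ R d (λ i → (f i - g i) * b i) + ∑ R d (λ i → g i * b i) ≈ ∑ R d (λ i → f i * b i)
  difference d b f g = trans (sym (∑-+ d _ _)) (∑-cong d (λ i → trans (sym (distribʳ (b i) _ _))
    (*-congʳ (//-rightDividesˡ (g i) (f i)))))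

  -- Within one block the head multiple cancels and the tail is independent. Across two blocks, an
  -- equality would give a vanishing combination with head coefficient e - e′, forcing e ≈ e′; this
  -- needs both heads in F_{q^2}, which is why membership is carried along with distinctness.
  span-distinct : ∀ d b → Independent d b → AllPairs (λ x y → ¬ (x ≈ y)) (span d b)
  span-distinct zero    b _     = [] ∷ []
  span-distinct (suc d) b indep = AllPairs.concat⁺
    (All.map⁺ (All.universal (λ e → AllPairs.map⁺ (AllPairs.map (λ y≉y′ eq → y≉y′ (+-cancelˡ _ _ _ eq)) tail-distinct)) Fs))
    (AllPairs.map⁺ (AllPairs.map
      (λ (e∈F , e′∈F , e≉e′) → All.map⁺ (All.map
        (λ y∈ → All.map⁺ (All.map (λ y′∈ eq → e≉e′ (same-head e∈F e′∈F y∈ y′∈ eq)) tail-sound)) tail-sound))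
      (AllPairs-with (All.all-filter F? elems) (AllPairs.filter⁺ F? distinct))))
    where
    b₀ = b Fin.zero
    tail-sound = span-sound d (b ∘ Fin.suc)
    tail-distinct : AllPairs (λ x y → ¬ (x ≈ y)) (span d (b ∘ Fin.suc))
    tail-distinct = span-distinct d (b ∘ Fin.suc) (λ coef coef∈F ∑≈0 i →
      indep (0# ◂ coef) (◂-F (σ-0# 2) coef∈F) (trans (+-cong (zeroˡ _) ∑≈0) (+-identityˡ 0#)) (Fin.suc i))
    same-head : ∀ {e e′ y y′} → F e → F e′ → Combination d (b ∘ Fin.suc) y → Combination d (b ∘ Fin.suc) y′ →
                e * b₀ + y ≈ e′ * b₀ + y′ → e ≈ e′
    same-head {e} {e′} {y} {y′} e∈F e′∈F (f , f∈F , y≈) (g , g∈F , y′≈) eq = x∙y⁻¹≈ε⇒x≈y e e′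
      (indep coef (◂-F (F-+ e∈F (F-neg e′∈F)) (λ i → F-+ (f∈F i) (F-neg (g∈F i))))
        (+-cancelʳ (∑ R (suc d) (λ i → (e′ ◂ g) i * b i)) _ _ (begin
          ∑ R (suc d) (λ i → coef i * b i) + ∑ R (suc d) (λ i → (e′ ◂ g) i * b i)
            ≈⟨ refl ⟩
          ∑ R (suc d) (λ i → ((e ◂ f) i - (e′ ◂ g) i) * b i) + ∑ R (suc d) (λ i → (e′ ◂ g) i * b i)
            ≈⟨ difference (suc d) b (e ◂ f) (e′ ◂ g) ⟩
          e * b₀ + ∑ R d (λ i → f i * b (Fin.suc i))     ≈⟨ +-congˡ y≈ ⟨
          e * b₀ + y                                     ≈⟨ eq ⟩
          e′ * b₀ + y′                                   ≈⟨ +-congˡ y′≈ ⟩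
          e′ * b₀ + ∑ R d (λ i → g i * b (Fin.suc i))    ≈⟨ +-identityˡ _ ⟨
          0# + ∑ R (suc d) (λ i → (e′ ◂ g) i * b i)      ∎)) Fin.zero)
      where
      coef : Fin (suc d) → Carrier
      coef = (e - e′) ◂ (λ i → f i - g i)

  #-dimension : {P : Carrier → Set ℓ} (P? : ∀ x → Dec (P x)) → (∀ {x y} → x ≈ y → P x → P y) →
                P 0# → (∀ {e x y} → F e → P x → P y → P (e * x + y)) →
                ∀ d → HasDimension P d → # P? ≡ (q ℕ.^ 2) ℕ.^ d
  #-dimension {P} P? resp P0 closed d (b , Pb , indep , spans) = ≡.trans
    (≡.sym (#-list P? (span d b) (span-distinct d b indep) (λ x Px → span-complete d b (spans x Px)) member))
    (length-span d b)
    where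
    combination : ∀ d (b : Fin d → Carrier) (coef : Fin d → Carrier) → (∀ i → P (b i)) → (∀ i → F (coef i)) →
                  P (∑ R d (λ i → coef i * b i))
    combination zero    b coef Pb coef∈F = P0
    combination (suc d) b coef Pb coef∈F =
      closed (coef∈F Fin.zero) (Pb Fin.zero) (combination d _ _ (Pb ∘ Fin.suc) (coef∈F ∘ Fin.suc))
    member : ∀ x → Any (x ≈_) (span d b) → P x
    member x x∈ with All.lookupAny (span-sound d b) x∈
    ... | (coef , coef∈F , y≈) , x≈y = resp (sym (trans x≈y y≈)) (combination d b coef Pb coef∈F)

-- Passage from integers to rationals, and the final ring identities.

module Rationals where
  -- Opaque, so that i / 1 is never normalised.
  opaque
    ι : ℤ → ℚ
    ι i = i / 1

    ℕ→ℚ≡ι : ∀ m → ℕ→ℚ m ≡ ι (+ m)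
    ℕ→ℚ≡ι m = ≡.refl

  private
    opaque
      unfolding ι
      toℚᵘ-ι : ∀ i → toℚᵘ (ι i) ℚᵘ.≃ mkℚᵘ i 0
      toℚᵘ-ι i = ℚ.toℚᵘ-fromℚᵘ (mkℚᵘ i 0)

    ℚ-ring : AlmostCommutativeRing 0ℓ 0ℓ
    ℚ-ring = fromCommutativeRing ℚ.+-*-commutativeRing (λ x → dec⇒maybe (ℚ.0ℚ ℚ.≟ x))

  ι-+ : ∀ i j → ι (i ℤ.+ j) ≡ ι i ℚ.+ ι j
  ι-+ i j = ℚ.toℚᵘ-injective (ℚᵘ.≃-trans (toℚᵘ-ι (i ℤ.+ j)) (ℚᵘ.≃-trans
    (ℚᵘ.*≡* (≡.cong (ℤ._* + 1) (≡.sym (≡.cong₂ ℤ._+_ (ℤ.*-identityʳ i) (ℤ.*-identityʳ j)))))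
    (ℚᵘ.≃-sym (ℚᵘ.≃-trans (ℚ.toℚᵘ-homo-+ (ι i) (ι j)) (ℚᵘ.+-cong (toℚᵘ-ι i) (toℚᵘ-ι j))))))

  ι-* : ∀ i j → ι (i ℤ.* j) ≡ ι i ℚ.* ι j
  ι-* i j = ℚ.toℚᵘ-injective (ℚᵘ.≃-trans (toℚᵘ-ι (i ℤ.* j))
    (ℚᵘ.≃-sym (ℚᵘ.≃-trans (ℚ.toℚᵘ-homo-* (ι i) (ι j)) (ℚᵘ.*-cong (toℚᵘ-ι i) (toℚᵘ-ι j)))))

  ι-neg : ∀ i → ι (ℤ.- i) ≡ ℚ.- ι i
  ι-neg i = ℚ.toℚᵘ-injective (ℚᵘ.≃-trans (toℚᵘ-ι (ℤ.- i))
    (ℚᵘ.≃-sym (ℚᵘ.≃-trans (ℚ.toℚᵘ-homo‿- (ι i)) (ℚᵘ.-‿cong (toℚᵘ-ι i)))))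

  ι-/ : ∀ i d .{{_ : NonZero d}} → ι (+ d) ℚ.* (i / d) ≡ ι i
  ι-/ i d@(suc d-1) = ℚ.toℚᵘ-injective (ℚᵘ.≃-trans (ℚ.toℚᵘ-homo-* (ι (+ d)) (i / d)) (ℚᵘ.≃-trans
    (ℚᵘ.*-cong (toℚᵘ-ι (+ d)) (ℚ.toℚᵘ-fromℚᵘ (mkℚᵘ i d-1)))
    (ℚᵘ.≃-trans (ℚᵘ.*≡* (rearrange (+ d) i)) (ℚᵘ.≃-sym (toℚᵘ-ι i)))))
    where
    rearrange : ∀ d i → (d ℤ.* i) ℤ.* + 1 ≡ i ℤ.* (+ 1 ℤ.* d)
    rearrange = solve-ℤ

  ι-*-cancelˡ : ∀ d .{{_ : NonZero d}} x y → ι (+ d) ℚ.* x ≡ ι (+ d) ℚ.* y → x ≡ y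
  ι-*-cancelˡ d x y e = ≡.trans (≡.sym (undo x)) (≡.trans (≡.cong ((+ 1 / d) ℚ.*_) e) (undo y))
    where
    undo : ∀ x → (+ 1 / d) ℚ.* (ι (+ d) ℚ.* x) ≡ x
    undo x = ≡.trans (≡.sym (ℚ.*-assoc (+ 1 / d) (ι (+ d)) x)) (≡.trans
      (≡.cong (ℚ._* x) (≡.trans (ℚ.*-comm (+ 1 / d) (ι (+ d))) (≡.trans (ι-/ (+ 1) d) (≡.sym (ℕ→ℚ≡ι 1))))) (ℚ.*-identityˡ x))

  negQPow-spec : ∀ q r .{{_ : NonZero q}} → ι (+ (q ℕ.^ r)) ℚ.* negQPow q r ≡ ι ((ℤ.- + 1) ℤ.^ r)
  negQPow-spec (suc m) r = ι-/ ((ℤ.- + 1) ℤ.^ r) (suc m ℕ.^ r) {{ℕ.m^n≢0 (suc m) r}}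

  private
    ^-neg : ∀ q N → (ℤ.- q) ℤ.^ N ≡ (ℤ.- + 1) ℤ.^ N ℤ.* q ℤ.^ N
    ^-neg q zero    = ≡.refl
    ^-neg q (suc N) = ≡.trans (≡.cong (λ t → (ℤ.- q) ℤ.* t) (^-neg q N)) (step q ((ℤ.- + 1) ℤ.^ N) (q ℤ.^ N))
      where
      step : ∀ q s t → (ℤ.- q) ℤ.* (s ℤ.* t) ≡ ((ℤ.- + 1) ℤ.* s) ℤ.* (q ℤ.* t)
      step = solve-ℤ

    sign-parity : ∀ r d → (ℤ.- + 1) ℤ.^ (d ℕ.+ (d ℕ.+ r)) ≡ (ℤ.- + 1) ℤ.^ r
    sign-parity r zero    = ≡.refl
    sign-parity r (suc d) rewrite ℕ.+-suc d (d ℕ.+ r) = ≡.trans (step ((ℤ.- + 1) ℤ.^ (d ℕ.+ (d ℕ.+ r)))) (sign-parity r d)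
      where
      step : ∀ s → (ℤ.- + 1) ℤ.* ((ℤ.- + 1) ℤ.* s) ≡ s
      step = solve-ℤ

  -- With r = n - d, 2n = (n + d) + r, so q^r cancels the denominator and leaves q^(n+d). The
  -- exponents n + d and r have the same parity, so the sign is that of (-1)^(n+d).
  q^2n*negQPow : ∀ q n d .{{_ : NonZero q}} → d ≤ n →
                 ι (+ (q ℕ.^ (2 ℕ.* n))) ℚ.* negQPow q (n ℕ.∸ d) ≡ ι ((ℤ.- + q) ℤ.^ (n ℕ.+ d))
  q^2n*negQPow q n d d≤n = begin
    ι (+ (q ℕ.^ (2 ℕ.* n))) ℚ.* χ
      ≡⟨ ≡.cong (λ t → ι (+ t) ℚ.* χ) (≡.trans (≡.cong (q ℕ.^_) 2n≡) (ℕ.^-distribˡ-+-* q (n ℕ.+ d) r)) ⟩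
    ι (+ (q ℕ.^ (n ℕ.+ d) ℕ.* q ℕ.^ r)) ℚ.* χ
      ≡⟨ ≡.cong (ℚ._* χ) (≡.trans (≡.cong ι (ℤ.pos-* (q ℕ.^ (n ℕ.+ d)) (q ℕ.^ r))) (ι-* _ _)) ⟩
    ι (+ (q ℕ.^ (n ℕ.+ d))) ℚ.* ι (+ (q ℕ.^ r)) ℚ.* χ
      ≡⟨ ≡.trans (ℚ.*-assoc (ι (+ (q ℕ.^ (n ℕ.+ d)))) (ι (+ (q ℕ.^ r))) χ) (≡.cong (ι (+ (q ℕ.^ (n ℕ.+ d))) ℚ.*_) (negQPow-spec q r)) ⟩
    ι (+ (q ℕ.^ (n ℕ.+ d))) ℚ.* ι ((ℤ.- + 1) ℤ.^ r)
      ≡⟨ ≡.trans (≡.sym (ι-* _ _)) (≡.cong ι (ℤ.*-comm (+ (q ℕ.^ (n ℕ.+ d))) _)) ⟩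
    ι ((ℤ.- + 1) ℤ.^ r ℤ.* + (q ℕ.^ (n ℕ.+ d)))
      ≡⟨ ≡.cong ι (≡.cong₂ ℤ._*_ (≡.sym (≡.trans (≡.cong ((ℤ.- + 1) ℤ.^_) n+d≡) (sign-parity r d)))
           (SecondMoment.pos-^ q (n ℕ.+ d))) ⟩
    ι ((ℤ.- + 1) ℤ.^ (n ℕ.+ d) ℤ.* (+ q) ℤ.^ (n ℕ.+ d))
      ≡⟨ ≡.cong ι (^-neg (+ q) (n ℕ.+ d)) ⟨
    ι ((ℤ.- + q) ℤ.^ (n ℕ.+ d)) ∎
    where
    open ≡.≡-Reasoning
    r = n ℕ.∸ d
    χ = negQPow q r
    n≡ : d ℕ.+ r ≡ n
    n≡ = ℕ.m+[n∸m]≡n d≤n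
    2n≡ : 2 ℕ.* n ≡ (n ℕ.+ d) ℕ.+ r
    2n≡ = ≡.trans (≡.cong (n ℕ.+_) (≡.trans (ℕ.+-identityʳ n) (≡.sym n≡))) (≡.sym (ℕ.+-assoc n d r))
    n+d≡ : n ℕ.+ d ≡ d ℕ.+ (d ℕ.+ r)
    n+d≡ = ≡.trans (ℕ.+-comm n d) (≡.cong (d ℕ.+_) (≡.sym n≡))

  open import Data.Rational using (_+_; _*_; _-_; -_)

  -- E stands for q^(2(n-1)) and S for the sum over U. The hypothesis is the number of hits times q,
  -- summed over U. The factor q² stays on both sides and is cancelled at the very end, so no
  -- division enters the identity.
  total-zero : ∀ q N Q S q₁ E → Q ≡ q * (q * E) →
               q * (q * N + Q) ≡ (q * Q + Q) + (q₁ * Q) * S → q * (q * N) ≡ q * (q * (E + (q₁ * E) * S))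
  total-zero q N Q S q₁ E Q≡ h = ≡.trans (isolate q N Q) (≡.trans (≡.cong (_- q * Q) h)
    (≡.trans (≡.cong (λ Q → (q * Q + Q) + (q₁ * Q) * S - q * Q) Q≡) (expand q S q₁ E)))
    where
    isolate : ∀ q N Q → q * (q * N) ≡ q * (q * N + Q) - q * Q
    isolate = solve-ring ℚ-ring
    expand : ∀ q S q₁ E → (q * (q * (q * E)) + q * (q * E)) + (q₁ * (q * (q * E))) * S - q * (q * (q * E))
                          ≡ q * (q * (E + (q₁ * E) * S))
    expand = solve-ring ℚ-ring

  total-nonzero : ∀ q N Q S χ E → Q ≡ q * (q * E) →
                  q * (q * N + Q) ≡ (q * Q + Q) + (- Q) * S + q * (Q * χ) →
                  q * (q * N) ≡ q * (q * (E + (q * E) * χ - E * S))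
  total-nonzero q N Q S χ E Q≡ h = ≡.trans (isolate q N Q) (≡.trans (≡.cong (_- q * Q) h)
    (≡.trans (≡.cong (λ Q → (q * Q + Q) + (- Q) * S + q * (Q * χ) - q * Q) Q≡) (expand q S χ E)))
    where
    isolate : ∀ q N Q → q * (q * N) ≡ q * (q * N + Q) - q * Q
    isolate = solve-ring ℚ-ring
    expand : ∀ q S χ E →
             (q * (q * (q * E)) + q * (q * E)) + (- (q * (q * E))) * S + q * ((q * (q * E)) * χ) - q * (q * (q * E))
             ≡ q * (q * (E + (q * E) * χ - E * S))
    expand = solve-ring ℚ-ring

  -- The value for a zero level is the value Q - Qχ for a nonzero level plus q Qχ, with q written as
  -- 1 + q₁. The sum over U thereby becomes a uniform sum plus a term concentrated at one υ.
  absorb : ∀ Q χ q₁ → Q + q₁ * (Q * χ) ≡ (Q + (- Q) * χ) + (ι (+ 1) + q₁) * (Q * χ)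
  absorb Q χ q₁ = ≡.subst (λ one → Q + q₁ * (Q * χ) ≡ (Q + (- Q) * χ) + (one + q₁) * (Q * χ)) (ℕ→ℚ≡ι 1)
    (≡.trans (step Q χ q₁ (Q * χ)) (≡.cong (λ t → (Q + (- Q) * χ) + t) (≡.sym (≡.trans (ℚ.*-distribʳ-+ (Q * χ) ℚ.1ℚ q₁)
      (≡.cong (_+ q₁ * (Q * χ)) (ℚ.*-identityˡ (Q * χ)))))))
    where
    step : ∀ Q χ q₁ x → Q + q₁ * (Q * χ) ≡ (Q + (- Q) * χ) + (Q * χ + q₁ * (Q * χ))
    step = solve-ring ℚ-ring

open Rationals

^-cancelʳ-≤ : ∀ q → 2 ≤ q → ∀ {i j} → q ℕ.^ i ≤ q ℕ.^ j → i ≤ j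
^-cancelʳ-≤ q 2≤q {i} {j} h with i ℕ.≤? j
... | yes i≤j = i≤j
... | no  i≰j = ⊥-elim (ℕ.<⇒≱ (ℕ.^-monoʳ-< q 2≤q (ℕ.≰⇒> i≰j)) h)

-- The exact level counts of g in terms of the dimension of the kernel.

module Evaluation {c ℓ : Level} (R : CommutativeRing c ℓ) {p : ℕ} (pp : Prime p) (k q n : ℕ)
                  (1≤k : 1 ≤ k) (q≡p^k : q ≡ p ℕ.^ k) (1≤n : 1 ≤ n)
                  (FF : IsFiniteFieldOfSize R (q ℕ.^ (2 ℕ.* n)))
                  (a : Fin n → CommutativeRing.Carrier R)
                  (υ : CommutativeRing.Carrier R) (υ∈U : Setup.InU R q n a υ)
                  (d : ℕ) (dimension : Setup.HasDimension R q n a (Setup.InKer R q n a υ) d) where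
  open CommutativeRing R using (_≈_; 0#; trans; sym; +-cong; *-congˡ; zeroʳ; +-identityʳ; distribˡ)
    renaming (_+_ to _⊕_; _*_ to _⊛_)
  open Forms R pp k q n 1≤k q≡p^k 1≤n FF a
  open Hermitian υ υ∈U using (e; Q≡eq; W)
  open Values R pp k q n 1≤k q≡p^k 1≤n FF a υ υ∈U
  open Dimension R pp k q n 1≤k q≡p^k 1≤n FF a using (#-dimension)

  ker? : ∀ x → Dec (InKer υ x)
  ker? x = (υ ⊛ L* x ⊕ L x) ≟ 0#

  #ker : # ker? ≡ q ℕ.^ (2 ℕ.* d)
  #ker = ≡.trans (#-dimension ker? (λ x≈y h → trans (sym (+-cong (*-congˡ (L*-cong x≈y)) (L-cong x≈y))) h)
      (trans (+-cong (trans (*-congˡ L*0) (zeroʳ υ)) L0) (+-identityʳ 0#)) closed d dimension)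
    (ℕ.^-*-assoc q 2 d)
    where
    L0 : L 0# ≈ 0#
    L0 = x+x≈x⇒x≈0 _ (trans (sym (L-+ 0# 0#)) (L-cong (+-identityʳ 0#)))
    L*0 : L* 0# ≈ 0#
    L*0 = x+x≈x⇒x≈0 _ (trans (sym (L*-+ 0# 0#)) (L*-cong (+-identityʳ 0#)))
    closed : ∀ {t x y} → F t → InKer υ x → InKer υ y → InKer υ (t ⊛ x ⊕ y)
    closed {t} {x} {y} t∈F hx hy = begin
      υ ⊛ L* (t ⊛ x ⊕ y) ⊕ L (t ⊛ x ⊕ y)
        ≈⟨ +-cong (trans (*-congˡ (trans (L*-+ _ _) (+-cong (L*-*ˡ t∈F x) (CommutativeRing.refl R)))) (distribˡ _ _ _))
                  (trans (L-+ _ _) (+-cong (L-*ˡ t∈F x) (CommutativeRing.refl R))) ⟩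
      (υ ⊛ (t ⊛ L* x) ⊕ υ ⊛ L* y) ⊕ (t ⊛ L x ⊕ L y)
        ≈⟨ interchange _ _ _ _ ⟩
      (υ ⊛ (t ⊛ L* x) ⊕ t ⊛ L x) ⊕ (υ ⊛ L* y ⊕ L y)
        ≈⟨ +-cong (trans (+-cong (x∙yz≈y∙xz υ t (L* x)) (CommutativeRing.refl R)) (sym (distribˡ _ _ _))) hy ⟩
      t ⊛ (υ ⊛ L* x ⊕ L x) ⊕ 0#
        ≈⟨ trans (+-identityʳ _) (trans (*-congˡ hx) (zeroʳ t)) ⟩
      0# ∎
      where
      open import Relation.Binary.Reasoning.Setoid (CommutativeRing.setoid R)
      open import Algebra.Properties.CommutativeSemigroup (CommutativeRing.+-commutativeSemigroup R) using (interchange)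
      open import Algebra.Properties.CommutativeSemigroup (CommutativeRing.*-commutativeSemigroup R) using (x∙yz≈y∙xz)

  -- The kernel has q^(2d) elements inside a field of q^(2n). This makes `n ∸ d` a genuine
  -- difference, namely R(υ).
  d≤n : d ≤ n
  d≤n = ℕ.*-cancelˡ-≤ 2 (^-cancelʳ-≤ q 2≤q (≡.subst (_≤ Q) #ker (#≤ ker?)))
    where
    #≤ : ∀ {r} {P : CommutativeRing.Carrier R → Set r} (P? : ∀ x → Dec (P x)) → # P? ≤ Q
    #≤ P? = ≡.subst (# P? ≤_) (#-all (λ x → x ≟ x) (λ _ → CommutativeRing.refl R))
      (≡.subst₂ _≤_ (≡.sym (#-def P?)) (≡.sym (#-def (λ x → x ≟ x))) (Σℕ-mono elems _ _ bound))
      where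
      bound : ∀ x → when (P? x) 1 ≤ when (x ≟ x) 1
      bound x = ≡.subst (when (P? x) 1 ≤_) (≡.sym (∑ℕ.when-yes (x ≟ x) (CommutativeRing.refl R) 1)) (when≤1 (P? x))
        where
        when≤1 : ∀ Px? → when Px? 1 ≤ 1
        when≤1 (yes _) = ℕ.≤-refl
        when≤1 (no _)  = z≤n

  -- The integer form of q^(2n) (-q)^(-R(υ)), since 2n - (n - d) = n + d and the signs agree.
  X : ℤ
  X = (ℤ.- + q) ℤ.^ (n ℕ.+ d)

  private
    open import Data.Integer using (_+_; _*_; _-_; -_)

    q≡1+q₁ : + q ≡ + 1 + + q₁
    q≡1+q₁ = ≡.cong +_ (≡.sym suc-q₁)

    Qℤ : + Q ≡ + e * (+ 1 + + q₁)
    Qℤ = ≡.trans (≡.cong +_ Q≡eq) (≡.trans (ℤ.pos-* e q) (≡.cong (λ t → + e * t) q≡1+q₁))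

    first : + Q ≡ + Z + + q₁ * + M₀
    first = ≡.trans (≡.cong +_ first-moment) (≡.cong (λ t → + Z + t) (ℤ.pos-* q₁ M₀))

    second : (+ Z * + Z + + q₁ * (+ M₀ * + M₀)) + + ρ * + e ≡ + ρ * + Q + + Q * + e
    second = ≡.trans (≡.sym (≡.cong₂ _+_ (≡.cong₂ _+_ (ℤ.pos-* Z Z)
        (≡.trans (ℤ.pos-* q₁ (M₀ ℕ.* M₀)) (≡.cong (λ t → + q₁ * t) (ℤ.pos-* M₀ M₀)))) (ℤ.pos-* ρ e)))
      (≡.trans (≡.cong +_ second-moment) (≡.cong₂ _+_ (ℤ.pos-* ρ Q) (ℤ.pos-* Q e)))

    q₁≢0 : ¬ (+ q₁ ≡ + 0)
    q₁≢0 h = ℕ.<⇒≢ 0<q₁ (≡.sym (ℤ.+-injective h))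

    ρQ : + ρ * + Q ≡ ((+ q) ℤ.^ (n ℕ.+ d)) * ((+ q) ℤ.^ (n ℕ.+ d))
    ρQ = ≡.trans (≡.sym (ℤ.pos-* ρ Q)) (≡.trans (≡.cong +_ power) (≡.trans (ℤ.pos-* (q ℕ.^ (n ℕ.+ d)) (q ℕ.^ (n ℕ.+ d)))
      (≡.cong₂ _*_ (SecondMoment.pos-^ q (n ℕ.+ d)) (SecondMoment.pos-^ q (n ℕ.+ d)))))
      where
      power : ρ ℕ.* Q ≡ q ℕ.^ (n ℕ.+ d) ℕ.* q ℕ.^ (n ℕ.+ d)
      power = ≡.trans (≡.cong (ℕ._* Q) (≡.trans ρ≡#ker #ker)) (≡.trans (≡.sym (ℕ.^-distribˡ-+-* q (2 ℕ.* d) (2 ℕ.* n)))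
        (≡.trans (≡.cong (q ℕ.^_) (exponents d n)) (ℕ.^-distribˡ-+-* q (n ℕ.+ d) (n ℕ.+ d))))
        where
        exponents : ∀ d n → 2 ℕ.* d ℕ.+ 2 ℕ.* n ≡ (n ℕ.+ d) ℕ.+ (n ℕ.+ d)
        exponents = solve-∀

    S≡1 : ∃ λ A → + Z - + M₀ ≡ + 1 + (+ q + + 1) * A
    S≡1 = from Z-∣ M₀-∣
      where
      collect : ∀ r A B → (+ 1 + A * r) - B * r ≡ + 1 + r * (A - B)
      collect = solve-ℤ
      from : ∀ {z m} → (∃ λ A → z ≡ 1 ℕ.+ A × (q ℕ.+ 1) ∣ A) → (q ℕ.+ 1) ∣ m →
             ∃ λ A → + z - + m ≡ + 1 + (+ q + + 1) * A
      from (_ , ≡.refl , divides A ≡.refl) (divides B ≡.refl) = + A - + B , ≡.trans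
        (≡.cong₂ (λ s t → (+ 1 + s) - t) (ℤ.pos-* A (q ℕ.+ 1)) (ℤ.pos-* B (q ℕ.+ 1)))
        (collect (+ q + + 1) (+ A) (+ B))

    S≡X : + Z - + M₀ ≡ X
    S≡X = SecondMoment.square-root q 2≤q (n ℕ.+ d) _ (proj₁ S≡1) (proj₂ S≡1)
      (≡.trans (SecondMoment.square (+ q₁) q₁≢0 (+ Z) (+ M₀) (+ ρ) (+ e) (+ Q) Qℤ first second) ρQ)

  -- Here and in the nonzero case: the solution of the linear system Z + q₁ M₀ = Q, Z - M₀ = X.
  q*#g-zero : ∀ {s} → s ≈ 0# → + q * + #g s ≡ + Q + + q₁ * X
  q*#g-zero s≈0 = ≡.trans (≡.cong₂ _*_ q≡1+q₁ (≡.cong +_ (#g-cong s≈0))) (≡.trans (expand (+ q₁) (+ Z) (+ M₀))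
    (≡.cong₂ (λ s t → s + + q₁ * t) (≡.sym first) S≡X))
    where
    expand : ∀ q₁ Z M → (+ 1 + q₁) * Z ≡ (Z + q₁ * M) + q₁ * (Z - M)
    expand = solve-ℤ

  q*#g-nonzero : ∀ {s} → W s → ¬ (s ≈ 0#) → + q * + #g s ≡ + Q - X
  q*#g-nonzero s∈W s≉0 = ≡.trans (≡.cong₂ _*_ q≡1+q₁ (≡.cong +_ (#g-const (s∈W , s≉0) s₀∈W*)))
    (≡.trans (expand (+ q₁) (+ Z) (+ M₀)) (≡.cong₂ _-_ (≡.sym first) S≡X))
    where
    expand : ∀ q₁ Z M → (+ 1 + q₁) * M ≡ (Z + q₁ * M) - (Z - M)
    expand = solve-ℤ

  χ : ℚ
  χ = negQPow q (n ℕ.∸ d)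

  private
    ιX : ι X ≡ ι (+ Q) ℚ.* χ
    ιX = ≡.sym (q^2n*negQPow q n d d≤n)

  #g-zero : ∀ {s} → s ≈ 0# → ι (+ q) ℚ.* ι (+ #g s) ≡ ι (+ Q) ℚ.+ ι (+ q₁) ℚ.* (ι (+ Q) ℚ.* χ)
  #g-zero {s} s≈0 = ≡.trans (≡.sym (ι-* (+ q) (+ #g s))) (≡.trans (≡.cong ι (q*#g-zero s≈0))
    (≡.trans (ι-+ (+ Q) (+ q₁ * X)) (≡.cong (ι (+ Q) ℚ.+_) (≡.trans (ι-* (+ q₁) X) (≡.cong (ι (+ q₁) ℚ.*_) ιX)))))

  #g-nonzero : ∀ {s} → W s → ¬ (s ≈ 0#) → ι (+ q) ℚ.* ι (+ #g s) ≡ ι (+ Q) ℚ.- ι (+ Q) ℚ.* χ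
  #g-nonzero {s} s∈W s≉0 = ≡.trans (≡.sym (ι-* (+ q) (+ #g s))) (≡.trans (≡.cong ι (q*#g-nonzero s∈W s≉0))
    (≡.trans (ι-+ (+ Q) (- X)) (≡.cong (ι (+ Q) ℚ.+_) (≡.trans (ι-neg X) (≡.cong ℚ.-_ ιX)))))

open import Data.Nat using (_^_; _*_; _∸_)

-- Summation over U.

module Totals {c ℓ : Level} (R : CommutativeRing c ℓ) {p : ℕ} (pp : Prime p) (k q n : ℕ)
              (1≤k : 1 ≤ k) (q≡p^k : q ≡ p ^ k) (1≤n : 1 ≤ n)
              (FF : IsFiniteFieldOfSize R (q ^ (2 * n)))
              (a : Fin n → CommutativeRing.Carrier R)
              (dim : CommutativeRing.Carrier R → ℕ)
              (dimension : (υ : CommutativeRing.Carrier R) → Setup.InU R q n a υ →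
                Setup.HasDimension R q n a (Setup.InKer R q n a υ) (dim υ)) where
  open CommutativeRing R using (Carrier; _≈_; 0#; 1#; -_; refl; trans; sym; +-cong; +-congˡ; +-congʳ; *-congˡ; *-congʳ;
      zeroʳ; +-identityˡ; +-identityʳ; *-assoc; *-comm; *-identityʳ; -‿cong; -‿inverseˡ; -‿inverseʳ; +-comm)
    renaming (_+_ to _⊕_; _*_ to _⊛_)
  open Forms R pp k q n 1≤k q≡p^k 1≤n FF a
  open Setup.Count R q n a FF using (N; Ulist; SumU)
  open Reindex R FF
  open Dimension R pp k q n 1≤k q≡p^k 1≤n FF a using (F-+)
  open import Relation.Binary.Reasoning.Setoid (CommutativeRing.setoid R)
  open import Algebra.Properties.CommutativeSemigroup (CommutativeRing.+-commutativeSemigroup R) using (interchange)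
  private module ∑ℚ = FieldSum R FF ℚ.+-0-commutativeMonoid

  U? : ∀ υ → Dec (InU υ)
  U? υ = pow R υ (q ℕ.+ 1) ≟ 1#

  -- From υ z^q = -z, the q-th power gives υ^q z = -z^q because z^(q^2) = z. Multiplying by υ yields
  -- υ^(q+1) z = -υ z^q = z.
  unitary : ∀ {z υ} → F z → ¬ (z ≈ 0#) → z ⊕ υ ⊛ σ 1 z ≈ 0# → InU υ
  unitary {z} {υ} z∈F z≉0 h = *-cancelˡ z≉0 (begin
    z ⊛ pow R υ (q ℕ.+ 1)      ≈⟨ *-congˡ (trans (pow-≡ υ (ℕ.+-comm q 1)) (*-congˡ (pow-q υ))) ⟩
    z ⊛ (υ ⊛ σ 1 υ)            ≈⟨ trans (*-comm _ _) (*-assoc _ _ _) ⟩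
    υ ⊛ (σ 1 υ ⊛ z)            ≈⟨ *-congˡ (*-congˡ (trans (σ-∘ 1 1 z) z∈F)) ⟨
    υ ⊛ (σ 1 υ ⊛ σ 1 (σ 1 z))  ≈⟨ *-congˡ (trans (sym (σ-* 1 υ _)) (trans (σ-cong 1 υσz≈-z) (σ-neg 1 z))) ⟩
    υ ⊛ - σ 1 z                ≈⟨ -‿distribʳ-* _ _ ⟨
    - (υ ⊛ σ 1 z)              ≈⟨ trans (-‿cong υσz≈-z) (-‿involutive z) ⟩
    z                          ≈⟨ *-identityʳ z ⟨
    z ⊛ 1#                     ∎)
    where
    υσz≈-z : υ ⊛ σ 1 z ≈ - z
    υσz≈-z = inverseʳ-unique z _ h

  module _ (c : Carrier) (c∈F : F c) where
    f : Carrier → Carrier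
    f x = B x x ⊕ c

    f∈F : ∀ x → F (f x)
    f∈F x = F-+ (Tr∈F _) c∈F

    Hit : Carrier → Carrier → Set ℓ
    Hit υ x = InU υ × (f x ⊕ υ ⊛ σ 1 (f x) ≈ 0#)

    hit? : ∀ υ x → Dec (Hit υ x)
    hit? υ x = U? υ ×-dec ((f x ⊕ υ ⊛ σ 1 (f x)) ≟ 0#)

    -- A nonzero z in F satisfies z + υ z^q = 0 for υ = -z^(1-q) ∈ U only, and z = 0 for every υ ∈ U.
    #hit-υ : ∀ x → # (λ υ → hit? υ x) ≡ when (f x ≟ 0#) q ℕ.+ 1
    #hit-υ x = count (f x ≟ 0#)
      where
      count : (fx≟0 : Dec (f x ≈ 0#)) → # (λ υ → hit? υ x) ≡ when fx≟0 q ℕ.+ 1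
      count (yes fx≈0) = ≡.trans (#-⇔ (λ υ → hit? υ x) U? (λ _ → proj₁) (λ υ h → h ,
        trans (+-cong fx≈0 (trans (*-congˡ (trans (σ-cong 1 fx≈0) (σ-0# 1))) (zeroʳ υ))) (+-identityʳ 0#))) #U
      count (no fx≉0) with *-move (σ≉0 1 fx≉0)
      ... | b , to , from = #-one (λ υ → hit? υ x) (b ⊛ - f x)
        (λ υ (_ , h) → to (trans (*-comm _ _) (inverseʳ-unique _ _ h)))
        (λ υ e → let h = trans (+-congˡ (trans (*-comm _ _) (from e))) (-‿inverseʳ _) in unitary (f∈F x) fx≉0 h , h)

    total-hits : Σℕ (λ υ → # (hit? υ)) ≡ q ℕ.* N c ℕ.+ Q
    total-hits = ≡.trans (#-swap hit?) (≡.trans (∑ℕ.∑ₗ-cong elems #hit-υ) (≡.trans (∑ℕ.∑ₗ-∙ elems _ _)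
      (≡.cong₂ ℕ._+_
        (≡.trans (Σℕ-when (λ x → f x ≟ 0#) q) (≡.trans (ℕ.*-comm _ q) (≡.cong (q ℕ.*_) (≡.sym (length-filter (λ x → f x ≟ 0#))))))
        (≡.trans (≡.sym (length-∑ₗ elems)) size))))

    module _ (υ : Carrier) (υ∈U : InU υ) where
      open Hermitian υ υ∈U
      open Values R pp k q n 1≤k q≡p^k 1≤n FF a υ υ∈U using (#g)

      -- Since f(x) + υ f(x)^q = g(x) + (c + υ c^q) once f includes c, a hit at υ means that g takes
      -- this value. The evaluation of g splits according to whether it is zero.
      level : Carrier
      level = - (c ⊕ υσ c)

      level∈W : W level
      level∈W = W-neg (τ∈W c∈F)

      level≈0 : c ⊕ υσ c ≈ 0# → level ≈ 0#
      level≈0 h = trans (-‿cong h) -0#≈0#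

      level≈0⁻¹ : level ≈ 0# → c ⊕ υσ c ≈ 0#
      level≈0⁻¹ h = trans (sym (-‿involutive _)) (trans (-‿cong h) -0#≈0#)

      #hit-x : # (hit? υ) ≡ #g level
      #hit-x = #-⇔ (hit? υ) (λ x → g x ≟ level)
        (λ x (_ , h) → inverseˡ-unique _ _ (trans (sym (regroup x)) h))
        (λ x h → υ∈U , trans (regroup x) (trans (+-congʳ h) (-‿inverseˡ _)))
        where
        regroup : ∀ x → f x ⊕ υ ⊛ σ 1 (f x) ≈ g x ⊕ (c ⊕ υσ c)
        regroup x = begin
          (B x x ⊕ c) ⊕ υσ (B x x ⊕ c)              ≈⟨ +-congˡ (υσ-+ _ _) ⟩
          (B x x ⊕ c) ⊕ (υσ (B x x) ⊕ υσ c)         ≈⟨ interchange _ _ _ _ ⟩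
          (B x x ⊕ υσ (B x x)) ⊕ (c ⊕ υσ c)         ≈⟨ +-congʳ (trans (h≈B x x) (+-comm _ _)) ⟨
          g x ⊕ (c ⊕ υσ c)                          ∎

    #hit-none : ∀ υ → ¬ InU υ → # (hit? υ) ≡ 0
    #hit-none υ ¬U = #-none (hit? υ) (λ _ (υ∈U , _) → ¬U υ∈U)

  χ : Carrier → ℚ
  χ υ = negQPow q (n ∸ dim υ)

  q̂ Q̂ q̂₁ : ℚ
  q̂  = ι (+ q)
  Q̂  = ι (+ Q)
  q̂₁ = ι (+ q₁)

  q̂≡ : q̂ ≡ ι (+ 1) ℚ.+ q̂₁
  q̂≡ = ≡.trans (≡.cong (λ t → ι (+ t)) (≡.sym suc-q₁)) (ι-+ (+ 1) (+ q₁))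

  Σℚ : (Carrier → ℚ) → ℚ
  Σℚ = ∑ℚ.∑ᴷ

  private
    ∑ₗ-*ˡ : (xs : List Carrier) (t : ℚ) (w : Carrier → ℚ) → ∑ℚ.∑ₗ xs (λ x → t ℚ.* w x) ≡ t ℚ.* ∑ℚ.∑ₗ xs w
    ∑ₗ-*ˡ []       t w = ≡.sym (ℚ.*-zeroʳ t)
    ∑ₗ-*ˡ (x ∷ xs) t w = ≡.trans (≡.cong (t ℚ.* w x ℚ.+_) (∑ₗ-*ˡ xs t w)) (≡.sym (ℚ.*-distribˡ-+ t (w x) _))

    ι-∑ₗ : (xs : List Carrier) (w : Carrier → ℕ) → ι (+ ∑ℕ.∑ₗ xs w) ≡ ∑ℚ.∑ₗ xs (λ x → ι (+ w x))
    ι-∑ₗ []       w = ≡.sym (ℕ→ℚ≡ι 0)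
    ι-∑ₗ (x ∷ xs) w = ≡.trans (ι-+ (+ w x) (+ ∑ℕ.∑ₗ xs w)) (≡.cong (ι (+ w x) ℚ.+_) (ι-∑ₗ xs w))

    sumℚ-map : (xs : List Carrier) (w : Carrier → ℚ) → sumℚ (map w xs) ≡ ∑ℚ.∑ₗ xs w
    sumℚ-map []       w = ≡.refl
    sumℚ-map (x ∷ xs) w = ≡.cong (w x ℚ.+_) (sumℚ-map xs w)

    ι-when : {P : Set ℓ} (P? : Dec P) (j : ℕ) → ι (+ when P? j) ≡ ∑ℚ.when P? (ι (+ j))
    ι-when (yes _) j = ≡.refl
    ι-when (no _)  j = ≡.sym (ℕ→ℚ≡ι 0)

  constant weight : Carrier → ℚ
  constant υ = ∑ℚ.when (U? υ) Q̂
  weight υ   = ∑ℚ.when (U? υ) (χ υ)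

  SumU≡ : SumU dim ≡ Σℚ weight
  SumU≡ = ≡.trans (sumℚ-map Ulist χ) (∑ℚ.∑ₗ-filter U? elems χ)

  Σ-U : Σℚ constant ≡ q̂ ℚ.* Q̂ ℚ.+ Q̂
  Σ-U = ≡.trans (∑ℚ.∑ₗ-cong elems (λ υ → ≡.sym (ι-when (U? υ) Q))) (≡.trans (≡.sym (ι-∑ₗ elems (λ υ → when (U? υ) Q)))
    (≡.trans (≡.cong (λ t → ι (+ t)) (≡.trans (Σℕ-when U? Q) (≡.trans (≡.cong (ℕ._* Q) #U)
      (≡.trans (ℕ.*-distribʳ-+ Q q 1) (≡.cong (q ℕ.* Q ℕ.+_) (ℕ.+-identityʳ Q))))))
    (≡.trans (ι-+ (+ (q ℕ.* Q)) (+ Q)) (≡.cong (ℚ._+ Q̂) (≡.trans (≡.cong ι (ℤ.pos-* q Q)) (ι-* (+ q) (+ Q)))))))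

  sum-hits : ∀ c (c∈F : F c) → Σℚ (λ υ → q̂ ℚ.* ι (+ # (hit? c c∈F υ))) ≡ q̂ ℚ.* (q̂ ℚ.* ι (+ N c) ℚ.+ Q̂)
  sum-hits c c∈F = ≡.trans (∑ₗ-*ˡ elems q̂ _) (≡.cong (q̂ ℚ.*_) (≡.trans (≡.sym (ι-∑ₗ elems _))
    (≡.trans (≡.cong (λ t → ι (+ t)) (total-hits c c∈F)) (≡.trans (ι-+ (+ (q ℕ.* N c)) (+ Q))
      (≡.cong (ℚ._+ Q̂) (≡.trans (≡.cong ι (ℤ.pos-* q (N c))) (ι-* (+ q) (+ N c))))))))

  Ê : ℚ
  Ê = ι (+ (q ^ (2 * (n ∸ 1))))

  private
    ι-^suc : ∀ j → ι (+ (q ^ suc j)) ≡ q̂ ℚ.* ι (+ (q ^ j))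
    ι-^suc j = ≡.trans (≡.cong ι (ℤ.pos-* q (q ^ j))) (ι-* (+ q) (+ (q ^ j)))

    2n≡ : 2 * n ≡ suc (suc (2 * (n ∸ 1)))
    2n≡ = ≡.trans (≡.cong (2 *_) (≡.sym (ℕ.m+[n∸m]≡n 1≤n))) (double (n ∸ 1))
      where
      double : ∀ j → 2 ℕ.* suc j ≡ suc (suc (2 ℕ.* j))
      double = solve-∀

  Q̂≡ : Q̂ ≡ q̂ ℚ.* (q̂ ℚ.* Ê)
  Q̂≡ = ≡.trans (≡.cong (λ j → ι (+ (q ^ j))) 2n≡) (≡.trans (ι-^suc (suc (2 * (n ∸ 1)))) (≡.cong (q̂ ℚ.*_) (ι-^suc (2 * (n ∸ 1)))))

  q^[2n-1] : ι (+ (q ^ (2 * n ∸ 1))) ≡ q̂ ℚ.* Ê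
  q^[2n-1] = ≡.trans (≡.cong (λ j → ι (+ (q ^ (j ∸ 1)))) 2n≡) (ι-^suc (2 * (n ∸ 1)))

  private
    0∈F : F 0#
    0∈F = σ-0# 2

    pointwise-zero : ∀ υ (U?υ : Dec (InU υ)) → q̂ ℚ.* ι (+ # (hit? 0# 0∈F υ)) ≡
                     ∑ℚ.when U?υ Q̂ ℚ.+ (q̂₁ ℚ.* Q̂) ℚ.* ∑ℚ.when U?υ (χ υ)
    pointwise-zero υ (yes υ∈U) = ≡.trans (≡.cong (λ t → q̂ ℚ.* ι (+ t)) (#hit-x 0# 0∈F υ υ∈U))
      (≡.trans (Evaluation.#g-zero R pp k q n 1≤k q≡p^k 1≤n FF a υ υ∈U (dim υ) (dimension υ υ∈U)
        (level≈0 0# 0∈F υ υ∈U (trans (+-identityˡ _) (trans (*-congˡ (σ-0# 1)) (zeroʳ υ)))))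
      (≡.cong (Q̂ ℚ.+_) (≡.sym (ℚ.*-assoc q̂₁ Q̂ (χ υ)))))
    pointwise-zero υ (no ¬U) = ≡.trans (≡.cong (λ t → q̂ ℚ.* ι (+ t)) (#hit-none 0# 0∈F υ ¬U))
      (≡.trans (≡.cong (q̂ ℚ.*_) (≡.sym (ℕ→ℚ≡ι 0))) (≡.trans (ℚ.*-zeroʳ q̂)
        (≡.sym (≡.trans (ℚ.+-identityˡ _) (ℚ.*-zeroʳ (q̂₁ ℚ.* Q̂))))))

  q²N₀ : q̂ ℚ.* (q̂ ℚ.* ι (+ N 0#)) ≡ q̂ ℚ.* (q̂ ℚ.* (Ê ℚ.+ (q̂₁ ℚ.* Ê) ℚ.* SumU dim))
  q²N₀ = total-zero q̂ (ι (+ N 0#)) Q̂ (SumU dim) q̂₁ Ê Q̂≡ (≡.trans (≡.sym (sum-hits 0# 0∈F))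
    (≡.trans (∑ℚ.∑ₗ-cong elems (λ υ → pointwise-zero υ (U? υ))) (≡.trans (∑ℚ.∑ₗ-∙ elems constant (λ υ → (q̂₁ ℚ.* Q̂) ℚ.* weight υ))
      (≡.cong₂ ℚ._+_ Σ-U (≡.trans (∑ₗ-*ˡ elems (q̂₁ ℚ.* Q̂) weight) (≡.cong ((q̂₁ ℚ.* Q̂) ℚ.*_) (≡.sym SumU≡)))))))

  -- The kernels for υ ≈ υ′ have the same number of elements, hence the same dimension.
  dim-cong : ∀ {υ υ′} → InU υ → InU υ′ → υ ≈ υ′ → dim υ ≡ dim υ′
  dim-cong {υ} {υ′} υ∈U υ′∈U e = ℕ.*-cancelˡ-≡ (dim υ) (dim υ′) 2 (ℕ.≤-antisym
    (^-cancelʳ-≤ q 2≤q (ℕ.≤-reflexive same)) (^-cancelʳ-≤ q 2≤q (ℕ.≤-reflexive (≡.sym same))))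
    where
    module E  = Evaluation R pp k q n 1≤k q≡p^k 1≤n FF a υ υ∈U (dim υ) (dimension υ υ∈U)
    module E′ = Evaluation R pp k q n 1≤k q≡p^k 1≤n FF a υ′ υ′∈U (dim υ′) (dimension υ′ υ′∈U)
    same : q ^ (2 * dim υ) ≡ q ^ (2 * dim υ′)
    same = ≡.trans (≡.sym E.#ker) (≡.trans (#-⇔ E.ker? E′.ker?
      (λ _ h → trans (+-congʳ (*-congʳ (sym e))) h) (λ _ h → trans (+-congʳ (*-congʳ e)) h)) E′.#ker)

  module _ (c : Carrier) (c∈F : F c) (c≉0 : ¬ (c ≈ 0#)) (w : Carrier) (w≈ : w ⊛ pow R c q₁ ≈ 1#) where
    -- As w c^(q-1) = 1, w is c^(1-q) and this is the argument -c^(1-q) of R in the theorem. It is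
    -- the only υ at which `level` vanishes.
    υ₀ : Carrier
    υ₀ = - w

    υ₀-root : c ⊕ υ₀ ⊛ σ 1 c ≈ 0#
    υ₀-root = begin
      c ⊕ - w ⊛ σ 1 c                  ≈⟨ +-congˡ (-‿distribˡ-* _ _) ⟨
      c ⊕ - (w ⊛ σ 1 c)                ≈⟨ +-congˡ (-‿cong (*-congˡ (trans (sym (pow-q c)) (pow-≡ c (≡.sym suc-q₁))))) ⟩
      c ⊕ - (w ⊛ (c ⊛ pow R c q₁))     ≈⟨ +-congˡ (-‿cong (x∙yz≈y∙xz w c _)) ⟩
      c ⊕ - (c ⊛ (w ⊛ pow R c q₁))     ≈⟨ +-congˡ (-‿cong (trans (*-congˡ w≈) (*-identityʳ c))) ⟩
      c ⊕ - c                          ≈⟨ -‿inverseʳ c ⟩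
      0#                               ∎
      where open import Algebra.Properties.CommutativeSemigroup (CommutativeRing.*-commutativeSemigroup R) using (x∙yz≈y∙xz)

    υ₀∈U : InU υ₀
    υ₀∈U = unitary c∈F c≉0 υ₀-root

    υ₀-unique : ∀ {υ} → c ⊕ υ ⊛ σ 1 c ≈ 0# → υ ≈ υ₀
    υ₀-unique {υ} h = *-cancelˡ (σ≉0 1 c≉0) (trans (*-comm _ _) (trans (trans (inverseʳ-unique c _ h)
      (sym (inverseʳ-unique c _ υ₀-root))) (*-comm _ _)))

    private
      -- Every υ ∈ U receives the value for a nonzero level, and υ₀ the surplus computed in
      -- `absorb`. The surplus is written with `χ υ₀` so that it is a constant that `delta` can sum;
      -- at υ ≈ υ₀ the dimension is carried over by `dim-cong`.
      pointwise : ∀ υ (U?υ : Dec (InU υ)) (υ≟υ₀ : Dec (υ ≈ υ₀)) → q̂ ℚ.* ι (+ # (hit? c c∈F υ)) ≡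
                  (∑ℚ.when U?υ Q̂ ℚ.+ (ℚ.- Q̂) ℚ.* ∑ℚ.when U?υ (χ υ)) ℚ.+ ∑ℚ.when υ≟υ₀ (q̂ ℚ.* (Q̂ ℚ.* χ υ₀))
      pointwise υ (yes υ∈U) (yes e) = ≡.trans (≡.cong (λ t → q̂ ℚ.* ι (+ t)) (#hit-x c c∈F υ υ∈U))
        (≡.trans (Evaluation.#g-zero R pp k q n 1≤k q≡p^k 1≤n FF a υ υ∈U (dim υ) (dimension υ υ∈U)
          (level≈0 c c∈F υ υ∈U (trans (+-congˡ (*-congʳ e)) υ₀-root)))
        (≡.trans (value-at-root Q̂ (χ υ))
          (≡.cong (λ d → (Q̂ ℚ.+ (ℚ.- Q̂) ℚ.* χ υ) ℚ.+ q̂ ℚ.* (Q̂ ℚ.* negQPow q (n ∸ d))) (dim-cong υ∈U υ₀∈U e))))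
        where
        value-at-root : ∀ Q χ → Q ℚ.+ q̂₁ ℚ.* (Q ℚ.* χ) ≡ (Q ℚ.+ (ℚ.- Q) ℚ.* χ) ℚ.+ q̂ ℚ.* (Q ℚ.* χ)
        value-at-root Q χ = ≡.trans (absorb Q χ q̂₁) (≡.cong (λ t → (Q ℚ.+ (ℚ.- Q) ℚ.* χ) ℚ.+ t ℚ.* (Q ℚ.* χ)) (≡.sym q̂≡))
      pointwise υ (yes υ∈U) (no ¬e) = ≡.trans (≡.cong (λ t → q̂ ℚ.* ι (+ t)) (#hit-x c c∈F υ υ∈U))
        (≡.trans (Evaluation.#g-nonzero R pp k q n 1≤k q≡p^k 1≤n FF a υ υ∈U (dim υ) (dimension υ υ∈U)
          (level∈W c c∈F υ υ∈U) (λ h → ¬e (υ₀-unique (level≈0⁻¹ c c∈F υ υ∈U h))))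
        (≡.trans (≡.cong (Q̂ ℚ.+_) (ℚ.neg-distribˡ-* Q̂ (χ υ))) (≡.sym (ℚ.+-identityʳ _))))
      pointwise υ (no ¬U) (yes e) = ⊥-elim (¬U (trans (pow-cong (q ℕ.+ 1) e) υ₀∈U))
      pointwise υ (no ¬U) (no _)  = ≡.trans (≡.cong (λ t → q̂ ℚ.* ι (+ t)) (#hit-none c c∈F υ ¬U))
        (≡.trans (≡.cong (q̂ ℚ.*_) (≡.sym (ℕ→ℚ≡ι 0))) (≡.trans (ℚ.*-zeroʳ q̂)
          (≡.sym (≡.trans (ℚ.+-identityʳ _) (≡.trans (ℚ.+-identityˡ _) (ℚ.*-zeroʳ (ℚ.- Q̂)))))))

    q²N : q̂ ℚ.* (q̂ ℚ.* ι (+ N c)) ≡ q̂ ℚ.* (q̂ ℚ.* (Ê ℚ.+ (q̂ ℚ.* Ê) ℚ.* χ υ₀ ℚ.- Ê ℚ.* SumU dim))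
    q²N = total-nonzero q̂ (ι (+ N c)) Q̂ (SumU dim) (χ υ₀) Ê Q̂≡ (≡.trans (≡.sym (sum-hits c c∈F))
      (≡.trans (∑ℚ.∑ₗ-cong elems (λ υ → pointwise υ (U? υ) (υ ≟ υ₀)))
      (≡.trans (∑ℚ.∑ₗ-∙ elems (λ υ → constant υ ℚ.+ (ℚ.- Q̂) ℚ.* weight υ) (λ υ → ∑ℚ.when (υ ≟ υ₀) (q̂ ℚ.* (Q̂ ℚ.* χ υ₀))))
        (≡.cong₂ ℚ._+_ (≡.trans (∑ℚ.∑ₗ-∙ elems constant (λ υ → (ℚ.- Q̂) ℚ.* weight υ)) (≡.cong₂ ℚ._+_ Σ-U
            (≡.trans (∑ₗ-*ˡ elems (ℚ.- Q̂) weight) (≡.cong ((ℚ.- Q̂) ℚ.*_) (≡.sym SumU≡)))))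
          (∑ℚ.delta υ₀ (q̂ ℚ.* (Q̂ ℚ.* χ υ₀)))))))

  q²-cancel : ∀ x y → q̂ ℚ.* (q̂ ℚ.* x) ≡ q̂ ℚ.* (q̂ ℚ.* y) → x ≡ y
  q²-cancel x y h = ι-*-cancelˡ q x y (ι-*-cancelˡ q (q̂ ℚ.* x) (q̂ ℚ.* y) h)

theorem4p1 : {c ℓ : Level} (R : CommutativeRing c ℓ) (p k q n : ℕ) →
    Prime p → 1 ≤ k → q ≡ p ^ k → 1 ≤ n →
    (FF : IsFiniteFieldOfSize R (q ^ (2 * n))) →
    (a : Fin n → CommutativeRing.Carrier R) →
    (dim : CommutativeRing.Carrier R → ℕ) →
    ((υ : CommutativeRing.Carrier R) → Setup.InU R q n a υ →
      Setup.HasDimension R q n a (Setup.InKer R q n a υ) (dim υ)) →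
    let module CR = CommutativeRing R
        open Setup R q n a
        open Count FF
    in (ℕ→ℚ (N CR.0#) ≡ ℕ→ℚ (q ^ (2 * (n ∸ 1)))
          ℚ.+ ℕ→ℚ ((q ∸ 1) * q ^ (2 * (n ∸ 1))) ℚ.* SumU dim)
     × ((cc : CR.Carrier) → InFq2 cc → ¬ (cc CR.≈ CR.0#) →
        (w : CR.Carrier) → (w CR.* pow R cc (q ∸ 1)) CR.≈ CR.1# →
        ℕ→ℚ (N cc) ≡ ℕ→ℚ (q ^ (2 * (n ∸ 1)))
          ℚ.+ ℕ→ℚ (q ^ (2 * n ∸ 1)) ℚ.* negQPow q (n ∸ dim (CR.- w))
          ℚ.- ℕ→ℚ (q ^ (2 * (n ∸ 1))) ℚ.* SumU dim)
theorem4p1 R p k q n pp 1≤k q≡p^k 1≤n FF a dim dimension =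
    ≡.trans (ℕ→ℚ≡ι (N 0#)) (≡.trans (q²-cancel _ _ q²N₀)
      (≡.sym (≡.cong₂ (λ s t → s ℚ.+ t ℚ.* SumU dim) (ℕ→ℚ≡ι E)
        (≡.trans (ℕ→ℚ≡ι (q₁ * E)) (≡.trans (≡.cong ι (ℤ.pos-* q₁ E)) (ι-* (+ q₁) (+ E)))))))
  , λ c c∈F c≉0 w w≈ → ≡.trans (ℕ→ℚ≡ι (N c)) (≡.trans (q²-cancel _ _ (q²N c c∈F c≉0 w w≈))
      (≡.sym (≡.cong₂ (λ s t → s ℚ.+ t ℚ.* negQPow q (n ∸ dim (- w)) ℚ.- s ℚ.* SumU dim) (ℕ→ℚ≡ι E)
        (≡.trans (ℕ→ℚ≡ι (q ^ (2 * n ∸ 1))) q^[2n-1]))))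
  where
  open CommutativeRing R using (0#; -_)
  open Totals R pp k q n 1≤k q≡p^k 1≤n FF a dim dimension
  open Setup.Count R q n a FF using (N; SumU)
  E q₁ : ℕ
  E  = q ^ (2 * (n ∸ 1))
  q₁ = q ∸ 1
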